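{- Let $G$ be a unicyclic graph with cycle length $\ell$ such that there are $k\geq 2$ vertices of the cycle with degree at least $3$. If both $k$ and $\ell$ are even, then $\operatorname{mob}(G) \leq \frac{k}{2}+2$ and this is tight.
   Context: Graphs are connected and simple. A set $S\subseteq V(G)$ is a general position set if no three distinct vertices of $S$ lie on a common shortest path. Place a robot on each vertex of a general position set $S$; robots move one at a time, a move being legal if the robot moves to an adjacent unoccupied vertex and the new set of occupied vertices is again in general position. $S$ is a mobile general position set if some sequence of legal moves lets every vertex of $G$ be visited by at least one robot. $\operatorname{mob}(G)$ denotes the largest cardinality of a mobile general position set of $G$. -}

module Defs where

open import Data.Nat using (ℕ; zero; suc; _≤_; _≤ᵇ_)
open import Data.Bool using (Bool; true; false)
open import Data.Fin using (Fin; toℕ)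
open import Data.Fin.Subset using (Subset; _∈_; _∉_; ∣_∣; inside; outside)
open import Data.Vec using (_[_]≔_)
open import Data.List using (List; []; _∷_; length; filterᵇ; allFin)
open import Data.List.Relation.Unary.Any using (Any)
open import Data.Product using (Σ; ∃; _×_; _,_)
open import Data.Sum using (_⊎_)
open import Relation.Nullary using (¬_)
open import Relation.Binary.PropositionalEquality using (_≡_; _≢_)
open import Function.Bundles using (_⇔_)

record Graph : Set where
  field
    n     : ℕ
    E     : Fin n → Fin n → Bool
    sym   : ∀ u v → E u v ≡ E v u
    irref : ∀ v → E v v ≡ false
open Graph public

module _ (G : Graph) where

  Adj : Fin (n G) → Fin (n G) → Set
  Adj u v = E G u v ≡ true

  data Walk : Fin (n G) → Fin (n G) → ℕ → Set where
    []  : ∀ v → Walk v v 0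
    _∷_ : ∀ {u w v m} → Adj u w → Walk w v m → Walk u v (suc m)

  _∈W_ : ∀ {u v m} → Fin (n G) → Walk u v m → Set
  x ∈W [] v = x ≡ v
  _∈W_ {u} x (_ ∷ P) = x ≡ u ⊎ x ∈W P

  Connected : Set
  Connected = ∀ u v → ∃ λ m → Walk u v m

  IsShortest : ∀ {u v m} → Walk u v m → Set
  IsShortest {u} {v} {m} _ = ∀ m' → Walk u v m' → m ≤ m'

  OnCommonGeodesic : Fin (n G) → Fin (n G) → Fin (n G) → Set
  OnCommonGeodesic x y z =
    Σ (Fin (n G)) λ a → Σ (Fin (n G)) λ b → Σ ℕ λ m → Σ (Walk a b m) λ P →
      IsShortest P × x ∈W P × y ∈W P × z ∈W P

  GeneralPosition : Subset (n G) → Set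
  GeneralPosition S = ∀ x y z → x ∈ S → y ∈ S → z ∈ S →
    x ≢ y → y ≢ z → x ≢ z → ¬ OnCommonGeodesic x y z

  Move : Subset (n G) → Subset (n G) → Set
  Move S S' = Σ (Fin (n G)) λ u → Σ (Fin (n G)) λ v →
    u ∈ S × v ∉ S × Adj u v ×
    S' ≡ ((S [ u ]≔ outside) [ v ]≔ inside) × GeneralPosition S'

  data Run : Subset (n G) → List (Subset (n G)) → Set where
    done : ∀ {S} → Run S []
    step : ∀ {S S' rest} → Move S S' → Run S' rest → Run S (S' ∷ rest)

  Mobile : Subset (n G) → Set
  Mobile S = GeneralPosition S × Σ (List (Subset (n G))) λ rest →
    Run S rest × (∀ x → Any (λ T → x ∈ T) (S ∷ rest))

  IsMob : ℕ → Set
  IsMob m = (Σ (Subset (n G)) λ S → Mobile S × ∣ S ∣ ≡ m)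
          × (∀ S → Mobile S → ∣ S ∣ ≤ m)

  degree : Fin (n G) → ℕ
  degree v = length (filterᵇ (E G v) (allFin (n G)))

Succ : (ℓ : ℕ) → Fin ℓ → Fin ℓ → Set
Succ ℓ i j = suc (toℕ i) ≡ toℕ j ⊎ (suc (toℕ i) ≡ ℓ × toℕ j ≡ 0)

record Cycle (G : Graph) (ℓ : ℕ) : Set where
  field
    len≥3 : 3 ≤ ℓ
    vert  : Fin ℓ → Fin (n G)
    inj   : ∀ i j → vert i ≡ vert j → i ≡ j
    adj   : ∀ i j → Succ ℓ i j → Adj G (vert i) (vert j)
open Cycle public

CycEdge : ∀ {G ℓ} → Cycle G ℓ → Fin (n G) → Fin (n G) → Set
CycEdge {ℓ = ℓ} C u v = Σ (Fin ℓ) λ i → Σ (Fin ℓ) λ j → Succ ℓ i j ×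
  ((vert C i ≡ u × vert C j ≡ v) ⊎ (vert C i ≡ v × vert C j ≡ u))

-- G is unicyclic with unique cycle C: G is connected and every cycle of G
-- is C (same edge set, i.e. the same subgraph)
UnicyclicWith : ∀ {ℓ} (G : Graph) → Cycle G ℓ → Set
UnicyclicWith G C = Connected G ×
  (∀ ℓ' (C' : Cycle G ℓ') → ∀ u v → CycEdge C u v ⇔ CycEdge C' u v)

bigCycleVertices : ∀ {G ℓ} → Cycle G ℓ → ℕ
bigCycleVertices {G} {ℓ} C =
  length (filterᵇ (λ i → 3 ≤ᵇ degree G (vert C i)) (allFin ℓ))

{-# OPTIONS --safe #-}
module Submission where

-- The graph is a cycle of length 2h with trees hanging from it, 2κ of them nontrivial.
--
-- Upper bound. Two robots in one tree and any third robot have a median vertex that separates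
-- them pairwise; it can never be visited. So every tree always holds at most one robot. A robot
-- on the cycle forces the feet of all others into an arc of less than half the cycle that avoids
-- it, and with four or more robots at most two are on the cycle. Hence with κ + 3 robots there
-- are, at any time when the cycle is occupied, at least κ + 1 robots in trees, inside a short arc.
-- Choose a position 0 inside this arc such that each of the two open half circles next to it
-- has at most κ of the trees. A group of κ + 1 robots in trees inside a short arc around 0 then
-- has robots on both sides of 0. One robot joining or leaving the group at a time, the arc it
-- spans can therefore never move off 0, and the cycle vertex at 0 is never visited.
--
-- Tightness. On a cycle of length 2κ + 2 with pendant vertices at the positions 1, …, 2κ, let
-- κ + 1 robots occupy consecutive pendant vertices while one more robot patrols the rest of
-- the cycle. When it enters the pendant vertex after the group, the first robot of the
-- group becomes the new patrolling robot, so the group slides over all the pendant vertices.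

-- The obstacle in the upper bound is the empty cycle: while all robots are in trees, no cycle robot
-- holds their feet in a short arc. But a move inside a tree keeps the foot, so the feet stay where
-- they were when the last robot left the cycle. For this case the invariant speaks about each robot
-- that may be the next to step down.
--
-- A group needs `κ + 1` members because each half circle offers at most `κ` feet. The positions `0`
-- and `h` lie in neither half: a robot over `0` spans `0` by itself, and a robot over `h` would
-- have the cycle robot between itself and one end of the arc.
--
-- Moves are reversible between general positions, so a mobile set can reach every vertex from every
-- configuration of its tour. The origin may therefore be fixed at a convenient moment.

open import Defs hiding (sym)
open import Data.Bool using (Bool; true; false)
open import Data.Bool.Properties using (T-≡; T?; ∨-comm) renaming (_≟_ to _≟ᵇ_)
open import Data.Empty using (⊥; ⊥-elim)
open import Data.Fin using (Fin; zero; suc; toℕ; fromℕ<; splitAt; _↑ˡ_; _↑ʳ_)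
open import Data.Fin.Properties using (any?; toℕ-injective; toℕ-fromℕ<; toℕ<n; splitAt-↑ˡ; splitAt-↑ʳ; splitAt⁻¹-↑ˡ; splitAt⁻¹-↑ʳ; ↑ˡ-injective) renaming (_≟_ to _≟ᶠ_; suc-injective to sucᶠ-injective)
open import Data.Fin.Subset using (Subset; _∈_; _∉_; ∣_∣; inside; outside)
open import Data.Fin.Subset.Properties using (_∈?_)
open import Data.List using (List; []; _∷_; length; map; filter; filterᵇ; lookup; allFin)
open import Data.List.Membership.DecPropositional using () renaming (_∈?_ to ∈?-with)
open import Data.List.Membership.Propositional using (find) renaming (_∈_ to _∈ˡ_)
open import Data.List.Membership.Propositional.Properties using (∈-map⁺; ∈-map⁻; ∈-filter⁺; ∈-filter⁻; ∈-lookup; ∈-allFin; ∈-++⁻)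
open import Data.List.Properties using (length-map; length-++; length-tabulate)
open import Data.Nat using (ℕ; zero; suc; pred; _+_; _*_; _∸_; _/_; _⊓_; _⊔_; ∣_-_∣; _≤_; _<_; _≤ᵇ_; z≤n; s≤s; s≤s⁻¹; >-nonZero)
open import Data.Nat.Divisibility using (_∣_; divides)
open import Data.Nat.DivMod using (m*n/n≡m)
open import Data.Nat.Properties
open import Data.Nat.Tactic.RingSolver using (solve)
open import Data.Product using (Σ; ∃; _×_; _,_; proj₁; proj₂)
open import Data.Sum using (_⊎_; inj₁; inj₂; swap; [_,_]′)
open import Data.Unit using (⊤; tt)
open import Function using (_∘_; id)
open import Function.Bundles using (mk⇔; Equivalence)
open import Relation.Binary.Construct.Closure.ReflexiveTransitive as Star using (Star; ε; _◅_; _◅◅_)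
open import Relation.Binary.Definitions using (tri<; tri≈; tri>)
open import Relation.Binary.PropositionalEquality using (_≡_; _≢_; refl; sym; trans; cong; cong₂; subst; subst₂; module ≡-Reasoning)
open import Relation.Nullary using (¬_; Dec; yes; no; contradiction; does)
open import Relation.Nullary.Decidable using (map′; _×-dec_; _⊎-dec_; ¬?; dec-true; dec-false)
open import Relation.Unary using (Decidable)

-- Distances and arcs on the cycle

infixl 5 _⊹_
_⊹_ : ∀ {a b c d} → a ≤ b → c ≤ d → a + c ≤ b + d
_⊹_ = +-mono-≤

abstract

  -- A certificate check for linear arithmetic. Hypotheses and the negated goal are added up with
  -- `⊹`, each as often as its multiplier, and the ring solver confirms that the left total exceeds
  -- the right total by `suc c`.
  gap : ∀ {a b} c → a ≤ b → a ≡ suc (b + c) → ⊥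
  gap c p refl = <-irrefl refl (≤-trans (s≤s (m≤m+n _ c)) p)

cd : ℕ → ℕ → ℕ → ℕ
cd ℓ a b = ∣ a - b ∣ ⊓ (ℓ ∸ ∣ a - b ∣)

cd-sym : ∀ ℓ a b → cd ℓ a b ≡ cd ℓ b a
cd-sym ℓ a b = cong (λ d → d ⊓ (ℓ ∸ d)) (∣-∣-comm a b)

cd-refl : ∀ ℓ a → cd ℓ a a ≡ 0
cd-refl ℓ a = cong (_⊓ (ℓ ∸ ∣ a - a ∣)) (m≡n⇒∣m-n∣≡0 {a} refl)

-- The direct arc, or the arc through the end of the numbering. Both are stated as sums for linear
-- arithmetic; under truncated subtraction the second is exact only for `b ≤ ℓ`.
cd-cases : ∀ {ℓ a b} → a ≤ b → (cd ℓ a b + a ≡ b) ⊎ (b ≤ ℓ → cd ℓ a b + b ≡ ℓ + a)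
cd-cases {ℓ} {a} {b} a≤b with m≤n⇒∣m-n∣≡n∸m a≤b | ⊓-sel ∣ a - b ∣ (ℓ ∸ ∣ a - b ∣)
... | e | inj₁ s = inj₁ (trans (cong (_+ a) (trans s e)) (m∸n+n≡m a≤b))
... | e | inj₂ s = inj₂ λ b≤ℓ → begin
  cd ℓ a b + b               ≡⟨ cong₂ _+_ (trans s (cong (ℓ ∸_) e)) (sym (m∸n+n≡m a≤b)) ⟩
  ℓ ∸ (b ∸ a) + (b ∸ a + a)  ≡⟨ +-assoc (ℓ ∸ (b ∸ a)) (b ∸ a) a ⟨
  ℓ ∸ (b ∸ a) + (b ∸ a) + a  ≡⟨ cong (_+ a) (m∸n+n≡m (≤-trans (m∸n≤m b a) b≤ℓ)) ⟩
  ℓ + a ∎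
  where open ≡-Reasoning

cd-≤ : ∀ {ℓ a b} → a ≤ b → cd ℓ a b + a ≤ b
cd-≤ {ℓ} {a} {b} a≤b = subst (cd ℓ a b + a ≤_) (m∸n+n≡m a≤b)
  (+-monoˡ-≤ a (subst (cd ℓ a b ≤_) (m≤n⇒∣m-n∣≡n∸m a≤b) (m⊓n≤m _ _)))

cd-≤′ : ∀ {ℓ a b} → a ≤ b → b ≤ ℓ → cd ℓ a b + b ≤ ℓ + a
cd-≤′ {ℓ} {a} {b} a≤b b≤ℓ = begin
  cd ℓ a b + b               ≤⟨ +-monoˡ-≤ b (m⊓n≤n ∣ a - b ∣ (ℓ ∸ ∣ a - b ∣)) ⟩
  ℓ ∸ ∣ a - b ∣ + b          ≡⟨ cong₂ _+_ (cong (ℓ ∸_) (m≤n⇒∣m-n∣≡n∸m a≤b)) (sym (m∸n+n≡m a≤b)) ⟩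
  ℓ ∸ (b ∸ a) + (b ∸ a + a)  ≡⟨ +-assoc (ℓ ∸ (b ∸ a)) (b ∸ a) a ⟨
  ℓ ∸ (b ∸ a) + (b ∸ a) + a  ≡⟨ cong (_+ a) (m∸n+n≡m (≤-trans (m∸n≤m b a) b≤ℓ)) ⟩
  ℓ + a ∎
  where open ≤-Reasoning

∣-∣-suc : ∀ a b → ∣ a - suc b ∣ ≤ suc ∣ a - b ∣
∣-∣-suc zero b = ≤-refl
∣-∣-suc (suc a) zero = ≤-trans (≤-reflexive (∣-∣-identityʳ a)) (m≤n+m a 2)
∣-∣-suc (suc a) (suc b) = ∣-∣-suc a b

∣-∣-pred : ∀ a b → ∣ a - b ∣ ≤ suc ∣ a - suc b ∣
∣-∣-pred zero b = m≤n+m b 2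
∣-∣-pred (suc a) zero = s≤s (≤-reflexive (sym (∣-∣-identityʳ a)))
∣-∣-pred (suc a) (suc b) = ∣-∣-pred a b

∸-suc-≤ : ∀ m d → m ∸ d ≤ suc (m ∸ suc d)
∸-suc-≤ m zero = m≤n+m∸n m 1
∸-suc-≤ zero (suc d) = z≤n
∸-suc-≤ (suc m) (suc d) = ∸-suc-≤ m d

⊓∸-lipschitz : ∀ ℓ {p q} → p ≤ suc q → q ≤ suc p → p ⊓ (ℓ ∸ p) ≤ suc (q ⊓ (ℓ ∸ q))
⊓∸-lipschitz ℓ {p} {q} p≤ q≤ =
  ⊓-mono-≤ p≤ (≤-trans (∸-suc-≤ ℓ p) (s≤s (∸-monoʳ-≤ ℓ q≤)))

cd-wrap : ∀ {ℓ a i} → a < ℓ → suc i ≡ ℓ →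
          cd ℓ a 0 ≤ suc (cd ℓ a i) × cd ℓ a i ≤ suc (cd ℓ a 0)
cd-wrap {_} {a} {i} (s≤s a≤i) refl with m≤n⇒∃[o]m+o≡n a≤i
... | e , refl rewrite ∣-∣-identityʳ a | ∣m-m+n∣≡n a e
                     | trans (cong (_∸ a) (sym (+-suc a e))) (m+n∸m≡n a (suc e))
                     | m+n∸n≡m (suc a) e =
  ⊓-glb (m⊓n≤n a (suc e)) (m≤n⇒m≤1+n (m≤n⇒m≤1+n (m⊓n≤m a (suc e)))) ,
  ⊓-glb (m⊓n≤n e (suc a)) (m≤n⇒m≤1+n (m≤n⇒m≤1+n (m⊓n≤m e (suc a))))

cd-lipschitz : ∀ {ℓ a} → a < ℓ → (i j : Fin ℓ) → Succ ℓ i j ⊎ Succ ℓ j i →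
               cd ℓ a (toℕ j) ≤ suc (cd ℓ a (toℕ i))
cd-lipschitz {ℓ} {a} a<ℓ i j (inj₁ (inj₁ e)) = subst (λ t → cd ℓ a t ≤ _) e
  (⊓∸-lipschitz ℓ (∣-∣-suc a (toℕ i)) (∣-∣-pred a (toℕ i)))
cd-lipschitz {ℓ} {a} a<ℓ i j (inj₂ (inj₁ e)) = subst (λ t → _ ≤ suc (cd ℓ a t)) e
  (⊓∸-lipschitz ℓ (∣-∣-pred a (toℕ j)) (∣-∣-suc a (toℕ j)))
cd-lipschitz {ℓ} {a} a<ℓ i j (inj₁ (inj₂ (e , z))) rewrite z = proj₁ (cd-wrap a<ℓ e)
cd-lipschitz {ℓ} {a} a<ℓ i j (inj₂ (inj₂ (e , z))) rewrite z = proj₂ (cd-wrap a<ℓ e)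

-- b lies on a shortest arc from a to c of the cycle ℤ/2h (all of them below 2h), for a before c.
InArc : ℕ → ℕ → ℕ → ℕ → Set
InArc h a b c = (a < b × b < c × c ≤ a + h) ⊎ (a + h ≤ c × (b < a ⊎ c < b))

Arc : ℕ → ℕ → ℕ → ℕ → Set
Arc h a b c = InArc h a b c ⊎ InArc h c b a

arc-irrefl : ∀ {h a b} → 0 < h → ¬ Arc h a b a
arc-irrefl {h} {a} 0<h = λ { (inj₁ p) → go p ; (inj₂ p) → go p }
  where
  go : ∀ {b} → ¬ InArc h a b a
  go (inj₁ (p , q , _)) = <-asym p q
  go (inj₂ (p , _)) = <⇒≱ (m<m+n a 0<h) p

-- Subtraction of 1 modulo `suc L`.
rot : ℕ → ℕ → ℕ
rot L zero = L
rot L (suc r) = r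

rot-≤ : ∀ {L r} → r ≤ L → rot L r ≤ L
rot-≤ {r = zero} _ = ≤-refl
rot-≤ {r = suc r} p = <⇒≤ p

-- A point at `0` moves to the last place `L`. When it is an end of the arc, this exchanges the two
-- ends and the two alternatives of `InArc`, hence the symmetric `Arc` in the conclusion.
rot-arc : ∀ {L h a b c} → suc L ≡ h + h → a ≤ L → b ≤ L → c ≤ L →
          InArc h (rot L a) (rot L b) (rot L c) → Arc h a b c
rot-arc {a = zero} e _ b≤ _ (inj₁ (p , _)) = contradiction p (≤⇒≯ (rot-≤ b≤))
rot-arc {b = zero} e _ _ c≤ (inj₁ (_ , p , _)) = contradiction p (≤⇒≯ (rot-≤ c≤))
rot-arc {L} {h} {suc a} {suc b} {zero} e _ _ _ (inj₁ (p , _ , q)) =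
  inj₂ (inj₂ (≮⇒≥ (λ (lt : suc a < h) → absurd L h a lt q (≤-reflexive (sym e))) , inj₂ (s≤s p)))
  where
  absurd : ∀ L h a → suc a < h → L ≤ a + h → h + h ≤ suc L → ⊥
  absurd L h a p q r = gap 0 (p ⊹ q ⊹ r) (solve (L ∷ h ∷ a ∷ []))
rot-arc {a = suc a} {suc b} {suc c} e _ _ _ (inj₁ (p , q , r)) = inj₁ (inj₁ (s≤s p , s≤s q , s≤s r))
rot-arc {L} {zero} {zero} () _ _ _ (inj₂ _)
rot-arc {L} {suc h} {zero} e _ _ c≤ (inj₂ (p , _)) =
  contradiction (≤-trans p (rot-≤ c≤)) (<⇒≱ (m<m+n L (s≤s z≤n)))
rot-arc {L} {h} {suc a} {b} {zero} e a≤ b≤ _ (inj₂ (p , inj₂ q)) = contradiction q (≤⇒≯ (rot-≤ b≤))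
rot-arc {L} {h} {suc a} {zero} {zero} e a≤ _ _ (inj₂ (p , inj₁ q)) = contradiction (<⇒≤ a≤) (<⇒≱ q)
rot-arc {L} {h} {suc a} {suc b} {zero} e _ _ _ (inj₂ (p , inj₁ q)) =
  inj₂ (inj₁ (s≤s z≤n , s≤s q , ≮⇒≥ (λ (lt : h < suc a) → absurd L h a lt p (≤-reflexive e))))
  where
  absurd : ∀ L h a → h < suc a → a + h ≤ L → suc L ≤ h + h → ⊥
  absurd L h a p q r = gap 0 (p ⊹ q ⊹ r) (solve (L ∷ h ∷ a ∷ []))
rot-arc {a = suc a} {zero} {suc c} e a≤ _ c≤ (inj₂ (p , _)) = inj₁ (inj₂ (s≤s p , inj₁ (s≤s z≤n)))
rot-arc {a = suc a} {suc b} {suc c} e _ _ _ (inj₂ (p , inj₁ q)) = inj₁ (inj₂ (s≤s p , inj₁ (s≤s q)))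
rot-arc {a = suc a} {suc b} {suc c} e _ _ _ (inj₂ (p , inj₂ q)) = inj₁ (inj₂ (s≤s p , inj₂ (s≤s q)))

cd-arc : ∀ {h a b c} → a < h + h → b < h + h → c < h + h → InArc h a b c →
         cd (h + h) a b + cd (h + h) b c ≤ cd (h + h) a c
cd-arc {h} {a} {b} {c} _ _ c< (inj₁ (p , q , r))
  with cd-cases {h + h} (<⇒≤ (<-trans p q))
... | inj₁ e = near _ _ _ a b c (cd-≤ {h + h} (<⇒≤ p)) (cd-≤ {h + h} (<⇒≤ q)) (≤-reflexive (sym e))
  where
  near : ∀ u v w a b c → u + a ≤ b → v + b ≤ c → c ≤ w + a → u + v ≤ w
  near u v w a b c p q r = ≮⇒≥ λ (lt : w < u + v) → gap 0 (p ⊹ q ⊹ r ⊹ lt) (solve (u ∷ v ∷ w ∷ a ∷ b ∷ c ∷ []))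
... | inj₂ e = far _ _ _ a b c h (cd-≤ {h + h} (<⇒≤ p)) (cd-≤ {h + h} (<⇒≤ q)) r (≤-reflexive (sym (e (<⇒≤ c<))))
  where
  far : ∀ u v w a b c h → u + a ≤ b → v + b ≤ c → c ≤ a + h → h + h + a ≤ w + c → u + v ≤ w
  far u v w a b c h p q r s = ≮⇒≥ λ (lt : w < u + v) →
    gap 0 (p ⊹ q ⊹ r ⊹ r ⊹ s ⊹ lt) (solve (u ∷ v ∷ w ∷ a ∷ b ∷ c ∷ h ∷ []))
cd-arc {h} {a} {b} {c} a< b< c< (inj₂ (p , side)) =
  compare (cd-cases {h + h} a≤c) (sum side)
  where
  ℓ = h + h
  a≤c : a ≤ c
  a≤c = ≤-trans (m≤m+n a h) p
  left : ∀ u v a b c h → u + b ≤ a → v + c ≤ h + h + b → u + v + c ≤ h + h + a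
  left u v a b c h p q = ≮⇒≥ λ (lt : h + h + a < u + v + c) → gap 0 (p ⊹ q ⊹ lt) (solve (u ∷ v ∷ a ∷ b ∷ c ∷ h ∷ []))
  right : ∀ u v a b c h → u + b ≤ h + h + a → v + c ≤ b → u + v + c ≤ h + h + a
  right u v a b c h p q = ≮⇒≥ λ (lt : h + h + a < u + v + c) → gap 0 (p ⊹ q ⊹ lt) (solve (u ∷ v ∷ a ∷ b ∷ c ∷ h ∷ []))
  sum : b < a ⊎ c < b → cd ℓ a b + cd ℓ b c + c ≤ ℓ + a
  sum (inj₁ b<a) = left _ _ a b c h (subst (λ t → t + b ≤ a) (cd-sym ℓ b a) (cd-≤ {ℓ} (<⇒≤ b<a)))
    (cd-≤′ {ℓ} (≤-trans (<⇒≤ b<a) a≤c) (<⇒≤ c<))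
  sum (inj₂ c<b) = right _ _ a b c h (cd-≤′ {ℓ} (≤-trans a≤c (<⇒≤ c<b)) (<⇒≤ b<))
    (subst (λ t → t + c ≤ b) (cd-sym ℓ c b) (cd-≤ {ℓ} (<⇒≤ c<b)))
  compare : cd ℓ a c + a ≡ c ⊎ (c ≤ ℓ → cd ℓ a c + c ≡ ℓ + a) →
            cd ℓ a b + cd ℓ b c + c ≤ ℓ + a → cd ℓ a b + cd ℓ b c ≤ cd ℓ a c
  compare (inj₂ e) s = +-cancelʳ-≤ c _ _ (≤-trans s (≤-reflexive (sym (e (<⇒≤ c<)))))
  compare (inj₁ e) s = short _ (cd ℓ a c) a c h s p (≤-reflexive (sym e))
    where
    short : ∀ u w a c h → u + c ≤ h + h + a → a + h ≤ c → c ≤ w + a → u ≤ w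
    short u w a c h p q r = ≮⇒≥ λ (lt : w < u) → gap 0 (p ⊹ q ⊹ q ⊹ r ⊹ lt) (solve (u ∷ w ∷ a ∷ c ∷ h ∷ []))

wrap : ℕ → ℕ → ℕ
wrap h zero = h + h
wrap h (suc r) = suc r

-- With x read in (0, 2h], 0 lies on the arc from x to y, and this arc is shorter than h.
Straddles : ℕ → ℕ → ℕ → Set
Straddles h x y = y + h < wrap h x

module _ {h x y c : ℕ} (str : Straddles h x y) (x<2h : x < h + h) (c<2h : c < h + h) where

  private
    wrap-≤ : ∀ x → x < h + h → wrap h x ≤ h + h
    wrap-≤ zero _ = ≤-refl
    wrap-≤ (suc _) lt = <⇒≤ lt

  straddle-< : y < h
  straddle-< = +-cancelʳ-< h y h (<-≤-trans str (wrap-≤ x x<2h))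

  outside-arc : c ≢ x → c ≢ y → ¬ Arc h y c x → y < c × c < wrap h x
  outside-arc c≢x c≢y ¬arc = go x refl
    where
    y<c : ∀ r → x ≡ r → y < c
    y<c r e with <-cmp y c
    ... | tri< lt _ _ = lt
    ... | tri≈ _ eq _ = contradiction (sym eq) c≢y
    y<c zero refl | tri> _ _ gt = ⊥-elim (¬arc (inj₂ (inj₁ (n≢0⇒n>0 c≢x , gt , <⇒≤ straddle-<))))
    y<c (suc r) refl | tri> _ _ gt = ⊥-elim (¬arc (inj₁ (inj₂ (<⇒≤ str , inj₁ gt))))
    go : ∀ r → x ≡ r → y < c × c < wrap h x
    go zero refl = y<c zero refl , c<2h
    go (suc r) refl with <-cmp c (suc r)
    ... | tri< lt _ _ = y<c _ refl , lt
    ... | tri≈ _ eq _ = contradiction eq c≢x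
    ... | tri> _ _ gt = ⊥-elim (¬arc (inj₁ (inj₂ (<⇒≤ str , inj₂ gt))))

  beyond-arc : ∀ {z} → h ≤ z → z < c → c < wrap h x → Arc h x c z
  beyond-arc {z} h≤z z<c c<x = go x refl
    where
    go : ∀ r → x ≡ r → Arc h x c z
    go zero refl = inj₁ (inj₂ (h≤z , inj₂ z<c))
    go (suc r) refl = inj₂ (inj₁ (z<c , c<x , ≤-trans (<⇒≤ x<2h) (+-monoˡ-≤ h h≤z)))

  -- From `y` as from `x`, the way to the antipode `h` that avoids `0` has length at most `h`, so it
  -- is a shortest arc; `c` lies on one of these two.
  antipode-arc : y < c → c < wrap h x → c ≢ h → Arc h y c h ⊎ Arc h x c h
  antipode-arc y<c c<x c≢h with <-cmp c h
  ... | tri< lt _ _ = inj₁ (inj₁ (inj₁ (y<c , lt , m≤n+m h y)))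
  ... | tri≈ _ eq _ = contradiction eq c≢h
  ... | tri> _ _ gt = inj₂ (beyond-arc ≤-refl gt c<x)

  -- If the arc through `0` from `z` to `z′` were not shorter than `h`, the arc on the other side
  -- would be a shortest one. Wherever `c` is on the long way from `y` to `x`, it would then lie
  -- between `z′` and `z`, between `y` and `z′`, or between `x` and `z`.
  sides-straddle : ∀ {z z′} → y < c → c < wrap h x → h < z → z′ < h → c ≢ z → c ≢ z′ →
    ¬ Arc h z′ c z → ¬ Arc h y c z′ → ¬ Arc h x c z → Straddles h z z′
  sides-straddle {suc z} {z′} y<c c<x h<z z′<h c≢z c≢z′ ¬1 ¬2 ¬3 = ≰⇒> λ le → go le (<-cmp c z′) (<-cmp c (suc z))
    where
    go : suc z ≤ z′ + h → _ → _ → ⊥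
    go le (tri< lt _ _) _ = ¬2 (inj₁ (inj₁ (y<c , lt , ≤-trans (<⇒≤ z′<h) (m≤n+m h y))))
    go le (tri≈ _ eq _) _ = c≢z′ eq
    go le (tri> _ _ gt) (tri< lt _ _) = ¬1 (inj₁ (inj₁ (gt , lt , le)))
    go le _ (tri≈ _ eq _) = c≢z eq
    go le (tri> _ _ _) (tri> _ _ gt) = ¬3 (beyond-arc (<⇒≤ h<z) gt c<x)

-- For `b ≤ h` a shortest arc from `0` to `b` runs upwards over `a`; for `h ≤ b` one runs downwards
-- over `c`.
three-arc : ∀ {h a b c} → 0 < a → a < b → b < c → Arc h 0 a b ⊎ Arc h 0 c b
three-arc {h} {a} {b} {c} 0<a a<b b<c with ≤-total b h
... | inj₁ b≤h = inj₁ (inj₁ (inj₁ (0<a , a<b , b≤h)))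
... | inj₂ h≤b = inj₂ (inj₁ (inj₂ (h≤b , inj₂ b<c)))

-- The arithmetic cases of `off-arc`, with `u` and `v` the cyclic distances from `b` to `a` and to
-- `c`. Either `b` comes before `a` or after `c`, and each distance is bounded below by the direct
-- or by the wrapped formula.
before₁ : ∀ u v a b c → a ≤ u + b → c ≤ v + b → u + v + a ≤ c → b < a → ⊥
before₁ u v a b c p q r s = gap 1 (p ⊹ q ⊹ r ⊹ s ⊹ s) (solve (u ∷ v ∷ a ∷ b ∷ c ∷ []))
before₂ : ∀ u v a b c h → a ≤ u + b → h + h + b ≤ v + c → u + v + a ≤ c → c < a + h → ⊥
before₂ u v a b c h p q r s = gap 1 (p ⊹ q ⊹ r ⊹ s ⊹ s) (solve (u ∷ v ∷ a ∷ b ∷ c ∷ h ∷ []))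
before₃ : ∀ u v a b c h → h + h + b ≤ u + a → u + v + a ≤ c → c < h + h → ⊥
before₃ u v a b c h p q r = gap (b + v) (p ⊹ q ⊹ r) (solve (u ∷ v ∷ a ∷ b ∷ c ∷ h ∷ []))
after₁ : ∀ u v a b c → b ≤ u + a → u + v + a ≤ c → c < b → ⊥
after₁ u v a b c p q r = gap v (p ⊹ q ⊹ r) (solve (u ∷ v ∷ a ∷ b ∷ c ∷ []))
after₂ : ∀ u v a b c h → h + h + a ≤ u + b → b ≤ v + c → u + v + a ≤ c → c < a + h → ⊥
after₂ u v a b c h p q r s = gap 1 (p ⊹ q ⊹ r ⊹ s ⊹ s) (solve (u ∷ v ∷ a ∷ b ∷ c ∷ h ∷ []))
after₃ : ∀ u v a b c h → h + h + c ≤ v + b → u + v + a ≤ c → b < h + h → ⊥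
after₃ u v a b c h p q r = gap (u + a) (p ⊹ q ⊹ r) (solve (u ∷ v ∷ a ∷ b ∷ c ∷ h ∷ []))

cd-bounds : ∀ {ℓ a b} → a ≤ b → b ≤ ℓ → b ≤ cd ℓ a b + a ⊎ ℓ + a ≤ cd ℓ a b + b
cd-bounds {ℓ} a≤b b≤ℓ with cd-cases {ℓ} a≤b
... | inj₁ e = inj₁ (≤-reflexive (sym e))
... | inj₂ f = inj₂ (≤-reflexive (sym (f b≤ℓ)))

cd-boundsʳ : ∀ {ℓ a b} → a ≤ b → b ≤ ℓ → b ≤ cd ℓ b a + a ⊎ ℓ + a ≤ cd ℓ b a + b
cd-boundsʳ {ℓ} {a} {b} a≤b b≤ℓ =
  subst (λ d → b ≤ d + a ⊎ ℓ + a ≤ d + b) (cd-sym ℓ a b) (cd-bounds {ℓ} a≤b b≤ℓ)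

before : ∀ u v a b c h → a ≤ u + b ⊎ h + h + b ≤ u + a → c ≤ v + b ⊎ h + h + b ≤ v + c →
         u + v + a ≤ c → c < h + h → b < a → c < a + h → ⊥
before u v a b c h (inj₁ p) (inj₁ q) s _ lt _ = before₁ u v a b c p q s lt
before u v a b c h (inj₁ p) (inj₂ q) s _ _ lt = before₂ u v a b c h p q s lt
before u v a b c h (inj₂ p) _ s lt _ _ = before₃ u v a b c h p s lt

after : ∀ u v a b c h → b ≤ u + a ⊎ h + h + a ≤ u + b → b ≤ v + c ⊎ h + h + c ≤ v + b →
        u + v + a ≤ c → b < h + h → c < b → c < a + h → ⊥
after u v a b c h (inj₁ p) _ s _ lt _ = after₁ u v a b c p s lt
after u v a b c h (inj₂ p) (inj₁ q) s _ _ lt = after₂ u v a b c h p q s lt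
after u v a b c h (inj₂ p) (inj₂ q) s lt _ _ = after₃ u v a b c h q s lt

off-arc : ∀ {ℓ h a b c} → ℓ ≡ h + h → a < c → c < a + h → c < ℓ → b < ℓ → b < a ⊎ c < b →
          ¬ (cd ℓ a b + cd ℓ b c ≤ cd ℓ a c)
off-arc {ℓ} {h} {a} {b} {c} refl a<c c<a+h c<ℓ b<ℓ side le = go side
  where
  short : cd ℓ a b + cd ℓ b c + a ≤ c
  short = ≤-trans (+-monoˡ-≤ a le) (cd-≤ {ℓ} (<⇒≤ a<c))
  go : b < a ⊎ c < b → ⊥
  go (inj₁ b<a) = before (cd ℓ a b) (cd ℓ b c) a b c h
    (cd-boundsʳ {ℓ} (<⇒≤ b<a) (<⇒≤ (<-trans a<c c<ℓ))) (cd-bounds {ℓ} (<⇒≤ (<-trans b<a a<c)) (<⇒≤ c<ℓ))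
    short c<ℓ b<a c<a+h
  go (inj₂ c<b) = after (cd ℓ a b) (cd ℓ b c) a b c h
    (cd-bounds {ℓ} (<⇒≤ (<-trans a<c c<b)) (<⇒≤ b<ℓ)) (cd-boundsʳ {ℓ} (<⇒≤ c<b) (<⇒≤ b<ℓ))
    short b<ℓ c<b c<a+h

round : ∀ j a → suc (j + a) + suc (suc (j + a)) ≡ j + (2 + (a + suc (j + a)))
round j a = solve (j ∷ a ∷ [])

wrap-length : ∀ a b c → a + suc b + c ≡ suc (c + b) + a
wrap-length a b c = solve (a ∷ b ∷ c ∷ [])

through-length : ∀ a b c d → a + (b + 0) + (0 + (c + d)) ≡ a + (b + c + d)
through-length a b c d = solve (a ∷ b ∷ c ∷ d ∷ [])

segments-length : ∀ a b c d → a + b + (c + d) ≡ a + c + d + b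
segments-length a b c d = solve (a ∷ b ∷ c ∷ d ∷ [])

detour-length : ∀ a b c → a + (b + c) ≡ a + c + b
detour-length a b c = solve (a ∷ b ∷ c ∷ [])

-- Here `a`, `b`, `c` stand for depths and `p`, `q`, `r` for distances between feet. A route through
-- a vertex of depth `b` enters its tree and returns, which costs `b` twice, so the triangle
-- inequality leaves only `b ≡ 0`.
middle-on-cycle : ∀ a b c p q r → r ≤ p + q → a + (p + b) + (b + (q + c)) ≤ a + (r + c) → b ≡ 0 × p + q ≤ r
middle-on-cycle a zero c p q r _ h = refl ,
  ≮⇒≥ λ (lt : r < p + q) → gap 0 (h ⊹ lt) (solve (a ∷ c ∷ p ∷ q ∷ r ∷ []))
middle-on-cycle a (suc b) c p q r t h =
  ⊥-elim (gap (suc (b + b)) (h ⊹ t) (solve (a ∷ b ∷ c ∷ p ∷ q ∷ r ∷ [])))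

open import Data.List.Relation.Unary.All as All using (All; []; _∷_)
import Data.List.Relation.Unary.All.Properties as All
open import Data.List.Relation.Unary.AllPairs using ([]; _∷_)
open import Data.List.Relation.Unary.Any as Any using (Any; here; there)
open import Data.List.Relation.Unary.Unique.Propositional using (Unique)
import Data.List.Relation.Unary.Unique.Propositional.Properties as Unique
open import Data.Vec using ([]; _∷_; _[_]≔_; here; there; tabulate)
open import Data.Vec.Properties using ([]≔-updates; []≔-minimal; []=-injective; lookup⇒[]=; []=⇒lookup; lookup∘update′; lookup∘tabulate)

-- Robots in a graph

least : {P : ℕ → Set} → (∀ m → Dec (P m)) → ∀ m → P m →
        ∃ λ l → P l × (∀ m′ → P m′ → l ≤ m′)
least P? zero p = 0 , p , λ _ _ → z≤n
least P? (suc m) p with P? 0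
... | yes p₀ = 0 , p₀ , λ _ _ → z≤n
... | no ¬p₀ with least (P? ∘ suc) m p
... | l , pl , min = suc l , pl , λ where
  zero q → contradiction q ¬p₀
  (suc m′) q → s≤s (min m′ q)

module _ {A : Set} where

  delete : {x : A} (ys : List A) → x ∈ˡ ys → List A
  delete (_ ∷ ys) (here _) = ys
  delete (y ∷ ys) (there p) = y ∷ delete ys p

  length-delete : {x : A} (ys : List A) (p : x ∈ˡ ys) → suc (length (delete ys p)) ≡ length ys
  length-delete (_ ∷ ys) (here _) = refl
  length-delete (y ∷ ys) (there p) = cong suc (length-delete ys p)

  ∈-delete : {x z : A} (ys : List A) (p : x ∈ˡ ys) → z ∈ˡ ys → z ≢ x → z ∈ˡ delete ys p
  ∈-delete (_ ∷ ys) (here refl) (here refl) z≢x = contradiction refl z≢x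
  ∈-delete (_ ∷ ys) (here _) (there q) z≢x = q
  ∈-delete (_ ∷ ys) (there p) (here e) z≢x = here e
  ∈-delete (_ ∷ ys) (there p) (there q) z≢x = there (∈-delete ys p q z≢x)

  unique-length-≤ : {xs ys : List A} → Unique xs → (∀ {x} → x ∈ˡ xs → x ∈ˡ ys) →
                    length xs ≤ length ys
  unique-length-≤ {[]} _ _ = z≤n
  unique-length-≤ {x ∷ xs} {ys} (x∉ ∷ u) sub =
    subst (suc (length xs) ≤_) (length-delete ys (sub (here refl)))
      (s≤s (unique-length-≤ u λ q →
        ∈-delete ys (sub (here refl)) (sub (there q)) λ e → All.lookup x∉ q (sym e)))

elements : ∀ {n} → Subset n → List (Fin n)
elements [] = []
elements (true ∷ S) = zero ∷ map suc (elements S)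
elements (false ∷ S) = map suc (elements S)

length-elements : ∀ {n} (S : Subset n) → length (elements S) ≡ ∣ S ∣
length-elements [] = refl
length-elements (true ∷ S) = cong suc (trans (length-map suc (elements S)) (length-elements S))
length-elements (false ∷ S) = trans (length-map suc (elements S)) (length-elements S)

∈-elements⁺ : ∀ {n} (S : Subset n) {x} → x ∈ S → x ∈ˡ elements S
∈-elements⁺ (true ∷ S) here = here refl
∈-elements⁺ (true ∷ S) (there p) = there (∈-map⁺ suc (∈-elements⁺ S p))
∈-elements⁺ (false ∷ S) (there p) = ∈-map⁺ suc (∈-elements⁺ S p)

∈-elements⁻ : ∀ {n} (S : Subset n) {x} → x ∈ˡ elements S → x ∈ S
∈-elements⁻ (true ∷ S) (here refl) = here
∈-elements⁻ (true ∷ S) (there p) with ∈-map⁻ suc p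
... | _ , q , refl = there (∈-elements⁻ S q)
∈-elements⁻ (false ∷ S) p with ∈-map⁻ suc p
... | _ , q , refl = there (∈-elements⁻ S q)

elements-unique : ∀ {n} (S : Subset n) → Unique (elements S)
elements-unique [] = []
elements-unique (true ∷ S) =
  All.tabulate (λ p e → 0∉ p e) ∷ Unique.map⁺ sucᶠ-injective (elements-unique S)
  where
  0∉ : ∀ {y} → y ∈ˡ map suc (elements S) → zero ≢ y
  0∉ p refl with ∈-map⁻ suc p
  ... | _ , _ , ()
elements-unique (false ∷ S) = Unique.map⁺ sucᶠ-injective (elements-unique S)

module Walks (G : Graph) where

  V : Set
  V = Fin (n G)

  _∼_ : V → V → Set
  _∼_ = Adj G

  ∼-sym : ∀ {u v} → u ∼ v → v ∼ u
  ∼-sym {u} {v} a = trans (Graph.sym G v u) a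

  ∼-irrefl : ∀ {v} → ¬ (v ∼ v)
  ∼-irrefl {v} a with trans (sym a) (irref G v)
  ... | ()

  _∼?_ : ∀ u v → Dec (u ∼ v)
  u ∼? v = E G u v ≟ᵇ true

  _⁀_ : ∀ {u v w a b} → Walk G u v a → Walk G v w b → Walk G u w (a + b)
  [] _ ⁀ Q = Q
  (e ∷ P) ⁀ Q = e ∷ (P ⁀ Q)

  snoc : ∀ {u v w a} → Walk G u v a → v ∼ w → Walk G u w (suc a)
  snoc ([] _) e = e ∷ [] _
  snoc (d ∷ P) e = d ∷ snoc P e

  reverse : ∀ {u v a} → Walk G u v a → Walk G v u a
  reverse ([] v) = [] v
  reverse (e ∷ P) = snoc (reverse P) (∼-sym e)

  start-∈ : ∀ {u v a} (P : Walk G u v a) → _∈W_ G u P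
  start-∈ ([] _) = refl
  start-∈ (_ ∷ _) = inj₁ refl

  end-∈ : ∀ {u v a} (P : Walk G u v a) → _∈W_ G v P
  end-∈ ([] _) = refl
  end-∈ (_ ∷ P) = inj₂ (end-∈ P)

  ⁀-∈ʳ : ∀ {u v w a b x} (P : Walk G u v a) {Q : Walk G v w b} →
         _∈W_ G x Q → _∈W_ G x (P ⁀ Q)
  ⁀-∈ʳ ([] _) x∈ = x∈
  ⁀-∈ʳ (_ ∷ P) x∈ = inj₂ (⁀-∈ʳ P x∈)

  snoc-∈⁻ : ∀ {u v w a x} (P : Walk G u v a) (e : v ∼ w) → _∈W_ G x (snoc P e) →
            _∈W_ G x P ⊎ x ≡ w
  snoc-∈⁻ ([] _) e (inj₁ x≡) = inj₁ x≡
  snoc-∈⁻ ([] _) e (inj₂ x≡) = inj₂ x≡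
  snoc-∈⁻ (_ ∷ P) e (inj₁ x≡) = inj₁ (inj₁ x≡)
  snoc-∈⁻ (_ ∷ P) e (inj₂ x∈) with snoc-∈⁻ P e x∈
  ... | inj₁ x∈′ = inj₁ (inj₂ x∈′)
  ... | inj₂ x≡ = inj₂ x≡

  reverse-∈⁻ : ∀ {u v a x} (P : Walk G u v a) → _∈W_ G x (reverse P) → _∈W_ G x P
  reverse-∈⁻ ([] _) x≡ = x≡
  reverse-∈⁻ (e ∷ P) x∈ with snoc-∈⁻ (reverse P) (∼-sym e) x∈
  ... | inj₁ x∈′ = inj₂ (reverse-∈⁻ P x∈′)
  ... | inj₂ x≡ = inj₁ x≡

  position : ∀ {u v a x} (P : Walk G u v a) → _∈W_ G x P → ℕ
  position ([] _) _ = 0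
  position (_ ∷ _) (inj₁ _) = 0
  position (_ ∷ P) (inj₂ x∈) = suc (position P x∈)

  prefix : ∀ {u v a x} (P : Walk G u v a) (p : _∈W_ G x P) → Walk G u x (position P p)
  prefix ([] _) refl = [] _
  prefix (_ ∷ _) (inj₁ refl) = [] _
  prefix (e ∷ P) (inj₂ x∈) = e ∷ prefix P x∈

  suffix : ∀ {u v a x} (P : Walk G u v a) (p : _∈W_ G x P) →
           Σ ℕ λ s → Walk G x v s × position P p + s ≡ a
  suffix ([] v) refl = 0 , [] v , refl
  suffix P@(_ ∷ _) (inj₁ refl) = _ , P , refl
  suffix (_ ∷ P) (inj₂ x∈) with suffix P x∈
  ... | s , Q , eq = s , Q , cong suc eq

  segment : ∀ {u v a x y} (P : Walk G u v a) (p : _∈W_ G x P) (q : _∈W_ G y P) →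
            position P p ≤ position P q → Σ ℕ λ d → Walk G x y d × position P p + d ≡ position P q
  segment ([] _) refl refl _ = 0 , [] _ , refl
  segment (_ ∷ _) (inj₁ refl) (inj₁ refl) _ = 0 , [] _ , refl
  segment P@(_ ∷ _) (inj₁ refl) q@(inj₂ _) _ = _ , prefix P q , refl
  segment (_ ∷ P) (inj₂ p) (inj₂ q) (s≤s le) with segment P p q le
  ... | d , Q , eq = d , Q , cong suc eq

  walk? : ∀ m u v → Dec (Walk G u v m)
  walk? zero u v = map′ (λ { refl → [] u }) (λ { ([] _) → refl }) (u ≟ᶠ v)
  walk? (suc m) u v =
    map′ (λ { (_ , e , P) → e ∷ P }) (λ { (e ∷ P) → _ , e , P })
      (any? λ w → (u ∼? w) ×-dec walk? m w v)

  geodesic : Connected G → ∀ u v → Σ ℕ λ m → Σ (Walk G u v m) (IsShortest G)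
  geodesic conn u v with conn u v
  ... | m , P with least (λ l → walk? l u v) m P
  ... | l , Q , min = l , Q , min

  Separates : V → V → V → Set
  Separates w x y = ∀ {m} (P : Walk G x y m) → _∈W_ G w P

  separates-sym : ∀ {w x y} → Separates w x y → Separates w y x
  separates-sym s P = reverse-∈⁻ P (s (reverse P))

  separates⇒geodesic : Connected G → ∀ {w x y} → Separates w x y → OnCommonGeodesic G x w y
  separates⇒geodesic conn {w} {x} {y} s with geodesic conn x y
  ... | m , P , shortest = x , y , m , P , shortest , start-∈ P , s P , end-∈ P

  -- `Move` in terms of membership, with general position recorded at both ends; this makes it
  -- symmetric.
  record Step (S S′ : Subset (n G)) : Set where
    field
      from to : V
      from∈   : from ∈ S
      to∉     : to ∉ S
      to∈     : to ∈ S′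
      from∉   : from ∉ S′
      from∼to : from ∼ to
      keep    : ∀ {w} → w ∈ S → w ≢ from → w ∈ S′
      keep⁻   : ∀ {w} → w ∈ S′ → w ≢ to → w ∈ S
      gp      : GeneralPosition G S
      gp′     : GeneralPosition G S′

  step-sym : ∀ {S S′} → Step S S′ → Step S′ S
  step-sym s = record
    { from = to ; to = from ; from∈ = to∈ ; to∉ = from∉ ; to∈ = from∈ ; from∉ = to∉
    ; from∼to = ∼-sym from∼to ; keep = keep⁻ ; keep⁻ = keep ; gp = gp′ ; gp′ = gp }
    where open Step s

  ≔-∈ : ∀ (S : Subset (n G)) v → v ∈ (S [ v ]≔ inside)
  ≔-∈ S v = []≔-updates S v

  ≔-∉ : ∀ (S : Subset (n G)) v → v ∉ (S [ v ]≔ outside)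
  ≔-∉ S v v∈ with []=-injective v∈ ([]≔-updates S v)
  ... | ()

  ≔-other : ∀ (S : Subset (n G)) {v w s} → w ≢ v → w ∈ S → w ∈ (S [ v ]≔ s)
  ≔-other S w≢v w∈ = []≔-minimal S _ _ w≢v w∈

  ≔-other⁻ : ∀ (S : Subset (n G)) {v w s} → w ≢ v → w ∈ (S [ v ]≔ s) → w ∈ S
  ≔-other⁻ S {v} {w} w≢v w∈ =
    lookup⇒[]= w S (trans (sym (lookup∘update′ w≢v S _)) ([]=⇒lookup w∈))

  move⇒step : ∀ {S S′} → GeneralPosition G S → Move G S S′ → Step S S′
  move⇒step {S} gp (u , v , u∈ , v∉ , a , refl , gp′) = record
    { from = u ; to = v ; from∈ = u∈ ; to∉ = v∉ ; to∈ = ≔-∈ _ v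
    ; from∉ = λ u∈′ → ≔-∉ S u (≔-other⁻ _ u≢v u∈′)
    ; from∼to = a
    ; keep = λ w∈ w≢u → ≔-other _ (λ { refl → v∉ w∈ }) (≔-other S w≢u w∈)
    ; keep⁻ = keep⁻
    ; gp = gp ; gp′ = gp′ }
    where
    u≢v : u ≢ v
    u≢v refl = ∼-irrefl a
    keep⁻ : ∀ {w} → w ∈ ((S [ u ]≔ outside) [ v ]≔ inside) → w ≢ v → w ∈ S
    keep⁻ {w} w∈ w≢v with ≔-other⁻ (S [ u ]≔ outside) w≢v w∈
    ... | w∈′ with w ≟ᶠ u
    ... | yes refl = ⊥-elim (≔-∉ S u w∈′)
    ... | no w≢u = ≔-other⁻ S w≢u w∈′

  -- Mobility without the order of the visits. Since steps are reversible it passes to every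
  -- configuration of the tour.
  Roams : Subset (n G) → Set
  Roams S = ∀ x → ∃ λ T → x ∈ T × Star Step S T

  roams-step : ∀ {S S′} → Step S S′ → Roams S → Roams S′
  roams-step s r x with r x
  ... | T , x∈ , p = T , x∈ , step-sym s ◅ p

  mobile⇒roams : ∀ {S} → Mobile G S → Roams S
  mobile⇒roams (gp , rest , run , visits) x = go gp run (visits x)
    where
    go : ∀ {S rest} → GeneralPosition G S → Run G S rest → Any (λ T → x ∈ T) (S ∷ rest) →
         ∃ λ T → x ∈ T × Star Step S T
    go gp _ (here x∈) = _ , x∈ , ε
    go gp (step m r) (there a) with go (proj₂ (proj₂ (proj₂ (proj₂ (proj₂ (proj₂ m)))))) r a
    ... | T , x∈ , p = T , x∈ , move⇒step gp m ◅ p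

  step-∣∣ : ∀ {S S′} → Step S S′ → ∣ S ∣ ≤ ∣ S′ ∣
  step-∣∣ {S} {S′} s = subst (_≤ ∣ S′ ∣) (length-elements S)
    (subst (length (elements S) ≤_)
      (trans (length-delete (elements S′) to∈ˡ) (length-elements S′))
      (unique-length-≤ (elements-unique S) sub))
    where
    open Step s
    to∈ˡ : to ∈ˡ elements S′
    to∈ˡ = ∈-elements⁺ S′ to∈
    sub : ∀ {x} → x ∈ˡ elements S → x ∈ˡ from ∷ delete (elements S′) to∈ˡ
    sub {x} p with x ≟ᶠ from
    ... | yes refl = here refl
    ... | no x≢ = there (∈-delete (elements S′) to∈ˡ
      (∈-elements⁺ S′ (keep (∈-elements⁻ S p) x≢)) λ { refl → to∉ (∈-elements⁻ S p) })

  all-but-two : ∀ S c d → Σ (List V) λ xs → Unique xs × (∀ {x} → x ∈ˡ xs → x ∈ S × x ≢ c × x ≢ d) ×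
                ∣ S ∣ ≤ 2 + length xs
  all-but-two S c d = xs , Unique.filter⁺ other? (elements-unique S) ,
    (λ p → let q , ≢ = ∈-filter⁻ other? p in ∈-elements⁻ S q , ≢) ,
    subst (_≤ 2 + length xs) (length-elements S) (unique-length-≤ (elements-unique S) sub)
    where
    other? : ∀ x → Dec (x ≢ c × x ≢ d)
    other? x = ¬? (x ≟ᶠ c) ×-dec ¬? (x ≟ᶠ d)
    xs : List V
    xs = filter other? (elements S)
    sub : ∀ {x} → x ∈ˡ elements S → x ∈ˡ c ∷ d ∷ xs
    sub {x} p with x ≟ᶠ c | x ≟ᶠ d
    ... | yes refl | _ = here refl
    ... | no _ | yes refl = there (here refl)
    ... | no x≢c | no x≢d = there (there (∈-filter⁺ other? p (x≢c , x≢d)))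

  -- Three robots separated by one vertex

  module Frozen (conn : Connected G) (w : V) where

    Split : Subset (n G) → Set
    Split S = Σ V λ x → Σ V λ y → Σ V λ z → x ∈ S × y ∈ S × z ∈ S × x ≢ w × y ≢ w × z ≢ w ×
      Separates w x y × Separates w y z × Separates w x z

    separated-≢ : ∀ {x y} → x ≢ w → Separates w x y → x ≢ y
    separated-≢ {x} x≢w s refl = x≢w (sym (s ([] x)))

    blocked : ∀ {S x y} → GeneralPosition G S → x ∈ S → y ∈ S → x ≢ w → y ≢ w →
              Separates w x y → w ∉ S
    blocked gp x∈ y∈ x≢w y≢w s w∈ =
      gp _ _ _ x∈ w∈ y∈ x≢w (y≢w ∘ sym) (separated-≢ x≢w s) (separates⇒geodesic conn s)

    separates-step : ∀ {u v y} → u ∼ v → u ≢ w → Separates w u y → Separates w v y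
    separates-step a u≢w s P with s (a ∷ P)
    ... | inj₁ w≡u = ⊥-elim (u≢w (sym w≡u))
    ... | inj₂ w∈ = w∈

    -- Two robots separated by `w` make `w` forbidden, as it is on a geodesic between them. With
    -- three, the two that stay forbid `w` to the one that moves, and a step that avoids `w` does
    -- not change what `w` separates.
    split-step : ∀ {S S′} → Step S S′ → Split S → Split S′
    split-step {S} {S′} s (x , y , z , x∈ , y∈ , z∈ , x≢ , y≢ , z≢ , xy , yz , xz)
      with x ≟ᶠ from | y ≟ᶠ from | z ≟ᶠ from
      where open Step s
    ... | yes refl | _ | _ = to , y , z , to∈ , y∈′ , z∈′ ,
          (λ { refl → blocked gp′ y∈′ z∈′ y≢ z≢ yz to∈ }) , y≢ , z≢ ,
          separates-step from∼to x≢ xy , yz , separates-step from∼to x≢ xz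
      where
      open Step s
      y∈′ = keep y∈ (separated-≢ x≢ xy ∘ sym)
      z∈′ = keep z∈ (separated-≢ x≢ xz ∘ sym)
    ... | no x≢f | yes refl | _ = x , to , z , x∈′ , to∈ , z∈′ , x≢ ,
          (λ { refl → blocked gp′ x∈′ z∈′ x≢ z≢ xz to∈ }) , z≢ ,
          separates-sym (separates-step from∼to y≢ (separates-sym xy)) ,
          separates-step from∼to y≢ yz , xz
      where
      open Step s
      x∈′ = keep x∈ x≢f
      z∈′ = keep z∈ (separated-≢ y≢ yz ∘ sym)
    ... | no x≢f | no y≢f | yes refl = x , y , to , x∈′ , y∈′ , to∈ , x≢ , y≢ ,
          (λ { refl → blocked gp′ x∈′ y∈′ x≢ y≢ xy to∈ }) , xy ,
          separates-sym (separates-step from∼to z≢ (separates-sym yz)) ,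
          separates-sym (separates-step from∼to z≢ (separates-sym xz))
      where
      open Step s
      x∈′ = keep x∈ x≢f
      y∈′ = keep y∈ y≢f
    ... | no x≢f | no y≢f | no z≢f =
          x , y , z , keep x∈ x≢f , keep y∈ y≢f , keep z∈ z≢f , x≢ , y≢ , z≢ , xy , yz , xz
      where open Step s

    split⇒¬roams : ∀ {S} → GeneralPosition G S → Split S → ¬ Roams S
    split⇒¬roams gp sp roams with roams w
    ... | T , w∈ , p = go gp sp p w∈
      where
      go : ∀ {S T} → GeneralPosition G S → Split S → Star Step S T → w ∉ T
      go gp (x , y , _ , x∈ , y∈ , _ , x≢ , y≢ , _ , xy , _) ε = blocked gp x∈ y∈ x≢ y≢ xy
      go gp sp (s ◅ p) = go (Step.gp′ s) (split-step s sp) p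

-- The cycle with its trees

-- par is meaningful only off the cycle, that is, at positive depth.
record Rooted {G : Graph} {ℓ : ℕ} (C : Cycle G ℓ) : Set where
  field
    foot       : Fin (n G) → Fin ℓ
    depth      : Fin (n G) → ℕ
    par        : Fin (n G) → Fin (n G)
    depth-vert : ∀ i → depth (vert C i) ≡ 0
    foot-vert  : ∀ i → foot (vert C i) ≡ i
    root       : ∀ v → depth v ≡ 0 → vert C (foot v) ≡ v
    par-adj    : ∀ {v d} → depth v ≡ suc d → Adj G v (par v)
    par-depth  : ∀ {v d} → depth v ≡ suc d → depth (par v) ≡ d
    par-foot   : ∀ {v d} → depth v ≡ suc d → foot (par v) ≡ foot v
    edge       : ∀ {u v} → Adj G u v → CycEdge C u v ⊎
                 (∃ λ d → depth u ≡ suc d × v ≡ par u) ⊎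
                 (∃ λ d → depth v ≡ suc d × u ≡ par v)

module Along {G : Graph} {ℓ : ℕ} (C : Cycle G ℓ) where
  open Walks G

  forward : ∀ d (i j : Fin ℓ) → toℕ i + d ≡ toℕ j → Walk G (vert C i) (vert C j) d
  forward zero i j e with toℕ-injective (trans (sym (+-identityʳ (toℕ i))) e)
  ... | refl = [] _
  forward (suc d) i j e = adj C i i′ (inj₁ (sym (toℕ-fromℕ< i<))) ∷
    forward d i′ j (trans (cong (_+ d) (toℕ-fromℕ< i<)) e′)
    where
    e′ : suc (toℕ i) + d ≡ toℕ j
    e′ = trans (sym (+-suc (toℕ i) d)) e
    i< : suc (toℕ i) < ℓ
    i< = ≤-<-trans (≤-trans (m≤m+n _ d) (≤-reflexive e′)) (toℕ<n j)
    i′ = fromℕ< i<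

  backward : (i j : Fin ℓ) → ∀ e → suc (toℕ j + e) ≡ ℓ →
             Walk G (vert C i) (vert C j) (toℕ i + suc e)
  backward i j e eq =
    reverse (forward (toℕ i) first i (cong (_+ toℕ i) (toℕ-fromℕ< 0<ℓ))) ⁀
    (∼-sym (adj C last first (inj₂ (trans (cong suc last≡) eq , toℕ-fromℕ< 0<ℓ))) ∷
     reverse (forward e j last (sym last≡)))
    where
    0<ℓ : 0 < ℓ
    0<ℓ = ≤-<-trans z≤n (toℕ<n i)
    first = fromℕ< 0<ℓ
    last = fromℕ< {toℕ j + e} (≤-reflexive eq)
    last≡ : toℕ last ≡ toℕ j + e
    last≡ = toℕ-fromℕ< (≤-reflexive eq)

  ordered : (i j : Fin ℓ) → toℕ i ≤ toℕ j → Walk G (vert C i) (vert C j) (cd ℓ (toℕ i) (toℕ j))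
  ordered i j i≤j with cd-cases {ℓ} i≤j
  ... | inj₁ e = forward _ i j (trans (+-comm (toℕ i) _) e)
  ... | inj₂ f with m≤n⇒∃[o]m+o≡n (toℕ<n j)
  ...   | e , eq = subst (Walk G _ _) (+-cancelʳ-≡ (toℕ j) _ _ (begin
    toℕ i + suc e + toℕ j    ≡⟨ wrap-length (toℕ i) e (toℕ j) ⟩
    suc (toℕ j + e) + toℕ i  ≡⟨ cong (_+ toℕ i) eq ⟩
    ℓ + toℕ i                ≡⟨ f (<⇒≤ (toℕ<n j)) ⟨
    cd ℓ (toℕ i) (toℕ j) + toℕ j ∎)) (backward i j e eq)
    where
    open ≡-Reasoning

  around : (i j : Fin ℓ) → Walk G (vert C i) (vert C j) (cd ℓ (toℕ i) (toℕ j))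
  around i j with ≤-total (toℕ i) (toℕ j)
  ... | inj₁ i≤j = ordered i j i≤j
  ... | inj₂ j≤i = subst (Walk G _ _) (cd-sym ℓ (toℕ j) (toℕ i)) (reverse (ordered j i j≤i))

module Distances {G : Graph} {ℓ : ℕ} {C : Cycle G ℓ} (R : Rooted C) where
  open Walks G
  open Rooted R
  open Along C

  cdᶠ : V → V → ℕ
  cdᶠ x y = cd ℓ (toℕ (foot x)) (toℕ (foot y))

  climb : ∀ d v → depth v ≡ d → Walk G v (vert C (foot v)) d
  climb zero v e = subst (λ t → Walk G v t 0) (sym (root v e)) ([] v)
  climb (suc d) v e = par-adj e ∷
    subst (λ i → Walk G (par v) (vert C i) d) (par-foot e) (climb d (par v) (par-depth e))

  shortcut : ∀ x z → Walk G x z (depth x + (cdᶠ x z + depth z))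
  shortcut x z = climb _ x refl ⁀ (around (foot x) (foot z) ⁀ reverse (climb _ z refl))

  -- 1-Lipschitz, zero at x, and equal to the distance from x at every vertex outside the tree of x.
  potential : V → V → ℕ
  potential x v with foot v ≟ᶠ foot x
  ... | yes _ = depth x ∸ depth v
  ... | no _  = depth x + (cdᶠ x v + depth v)

  potential-vert : ∀ x i → potential x (vert C i) ≡ depth x + cd ℓ (toℕ (foot x)) (toℕ i)
  potential-vert x i with foot (vert C i) ≟ᶠ foot x
  ... | yes e rewrite depth-vert i | sym e | foot-vert i | cd-refl ℓ (toℕ i) = sym (+-identityʳ (depth x))
  ... | no _ rewrite depth-vert i | foot-vert i = cong (depth x +_) (+-identityʳ _)

  potential-edge : ∀ x {u v} → u ∼ v → potential x v ≤ suc (potential x u)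
  potential-edge x {u} {v} a with edge a
  ... | inj₁ (i , j , s , inj₁ (refl , refl))
        rewrite potential-vert x i | potential-vert x j =
        ≤-trans (+-monoʳ-≤ (depth x) (cd-lipschitz (toℕ<n (foot x)) i j (inj₁ s))) (≤-reflexive (+-suc (depth x) _))
  ... | inj₁ (i , j , s , inj₂ (refl , refl))
        rewrite potential-vert x i | potential-vert x j =
        ≤-trans (+-monoʳ-≤ (depth x) (cd-lipschitz (toℕ<n (foot x)) j i (inj₂ s))) (≤-reflexive (+-suc (depth x) _))
  ... | inj₂ (inj₁ (d , e , refl)) with foot (par u) ≟ᶠ foot x | foot u ≟ᶠ foot x
  ...   | yes _ | yes _ rewrite e | par-depth e = ∸-suc-≤ (depth x) d
  ...   | no _ | no _ rewrite e | par-depth e | par-foot e =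
          m≤n⇒m≤1+n (+-monoʳ-≤ (depth x) (+-monoʳ-≤ (cdᶠ x u) (n≤1+n d)))
  ...   | yes p | no ¬p = contradiction (trans (sym (par-foot e)) p) ¬p
  ...   | no ¬p | yes p = contradiction (trans (par-foot e) p) ¬p
  potential-edge x {u} {v} a | inj₂ (inj₂ (d , e , refl)) with foot (par v) ≟ᶠ foot x | foot v ≟ᶠ foot x
  ...   | yes _ | yes _ rewrite e | par-depth e = m≤n⇒m≤1+n (∸-monoʳ-≤ (depth x) (n≤1+n d))
  ...   | no _ | no _ rewrite e | par-depth e | par-foot e =
          ≤-reflexive (trans (cong (depth x +_) (+-suc (cdᶠ x v) d)) (+-suc (depth x) _))
  ...   | yes p | no ¬p = contradiction (trans (sym (par-foot e)) p) ¬p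
  ...   | no ¬p | yes p = contradiction (trans (par-foot e) p) ¬p

  potential-walk : ∀ x {u v m} → Walk G u v m → potential x v ≤ m + potential x u
  potential-walk x ([] _) = ≤-refl
  potential-walk x {u} {v} {suc m} (a ∷ P) =
    ≤-trans (potential-walk x P) (≤-trans (+-monoʳ-≤ m (potential-edge x a)) (≤-reflexive (+-suc m _)))

  -- `potential x` is 0 at `x`, equals the left side at `z`, and grows by at most 1 along each edge.
  distance-≤ : ∀ {x z m} → foot x ≢ foot z → Walk G x z m → depth x + (cdᶠ x z + depth z) ≤ m
  distance-≤ {x} {z} {m} x≢z P with potential-walk x P
  ... | q with foot z ≟ᶠ foot x | foot x ≟ᶠ foot x
  ... | yes e | _ = contradiction (sym e) x≢z
  ... | _ | no ¬e = contradiction refl ¬e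
  ... | no _ | yes _ rewrite n∸n≡0 (depth x) | +-identityʳ m = q

  between⇒geodesic : ∀ {x c z} → foot x ≢ foot z → depth c ≡ 0 → cdᶠ x c + cdᶠ c z ≤ cdᶠ x z →
                     OnCommonGeodesic G x c z
  between⇒geodesic {x} {c} {z} x≢z c₀ b =
    x , z , _ , P , shortest , start-∈ P , ⁀-∈ʳ (shortcut x c) (start-∈ (shortcut c z)) , end-∈ P
    where
    P = shortcut x c ⁀ shortcut c z
    shortest : IsShortest G P
    shortest m Q rewrite c₀ | through-length (depth x) (cdᶠ x c) (cdᶠ c z) (depth z) =
      ≤-trans (+-monoʳ-≤ (depth x) (+-monoˡ-≤ (depth z) b)) (distance-≤ x≢z Q)

  -- Taken from the graph instead of arc arithmetic: two arcs in a row form a walk between the feet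
  -- of `x` and `z`, and `distance-≤` bounds its length from below.
  cdᶠ-triangle : ∀ {x y z} → foot x ≢ foot z → cdᶠ x z ≤ cdᶠ x y + cdᶠ y z
  cdᶠ-triangle {x} {y} {z} x≢z =
    subst₂ (λ i k → cd ℓ (toℕ i) (toℕ k) ≤ cdᶠ x y + cdᶠ y z) (foot-vert _) (foot-vert _)
      (m+n≤o⇒m≤o _ (m+n≤o⇒n≤o (depth (vert C (foot x))) (distance-≤
        (λ e → x≢z (trans (sym (foot-vert _)) (trans e (foot-vert _))))
        (around (foot x) (foot y) ⁀ around (foot y) (foot z)))))

  Between : V → V → V → Set
  Between x c z = depth c ≡ 0 × cdᶠ x c + cdᶠ c z ≤ cdᶠ x z

  module _ {a b m} (P : Walk G a b m) (shortest : IsShortest G P) where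

    geodesic-between : ∀ {x y z} (p : _∈W_ G x P) (q : _∈W_ G y P) (r : _∈W_ G z P) →
      position P p ≤ position P q → position P q ≤ position P r →
      foot x ≢ foot y → foot y ≢ foot z → foot x ≢ foot z → Between x y z
    geodesic-between {x} {y} {z} p q r pq qr x≢y y≢z x≢z
      with segment P p q pq | segment P q r qr | prefix P p | suffix P r
    ... | d , Q , e | d′ , Q′ , e′ | A | s , B , f =
      middle-on-cycle (depth x) (depth y) (depth z) (cdᶠ x y) (cdᶠ y z) (cdᶠ x z) (cdᶠ-triangle {x} {y} {z} x≢z) (begin
        depth x + (cdᶠ x y + depth y) + (depth y + (cdᶠ y z + depth z))
          ≤⟨ +-mono-≤ (distance-≤ x≢y Q) (distance-≤ y≢z Q′) ⟩
        d + d′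
          -- Replacing the part of `P` from `x` to `z` by `shortcut x z` gives another walk from `a`
          -- to `b`, so that part is no longer than `D`.
          ≤⟨ +-cancelˡ-≤ (position P p + s) _ _ (begin
             position P p + s + (d + d′)  ≡⟨ segments-length (position P p) s d d′ ⟩
             position P p + d + d′ + s    ≡⟨ cong (λ t → t + d′ + s) e ⟩
             position P q + d′ + s        ≡⟨ cong (_+ s) e′ ⟩
             position P r + s             ≡⟨ f ⟩
             m                            ≤⟨ shortest _ (A ⁀ (shortcut x z ⁀ B)) ⟩
             position P p + (D + s)       ≡⟨ detour-length (position P p) D s ⟩
             position P p + s + D ∎) ⟩
        D ∎)
      where
      open ≤-Reasoning
      D = depth x + (cdᶠ x z + depth z)

  between-sym : ∀ {x y z} → Between x y z → Between z y x
  between-sym {x} {y} {z} (e , h) = e ,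
    subst₂ _≤_ (trans (+-comm (cdᶠ x y) (cdᶠ y z)) (cong₂ _+_ (c y z) (c x y))) (c x z) h
    where
    c : ∀ x y → cdᶠ x y ≡ cdᶠ y x
    c x y = cd-sym ℓ (toℕ (foot x)) (toℕ (foot y))

  geodesic⇒between : ∀ {x y z} → foot x ≢ foot y → foot y ≢ foot z → foot x ≢ foot z →
    OnCommonGeodesic G x y z → Between x y z ⊎ Between y x z ⊎ Between x z y
  geodesic⇒between {x} {y} {z} xy yz xz (_ , _ , _ , P , shortest , p , q , r)
    with ≤-total (position P p) (position P q) | ≤-total (position P q) (position P r)
       | ≤-total (position P p) (position P r)
  ... | inj₁ h | inj₁ k | _ = inj₁ (geodesic-between P shortest p q r h k xy yz xz)
  ... | inj₂ h | inj₂ k | _ =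
        inj₁ (between-sym (geodesic-between P shortest r q p k h (yz ∘ sym) (xy ∘ sym) (xz ∘ sym)))
  ... | inj₁ h | inj₂ k | inj₁ l = inj₂ (inj₂ (geodesic-between P shortest p r q l k xz (yz ∘ sym) xy))
  ... | inj₁ h | inj₂ k | inj₂ l =
        inj₂ (inj₁ (between-sym (geodesic-between P shortest r p q l h (xz ∘ sym) xy (yz ∘ sym))))
  ... | inj₂ h | inj₁ k | inj₁ l = inj₂ (inj₁ (geodesic-between P shortest q p r h l (xy ∘ sym) xz yz))
  ... | inj₂ h | inj₁ k | inj₂ l =
        inj₂ (inj₂ (between-sym (geodesic-between P shortest q r p k l yz (xz ∘ sym) (xy ∘ sym))))

  connected : Connected G
  connected x z = _ , shortcut x z

  -- Medians in trees

  data Below (v : V) : V → Set where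
    here  : Below v v
    under : ∀ {s d} → depth s ≡ suc d → Below v (par s) → Below v s

  below-depth : ∀ {v s} → Below v s → s ≡ v ⊎ depth v < depth s
  below-depth here = inj₁ refl
  below-depth (under e b) with below-depth b
  ... | inj₁ refl = inj₂ (≤-reflexive (trans (cong suc (par-depth e)) (sym e)))
  ... | inj₂ lt = inj₂ (<-trans lt (≤-reflexive (trans (cong suc (par-depth e)) (sym e))))

  below⇒off-cycle : ∀ {v s d} → depth v ≡ suc d → Below v s → depth s ≢ 0
  below⇒off-cycle e here z with trans (sym e) z
  ... | ()
  below⇒off-cycle e (under e′ b) z with trans (sym e′) z
  ... | ()

  -- A walk leaves the subtree below `v` only over the edge to `par v`, and `y` is outside this
  -- subtree because it is different from `v` and no deeper.
  lift-separates : ∀ {v d s y w} → depth v ≡ suc d → Below v s → y ≢ v → depth y ≤ depth v →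
                   Separates w (par v) y → Separates w s y
  lift-separates e b y≢v le sep ([] _) with below-depth b
  ... | inj₁ y≡v = contradiction y≡v y≢v
  ... | inj₂ lt = contradiction lt (≤⇒≯ le)
  lift-separates e b y≢v le sep (a ∷ P) with edge a
  ... | inj₁ (i , j , _ , inj₁ (refl , _)) = contradiction (depth-vert i) (below⇒off-cycle e b)
  ... | inj₁ (i , j , _ , inj₂ (_ , refl)) = contradiction (depth-vert j) (below⇒off-cycle e b)
  ... | inj₂ (inj₂ (d , e′ , refl)) = inj₂ (lift-separates e (under e′ b) y≢v le sep P)
  ... | inj₂ (inj₁ (d , e′ , refl)) with b
  ...   | here = inj₂ (sep P)
  ...   | under _ b′ = inj₂ (lift-separates e b′ y≢v le sep P)

  Median : V → V → V → Set
  Median x y z = ∃ λ w → Separates w x y × Separates w y z × Separates w x z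

  roots-≡ : ∀ {x y} → depth x ≡ 0 → depth y ≡ 0 → foot x ≡ foot y → x ≡ y
  roots-≡ {x} {y} x₀ y₀ e = trans (sym (root x x₀)) (trans (cong (vert C) e) (root y y₀))

  -- Induction on the sum of depths: the deepest of three distinct vertices is replaced by its
  -- parent until two coincide, and `lift-separates` carries the result back. The deepest one is off
  -- the cycle, since otherwise `x` and `y` would both be the root of their common tree.
  median : ∀ N x y z → depth x + depth y + depth z ≤ N → foot x ≡ foot y → Median x y z
  median N x y z le f with x ≟ᶠ y | x ≟ᶠ z | y ≟ᶠ z
  ... | yes refl | _ | _ = x , start-∈ , start-∈ , start-∈
  ... | no _ | yes refl | _ = x , start-∈ , end-∈ , start-∈
  ... | no _ | no _ | yes refl = y , end-∈ , start-∈ , end-∈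
  ... | no x≢y | no x≢z | no y≢z = deepest
    where
    zero-depth : ∀ {u v} → depth u ≤ depth v → depth v ≡ 0 → depth u ≡ 0
    zero-depth le e = n≤0⇒n≡0 (≤-trans le (≤-reflexive e))
    x-deepest : ∀ N d → depth x + depth y + depth z ≤ N → depth x ≡ d → depth y ≤ depth x → depth z ≤ depth x → Median x y z
    x-deepest N zero _ e yx zx = contradiction (roots-≡ e (zero-depth yx e) f) x≢y
    x-deepest zero (suc d) le e _ _ rewrite e with le
    ... | ()
    x-deepest (suc N) (suc d) le e yx zx with median N (par x) y z
          (subst (λ t → t + depth y + depth z ≤ N) (sym (par-depth e)) (s≤s⁻¹ (subst (λ t → t + depth y + depth z ≤ suc N) e le)))
          (trans (par-foot e) f)
    ... | w , xy , yz , xz = w , lift-separates e here (x≢y ∘ sym) yx xy , yz , lift-separates e here (x≢z ∘ sym) zx xz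
    y-deepest : ∀ N d → depth x + depth y + depth z ≤ N → depth y ≡ d → depth x ≤ depth y → depth z ≤ depth y → Median x y z
    y-deepest N zero _ e xy zy = contradiction (roots-≡ (zero-depth xy e) e f) x≢y
    y-deepest zero (suc d) le e _ _ rewrite e | +-suc (depth x) d with le
    ... | ()
    y-deepest (suc N) (suc d) le e xy zy with median N x (par y) z
          (subst (λ t → depth x + t + depth z ≤ N) (sym (par-depth e))
            (s≤s⁻¹ (subst (λ t → t + depth z ≤ suc N) (+-suc (depth x) d) (subst (λ t → depth x + t + depth z ≤ suc N) e le))))
          (trans f (sym (par-foot e)))
    ... | w , sxy , syz , sxz = w , separates-sym (lift-separates e here x≢y xy (separates-sym sxy)) ,
          lift-separates e here (y≢z ∘ sym) zy syz , sxz
    z-deepest : ∀ N d → depth x + depth y + depth z ≤ N → depth z ≡ d → depth x ≤ depth z → depth y ≤ depth z → Median x y z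
    z-deepest N zero _ e xz yz = contradiction (roots-≡ (zero-depth xz e) (zero-depth yz e) f) x≢y
    z-deepest zero (suc d) le e _ _ rewrite e | +-suc (depth x + depth y) d with le
    ... | ()
    z-deepest (suc N) (suc d) le e xz yz with median N x y (par z)
          (subst (λ t → depth x + depth y + t ≤ N) (sym (par-depth e))
            (s≤s⁻¹ (subst (_≤ suc N) (+-suc (depth x + depth y) d) (subst (λ t → depth x + depth y + t ≤ suc N) e le))))
          f
    ... | w , sxy , syz , sxz = w , sxy , separates-sym (lift-separates e here y≢z yz (separates-sym syz)) ,
          separates-sym (lift-separates e here x≢z xz (separates-sym sxz))
    deepest : Median x y z
    deepest with ≤-total (depth x) (depth y) | ≤-total (depth x) (depth z) | ≤-total (depth y) (depth z)
    ... | inj₁ xy | _ | inj₂ zy = y-deepest N _ le refl xy zy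
    ... | inj₁ xy | _ | inj₁ yz = z-deepest N _ le refl (≤-trans xy yz) yz
    ... | inj₂ yx | inj₁ xz | _ = z-deepest N _ le refl xz (≤-trans yx xz)
    ... | inj₂ yx | inj₂ zx | _ = x-deepest N _ le refl yx zx

  -- Two robots in the same tree together with any third robot freeze their median.
  foot-injective : ∀ {S} → GeneralPosition G S → Roams S → ∀ {x y z} → x ∈ S → y ∈ S → z ∈ S →
                   x ≢ z → y ≢ z → foot x ≡ foot y → x ≡ y
  foot-injective {S} gp roams {x} {y} {z} x∈ y∈ z∈ x≢z y≢z f with x ≟ᶠ y
  ... | yes x≡y = x≡y
  ... | no x≢y with median _ x y z ≤-refl f
  ...   | w , xy , yz , xz = ⊥-elim (Frozen.split⇒¬roams connected w gp
          (x , y , z , x∈ , y∈ , z∈ ,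
           (λ { refl → gp y x z y∈ x∈ z∈ (x≢y ∘ sym) x≢z y≢z (separates⇒geodesic connected yz) }) ,
           (λ { refl → gp x y z x∈ y∈ z∈ x≢y y≢z x≢z (separates⇒geodesic connected xz) }) ,
           (λ { refl → gp x z y x∈ z∈ y∈ x≢z (y≢z ∘ sym) x≢y (separates⇒geodesic connected xy) }) ,
           xy , yz , xz) roams)

  general-position : ∀ {S} →
    (∀ {x y} → x ∈ S → y ∈ S → foot x ≡ foot y → x ≡ y) →
    (∀ {x c z} → x ∈ S → c ∈ S → z ∈ S → x ≢ c → c ≢ z → x ≢ z → ¬ Between x c z) →
    GeneralPosition G S
  general-position inj free x y z x∈ y∈ z∈ x≢y y≢z x≢z ocg
    with geodesic⇒between (x≢y ∘ inj x∈ y∈) (y≢z ∘ inj y∈ z∈) (x≢z ∘ inj x∈ z∈) ocg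
  ... | inj₁ b = free x∈ y∈ z∈ x≢y y≢z x≢z b
  ... | inj₂ (inj₁ b) = free y∈ x∈ z∈ (x≢y ∘ sym) x≢z y≢z b
  ... | inj₂ (inj₂ b) = free x∈ z∈ y∈ x≢z (y≢z ∘ sym) x≢y b

-- Unicyclic graphs are cycles with rooted trees

next : ∀ {ℓ} (i : Fin ℓ) → ∃ λ j → Succ ℓ i j
next {ℓ} i with suc (toℕ i) <? ℓ
... | yes lt = fromℕ< lt , inj₁ (sym (toℕ-fromℕ< lt))
... | no ¬lt = fromℕ< 0<ℓ , inj₂ (≤-antisym (toℕ<n i) (≮⇒≥ ¬lt) , toℕ-fromℕ< 0<ℓ)
  where
  0<ℓ : 0 < ℓ
  0<ℓ = ≤-<-trans z≤n (toℕ<n i)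

prev : ∀ {ℓ} (i : Fin ℓ) → ∃ λ j → Succ ℓ j i
prev {suc ℓ} zero = fromℕ< {ℓ} ≤-refl , inj₂ (cong suc (toℕ-fromℕ< {ℓ} ≤-refl) , refl)
prev {suc ℓ} (suc i) = fromℕ< lt , inj₁ (cong suc (toℕ-fromℕ< lt))
  where
  lt : toℕ i < suc ℓ
  lt = m<n⇒m<1+n (toℕ<n i)

Succ? : ∀ {ℓ} (i j : Fin ℓ) → Dec (Succ ℓ i j)
Succ? {ℓ} i j = (suc (toℕ i) ≟ toℕ j) ⊎-dec ((suc (toℕ i) ≟ ℓ) ×-dec (toℕ j ≟ 0))

succ-unique : ∀ {ℓ} {i j k : Fin ℓ} → Succ ℓ i j → Succ ℓ i k → j ≡ k
succ-unique (inj₁ p) (inj₁ q) = toℕ-injective (trans (sym p) q)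
succ-unique {j = j} (inj₁ p) (inj₂ (q , _)) = contradiction (toℕ<n j) (<-irrefl (trans (sym p) q))
succ-unique {k = k} (inj₂ (q , _)) (inj₁ p) = contradiction (toℕ<n k) (<-irrefl (trans (sym p) q))
succ-unique (inj₂ (_ , p)) (inj₂ (_ , q)) = toℕ-injective (trans p (sym q))

pred-unique : ∀ {ℓ} {i j k : Fin ℓ} → Succ ℓ i k → Succ ℓ j k → i ≡ j
pred-unique (inj₁ p) (inj₁ q) = toℕ-injective (suc-injective (trans p (sym q)))
pred-unique (inj₁ p) (inj₂ (_ , q)) with trans p q
... | ()
pred-unique (inj₂ (_ , q)) (inj₁ p) with trans p q
... | ()
pred-unique (inj₂ (p , _)) (inj₂ (q , _)) = toℕ-injective (suc-injective (trans p (sym q)))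

¬2-cycle : ∀ {ℓ} {i j : Fin ℓ} → 3 ≤ ℓ → Succ ℓ i j → ¬ Succ ℓ j i
¬2-cycle _ (inj₁ p) (inj₁ q) = m≢1+n+m _ (trans (sym q) (cong suc (sym p)))
¬2-cycle 3≤ℓ (inj₁ p) (inj₂ (q , z)) rewrite z | sym p | sym q with 3≤ℓ
... | s≤s (s≤s ())
¬2-cycle 3≤ℓ (inj₂ (q , z)) (inj₁ p) rewrite z | sym p | sym q with 3≤ℓ
... | s≤s (s≤s ())
¬2-cycle 3≤ℓ (inj₂ (_ , z)) (inj₂ (q , _)) rewrite z | sym q with 3≤ℓ
... | s≤s ()

lookup-injective : ∀ {A : Set} {xs : List A} → Unique xs → ∀ i j → lookup xs i ≡ lookup xs j → i ≡ j
lookup-injective (_ ∷ _) zero zero _ = refl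
lookup-injective (x∉ ∷ _) zero (suc j) e = contradiction e (All.lookup x∉ (∈-lookup j))
lookup-injective (x∉ ∷ _) (suc i) zero e = contradiction (sym e) (All.lookup x∉ (∈-lookup i))
lookup-injective (_ ∷ q) (suc i) (suc j) e = cong suc (lookup-injective q i j e)

bounded : ∀ {m} (f : Fin m → ℕ) → ∃ λ N → ∀ i → f i ≤ N
bounded {zero} f = 0 , λ ()
bounded {suc m} f with bounded (f ∘ suc)
... | N , b = f zero ⊔ N , λ where
  zero → m≤m⊔n _ _
  (suc i) → ≤-trans (b i) (m≤n⊔m (f zero) N)

module _ {G : Graph} where
  open Walks G

  cycEdge-sym : ∀ {ℓ} {C : Cycle G ℓ} {u v} → CycEdge C u v → CycEdge C v u
  cycEdge-sym (i , j , s , e) = i , j , s , swap e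

  cycEdge? : ∀ {ℓ} (C : Cycle G ℓ) u v → Dec (CycEdge C u v)
  cycEdge? C u v = any? λ i → any? λ j → Succ? i j ×-dec
    (((vert C i ≟ᶠ u) ×-dec (vert C j ≟ᶠ v)) ⊎-dec ((vert C i ≟ᶠ v) ×-dec (vert C j ≟ᶠ u)))

  data Chain (R : V → V → Set) : V → List V → V → Set where
    []  : ∀ {v} → Chain R v [] v
    _∷_ : ∀ {u w v xs} → R u w → Chain R w xs v → Chain R u (w ∷ xs) v

  SimplePath : (V → V → Set) → V → V → Set
  SimplePath R u v = ∃ λ xs → Chain R u xs v × Unique (u ∷ xs)

  tail-from : ∀ {R u v x} xs → Chain R u xs v → Unique (u ∷ xs) → x ∈ˡ u ∷ xs → SimplePath R x v
  tail-from xs c q (here refl) = xs , c , q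
  tail-from (_ ∷ xs) (_ ∷ c) (_ ∷ q) (there x∈) = tail-from xs c q x∈

  simplify : ∀ {R u v} → Star R u v → SimplePath R u v
  simplify ε = [] , [] , [] ∷ []
  simplify {u = u} (_◅_ {j = w} r rs) with simplify rs
  ... | xs , c , q with ∈?-with _≟ᶠ_ u (w ∷ xs)
  ...   | yes u∈ = tail-from xs c q u∈
  ...   | no u∉ = w ∷ xs , r ∷ c , All.¬Any⇒All¬ _ u∉ ∷ q

  chain-adj : ∀ {u v} xs → Chain _∼_ u xs v → (i j : Fin (suc (length xs))) →
              suc (toℕ i) ≡ toℕ j → lookup (u ∷ xs) i ∼ lookup (u ∷ xs) j
  chain-adj (w ∷ xs) (a ∷ c) zero (suc zero) e = a
  chain-adj (w ∷ xs) (a ∷ c) (suc i) (suc j) e = chain-adj xs c i j (suc-injective e)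
  chain-adj (w ∷ xs) (a ∷ c) zero (suc (suc j)) ()

  chain-last : ∀ {R u v} xs → Chain R u xs v → (i : Fin (suc (length xs))) →
               suc (toℕ i) ≡ suc (length xs) → lookup (u ∷ xs) i ≡ v
  chain-last [] [] zero e = refl
  chain-last (_ ∷ xs) (_ ∷ c) (suc i) e = chain-last xs c i (suc-injective e)

  close : ∀ {u v} xs → Chain _∼_ u xs v → Unique (u ∷ xs) → 2 ≤ length xs → v ∼ u →
          Cycle G (suc (length xs))
  close {u} {v} xs c q le a = record
    { len≥3 = s≤s le
    ; vert = lookup (u ∷ xs)
    ; inj = λ i j e → lookup-injective q i j e
    ; adj = λ where
        i j (inj₁ e) → chain-adj xs c i j e
        i zero (inj₂ (e , _)) → subst (_∼ u) (sym (chain-last xs c i e)) a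
    }

  Avoiding : V → V → V → V → Set
  Avoiding u v a b = a ∼ b × ¬ (a ≡ u × b ≡ v) × ¬ (a ≡ v × b ≡ u)

  avoiding-sym : ∀ {u v a b} → Avoiding u v a b → Avoiding u v b a
  avoiding-sym (e , p , q) = ∼-sym e , (λ (x , y) → q (y , x)) , (λ (x , y) → p (y , x))

  module Unicyclic {ℓ} {C : Cycle G ℓ} (uni : UnicyclicWith G C) where

    -- A detour contains a simple path from `u` to `v`, of length at least 2 because the edge itself
    -- is avoided. Closed up by the edge it is a cycle, which has to be `C`, so the edge would be on
    -- `C`.
    bridge : ∀ {u v} → u ∼ v → ¬ CycEdge C u v → ¬ Star (Avoiding u v) u v
    bridge {u} {v} a ¬cyc p with simplify p
    ... | [] , [] , _ = ∼-irrefl a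
    ... | _ ∷ [] , (_ , ne , _) ∷ [] , _ = ne (refl , refl)
    ... | xs@(_ ∷ _ ∷ _) , c , q =
      ¬cyc (cycEdge-sym {C = C} (Equivalence.from (proj₂ uni _ C′ v u)
        (last , zero , inj₂ (last≡ , refl) , inj₁ (chain-last xs c last last≡ , refl))))
      where
      forget : ∀ {u′ v′ xs} → Chain (Avoiding u v) u′ xs v′ → Chain _∼_ u′ xs v′
      forget [] = []
      forget ((e , _) ∷ c) = e ∷ forget c
      C′ = close xs (forget c) q (s≤s (s≤s z≤n)) (∼-sym a)
      last : Fin (suc (length xs))
      last = fromℕ< {length xs} ≤-refl
      last≡ : suc (toℕ last) ≡ suc (length xs)
      last≡ = cong suc (toℕ-fromℕ< {length xs} ≤-refl)

    Near : ℕ → V → Set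
    Near zero v = ∃ λ i → vert C i ≡ v
    Near (suc m) v = ∃ λ w → v ∼ w × Near m w

    near? : ∀ m v → Dec (Near m v)
    near? zero v = any? λ i → vert C i ≟ᶠ v
    near? (suc m) v = any? λ w → (v ∼? w) ×-dec near? m w

    walk⇒near : ∀ {u m} i → Walk G u (vert C i) m → Near m u
    walk⇒near i ([] _) = i , refl
    walk⇒near i (a ∷ P) = _ , a , walk⇒near i P

    nearest : ∀ v → ∃ λ d → Near d v × (∀ m → Near m v → d ≤ m)
    nearest v with proj₁ uni v (vert C (fromℕ< (≤-trans (s≤s z≤n) (len≥3 C))))
    ... | m , P = least (λ d → near? d v) m (walk⇒near _ P)

    depth : V → ℕ
    depth v = proj₁ (nearest v)

    near : ∀ v → Near (depth v) v
    near v = proj₁ (proj₂ (nearest v))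

    depth-≤ : ∀ {v m} → Near m v → depth v ≤ m
    depth-≤ {v} {m} = proj₂ (proj₂ (nearest v)) m

    parent : ∀ d {v} → Near d v → V
    parent zero {v} _ = v
    parent (suc d) (w , _) = w

    par : V → V
    par v = parent (depth v) (near v)

    parent-spec : ∀ {d d′ v} (q : Near d v) → d ≡ suc d′ → v ∼ parent d q × Near d′ (parent d q)
    parent-spec (w , a , q) refl = a , q

    par-adj : ∀ {v d} → depth v ≡ suc d → v ∼ par v
    par-adj {v} e = proj₁ (parent-spec (near v) e)

    par-depth : ∀ {v d} → depth v ≡ suc d → depth (par v) ≡ d
    par-depth {v} {d} e = ≤-antisym (depth-≤ (proj₂ (parent-spec (near v) e)))
      (s≤s⁻¹ (subst (_≤ suc (depth (par v))) e (depth-≤ (par v , par-adj e , near (par v)))))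

    footFrom : ∀ d v → depth v ≡ d → Fin ℓ
    footFrom zero v e = proj₁ (subst (λ t → Near t v) e (near v))
    footFrom (suc d) v e = footFrom d (par v) (par-depth e)

    foot : V → Fin ℓ
    foot v = footFrom (depth v) v refl

    footFrom-≡ : ∀ {d v} (e : depth v ≡ d) → footFrom d v e ≡ foot v
    footFrom-≡ refl = refl

    root : ∀ v → depth v ≡ 0 → vert C (foot v) ≡ v
    root v e = subst (λ i → vert C i ≡ v) (footFrom-≡ e) (proj₂ (subst (λ t → Near t v) e (near v)))

    depth-vert : ∀ i → depth (vert C i) ≡ 0
    depth-vert i = n≤0⇒n≡0 (depth-≤ (i , refl))

    module _ {u v} (a : u ∼ v) (¬cyc : ¬ CycEdge C u v)
             (¬up : ¬ (∃ λ d → depth u ≡ suc d × v ≡ par u))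
             (¬down : ¬ (∃ λ d → depth v ≡ suc d × u ≡ par v)) where

      climb-avoiding : ∀ d w (e : depth w ≡ d) → Star (Avoiding u v) w (vert C (footFrom d w e))
      climb-avoiding zero w e = subst (Star _ w) (sym (proj₂ (subst (λ t → Near t w) e (near w)))) ε
      climb-avoiding (suc d) w e =
        (par-adj e , (λ { (refl , refl) → ¬up (d , e , refl) }) , (λ { (refl , refl) → ¬down (d , e , refl) })) ◅
        climb-avoiding d (par w) (par-depth e)

      forward-avoiding : ∀ d i j → toℕ i + d ≡ toℕ j → Star (Avoiding u v) (vert C i) (vert C j)
      forward-avoiding zero i j e with toℕ-injective (trans (sym (+-identityʳ (toℕ i))) e)
      ... | refl = ε
      forward-avoiding (suc d) i j e with next i
      ... | k , inj₁ s = (adj C i k (inj₁ s) ,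
                (λ (p , q) → ¬cyc (i , k , inj₁ s , inj₁ (p , q))) ,
                (λ (p , q) → ¬cyc (i , k , inj₁ s , inj₂ (p , q)))) ◅
              forward-avoiding d k j (trans (cong (_+ d) (sym s)) (trans (sym (+-suc (toℕ i) d)) e))
      ... | k , inj₂ (s , _) = contradiction (toℕ<n j) (≤⇒≯ (subst₂ _≤_ s (trans (sym (+-suc (toℕ i) d)) e)
              (m≤m+n (suc (toℕ i)) d)))

      around-avoiding : ∀ i j → Star (Avoiding u v) (vert C i) (vert C j)
      around-avoiding i j with ≤-total (toℕ i) (toℕ j)
      ... | inj₁ le = forward-avoiding _ i j (proj₂ (m≤n⇒∃[o]m+o≡n le))
      ... | inj₂ le = Star.reverse avoiding-sym (forward-avoiding _ j i (proj₂ (m≤n⇒∃[o]m+o≡n le)))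

      detour : Star (Avoiding u v) u v
      detour = climb-avoiding _ u refl ◅◅
        (around-avoiding (foot u) (foot v) ◅◅ Star.reverse avoiding-sym (climb-avoiding _ v refl))

    -- An edge of neither kind differs from all parent edges and all edges of `C`. Climbing from
    -- both its ends and going along `C` gives a detour around it, against `bridge`.
    edge-kind : ∀ {u v} → u ∼ v → CycEdge C u v ⊎
                (∃ λ d → depth u ≡ suc d × v ≡ par u) ⊎ (∃ λ d → depth v ≡ suc d × u ≡ par v)
    edge-kind {u} {v} a with cycEdge? C u v | child? u v | child? v u
      where
      positive? : ∀ m → Dec (∃ λ d → m ≡ suc d)
      positive? zero = no λ ()
      positive? (suc d) = yes (d , refl)
      child? : ∀ x y → Dec (∃ λ d → depth x ≡ suc d × y ≡ par x)
      child? x y = map′ (λ ((d , e) , p) → d , e , p) (λ (d , e , p) → (d , e) , p)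
        (positive? (depth x) ×-dec (y ≟ᶠ par x))
    ... | yes c | _ | _ = inj₁ c
    ... | no _ | yes up | _ = inj₂ (inj₁ up)
    ... | no _ | no _ | yes down = inj₂ (inj₂ down)
    ... | no ¬c | no ¬up | no ¬down = ⊥-elim (bridge a ¬c (detour a ¬c ¬up ¬down))

    unicyclic⇒rooted : Rooted C
    unicyclic⇒rooted = record
      { foot = foot ; depth = depth ; par = par
      ; depth-vert = depth-vert
      ; foot-vert = λ i → inj C _ _ (root (vert C i) (depth-vert i))
      ; root = root ; par-adj = par-adj ; par-depth = par-depth
      ; par-foot = λ {v} e → trans (sym (footFrom-≡ (par-depth e))) (footFrom-≡ {v = v} e)
      ; edge = edge-kind }

  -- Cycles with rooted trees are unicyclic

  module UniqueCycle {ℓ} {C : Cycle G ℓ} (R : Rooted C) where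
    open Rooted R

    module _ {ℓ′} (C′ : Cycle G ℓ′) where

      neighbours-≢ : ∀ {i j k} → Succ ℓ′ i j → Succ ℓ′ j k → vert C′ i ≢ vert C′ k
      neighbours-≢ s t e with inj C′ _ _ e
      ... | refl = ¬2-cycle (len≥3 C′) s t

      -- A vertex of `C′` off `C` has two different neighbours on `C′`, and only one of them can be
      -- its parent; the other is a child. Repeated, this exceeds every bound on the depth, so `C′`
      -- has no vertex off `C`.
      deeper : ∀ i {d} → depth (vert C′ i) ≡ suc d → ∃ λ j → depth (vert C′ j) ≡ suc (suc d)
      deeper i e with next i | prev i
      ... | j , s | k , t with kind (adj C′ i j s) | kind (∼-sym (adj C′ k i t))
        where
        kind : ∀ {v} → vert C′ i ∼ v → v ≡ par (vert C′ i) ⊎ depth v ≡ suc (suc _)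
        kind a with edge a
        ... | inj₁ (x , _ , _ , inj₁ (p , _)) = contradiction
              (trans (sym (depth-vert x)) (trans (cong (depth) p) e)) λ ()
        ... | inj₁ (_ , y , _ , inj₂ (_ , p)) = contradiction
              (trans (sym (depth-vert y)) (trans (cong (depth) p) e)) λ ()
        ... | inj₂ (inj₁ (_ , _ , p)) = inj₁ p
        ... | inj₂ (inj₂ (_ , e′ , p)) = inj₂ (trans e′ (cong suc
              (trans (sym (par-depth e′)) (trans (cong (depth) (sym p)) e))))
      ... | inj₂ q | _ = j , q
      ... | inj₁ _ | inj₂ q = k , q
      ... | inj₁ p | inj₁ q = contradiction (trans q (sym p)) (neighbours-≢ t s)

      unbounded : ∀ N i {d} → depth (vert C′ i) ≡ suc d → ∃ λ j → N ≤ depth (vert C′ j)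
      unbounded zero i e = i , z≤n
      unbounded (suc N) i e with unbounded N i e
      ... | j , le with depth (vert C′ j) in f
      ...   | zero = i , ≤-trans (s≤s le) (subst (1 ≤_) (sym e) (s≤s z≤n))
      ...   | suc d with deeper j f
      ...     | k , g = k , subst (suc N ≤_) (sym g) (s≤s le)

      on-cycle : ∀ i → depth (vert C′ i) ≡ 0
      on-cycle i with depth (vert C′ i) in e
      ... | zero = refl
      ... | suc d with bounded (depth ∘ vert C′)
      ...   | N , b with unbounded (suc N) i e
      ...     | j , lt = contradiction (b j) (<⇒≱ lt)

      on-cycle-edge : ∀ i {v} → vert C′ i ∼ v → depth v ≡ 0 → CycEdge C (vert C′ i) v
      on-cycle-edge i a v₀ with edge a
      ... | inj₁ c = c
      ... | inj₂ (inj₁ (_ , e , _)) = contradiction (trans (sym (on-cycle i)) e) λ ()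
      ... | inj₂ (inj₂ (_ , e , _)) = contradiction (trans (sym v₀) e) λ ()

      cycEdge⁻ : ∀ {u v} → CycEdge C′ u v → CycEdge C u v
      cycEdge⁻ (i , j , s , inj₁ (refl , refl)) = on-cycle-edge i (adj C′ i j s) (on-cycle j)
      cycEdge⁻ (i , j , s , inj₂ (refl , refl)) =
        cycEdge-sym {C = C} (on-cycle-edge i (adj C′ i j s) (on-cycle j))

      neighbour : ∀ {x v} → CycEdge C (vert C x) v → ∃ λ y → v ≡ vert C y × (Succ ℓ x y ⊎ Succ ℓ y x)
      neighbour (i , j , s , inj₁ (p , q)) with inj C _ _ p
      ... | refl = j , sym q , inj₁ s
      neighbour (i , j , s , inj₂ (p , q)) with inj C _ _ q
      ... | refl = i , sym p , inj₂ s

      -- The two neighbours on `C′` lie on `C` and are different, so they are the predecessor and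
      -- the successor of `x` on `C`.
      advance : ∀ {x y t} → vert C′ t ≡ vert C x → Succ ℓ x y → CycEdge C′ (vert C x) (vert C y)
      advance {x} {y} {t} e s with next t | prev t
      ... | j , sj | k , sk
        with neighbour (subst (λ u → CycEdge C u (vert C′ j)) e (on-cycle-edge t (adj C′ t j sj) (on-cycle j)))
           | neighbour (subst (λ u → CycEdge C u (vert C′ k)) e
               (on-cycle-edge t (∼-sym (adj C′ k t sk)) (on-cycle k)))
      ... | y′ , p , inj₁ s′ | _ = t , j , sj , inj₁ (e , trans p (cong (vert C) (succ-unique s′ s)))
      ... | _ , _ , inj₂ _ | y″ , q , inj₁ s″ = k , t , sk , inj₂ (trans q (cong (vert C) (succ-unique s″ s)) , e)
      ... | _ , p , inj₂ s′ | _ , q , inj₂ s″ =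
            contradiction (trans q (trans (cong (vert C) (pred-unique s″ s′)) (sym p))) (neighbours-≢ sk sj)

      Covered : Fin ℓ → Set
      Covered x = ∃ λ t → vert C′ t ≡ vert C x

      covered-next : ∀ {x y} → Covered x → Succ ℓ x y → Covered y
      covered-next (_ , e) s with advance e s
      ... | i , j , _ , inj₁ (_ , q) = j , q
      ... | i , j , _ , inj₂ (p , _) = i , p

      covered-forward : ∀ d {x y} → Covered x → toℕ x + d ≡ toℕ y → Covered y
      covered-forward zero {x} c e with toℕ-injective (trans (sym (+-identityʳ (toℕ x))) e)
      ... | refl = c
      covered-forward (suc d) {x} {y} c e with next x
      ... | k , s@(inj₁ k≡) = covered-forward d (covered-next c s)
            (trans (cong (_+ d) (sym k≡)) (trans (sym (+-suc (toℕ x) d)) e))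
      ... | k , inj₂ (l , _) = contradiction (toℕ<n y)
            (≤⇒≯ (subst₂ _≤_ l (trans (sym (+-suc (toℕ x) d)) e) (m≤m+n (suc (toℕ x)) d)))

      -- From any vertex of `C′`: up to the end of the numbering, over to position 0, and up to `x`.
      covered : ∀ x → Covered x
      covered x = covered-forward (toℕ x) (covered-next at-last (inj₂ (last≡ , refl′))) (cong (_+ toℕ x) refl′)
        where
        0<ℓ = ≤-trans (s≤s z≤n) (len≥3 C)
        start = fromℕ< (≤-trans (s≤s z≤n) (len≥3 C′))
        end = prev (fromℕ< 0<ℓ)
        refl′ : toℕ (fromℕ< 0<ℓ) ≡ 0
        refl′ = toℕ-fromℕ< 0<ℓ
        last≡ : suc (toℕ (proj₁ end)) ≡ ℓ
        last≡ with proj₂ end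
        ... | inj₁ e = contradiction (trans e refl′) λ ()
        ... | inj₂ (e , _) = e
        at-last : Covered (proj₁ end)
        at-last = covered-forward _ (start , sym (root _ (on-cycle start)))
          (proj₂ (m≤n⇒∃[o]m+o≡n (s≤s⁻¹ (subst (suc (toℕ (foot (vert C′ start))) ≤_) (sym last≡) (toℕ<n _)))))

      cycEdge⁺ : ∀ {u v} → CycEdge C u v → CycEdge C′ u v
      cycEdge⁺ (i , j , s , inj₁ (refl , refl)) = advance (proj₂ (covered i)) s
      cycEdge⁺ (i , j , s , inj₂ (refl , refl)) = cycEdge-sym {C = C′} (advance (proj₂ (covered i)) s)

    rooted⇒unicyclic : UnicyclicWith G C
    rooted⇒unicyclic = Distances.connected R , λ _ C′ u v → mk⇔ (cycEdge⁺ C′) (cycEdge⁻ C′)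

-- The upper bound

unique-map : ∀ {A B : Set} (f : A → B) {xs} → (∀ {x y} → x ∈ˡ xs → y ∈ˡ xs → f x ≡ f y → x ≡ y) →
             Unique xs → Unique (map f xs)
unique-map f inj [] = []
unique-map f {x ∷ xs} inj (x∉ ∷ u) =
  All.map⁺ (All.tabulate λ y∈ e → All.lookup x∉ y∈ (inj (here refl) (there y∈) e)) ∷
  unique-map f (λ p q → inj (there p) (there q)) u

minimiser : ∀ {A : Set} (f : A → ℕ) x xs → ∃ λ m → m ∈ˡ x ∷ xs × (∀ {y} → y ∈ˡ x ∷ xs → f m ≤ f y)
minimiser f x [] = x , here refl , λ { (here refl) → ≤-refl }
minimiser f x (y ∷ ys) with minimiser f y ys
... | m , m∈ , min with ≤-total (f x) (f m)
...   | inj₁ le = x , here refl , λ { (here refl) → ≤-refl ; (there p) → ≤-trans le (min p) }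
...   | inj₂ ge = m , there m∈ , λ { (here refl) → ge ; (there p) → min p }

maximiser : ∀ {A : Set} (f : A → ℕ) x xs → ∃ λ m → m ∈ˡ x ∷ xs × (∀ {y} → y ∈ˡ x ∷ xs → f y ≤ f m)
maximiser f x [] = x , here refl , λ { (here refl) → ≤-refl }
maximiser f x (y ∷ ys) with maximiser f y ys
... | m , m∈ , max with ≤-total (f m) (f x)
...   | inj₁ le = x , here refl , λ { (here refl) → ≤-refl ; (there p) → ≤-trans (max p) le }
...   | inj₂ ge = m , there m∈ , λ { (here refl) → ge ; (there p) → max p }

bigVertices : ∀ {G ℓ} → Cycle G ℓ → List (Fin ℓ)
bigVertices {G} {ℓ} C = filterᵇ (λ i → 3 ≤ᵇ degree G (vert C i)) (allFin ℓ)

bigVertices-unique : ∀ {G ℓ} (C : Cycle G ℓ) → Unique (bigVertices C)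
bigVertices-unique {G} {ℓ} C = Unique.filter⁺ (λ i → T? (3 ≤ᵇ degree G (vert C i))) (Unique.allFin⁺ ℓ)

module _ {G : Graph} where
  open Walks G

  degree-≥ : ∀ v xs → Unique xs → (∀ {x} → x ∈ˡ xs → v ∼ x) → length xs ≤ degree G v
  degree-≥ v xs u nb = unique-length-≤ u λ {x} p →
    ∈-filter⁺ (λ w → T? (E G v w)) (∈-allFin x) (Equivalence.from T-≡ (nb p))

  degree-≤ : ∀ v xs → (∀ {x} → v ∼ x → x ∈ˡ xs) → degree G v ≤ length xs
  degree-≤ v xs nb = unique-length-≤ (Unique.filter⁺ (λ w → T? (E G v w)) (Unique.allFin⁺ (n G)))
    λ p → nb (Equivalence.to T-≡ (proj₂ (∈-filter⁻ (λ w → T? (E G v w)) {xs = allFin (n G)} p)))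

  bigVertices⁻ : ∀ {ℓ} (C : Cycle G ℓ) {i} → i ∈ˡ bigVertices C → 3 ≤ degree G (vert C i)
  bigVertices⁻ {ℓ} C p = ≤ᵇ⇒≤ 3 _
    (proj₂ (∈-filter⁻ (λ i → T? (3 ≤ᵇ degree G (vert C i))) {xs = allFin ℓ} p))

  module _ {ℓ} {C : Cycle G ℓ} (R : Rooted C) where
    open Rooted R

    tree-neighbour : ∀ d v → depth v ≡ suc d → ∃ λ a → depth a ≡ 1 × vert C (foot v) ∼ a
    tree-neighbour zero v e = v , e ,
      ∼-sym (subst (v ∼_) (trans (sym (root (par v) (par-depth e))) (cong (vert C) (par-foot e))) (par-adj e))
    tree-neighbour (suc d) v e with tree-neighbour d (par v) (par-depth e)
    ... | a , a₁ , adj = a , a₁ , subst (λ i → vert C i ∼ a) (par-foot e) adj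

    -- Two neighbours on the cycle and one in the tree. Thus robots in trees have their feet among
    -- the counted vertices.
    foot-big : ∀ v → depth v ≢ 0 → foot v ∈ˡ bigVertices C
    foot-big v v≢0 = ∈-filter⁺ (λ i → T? (3 ≤ᵇ degree G (vert C i))) (∈-allFin i)
      (≤⇒≤ᵇ (three (depth v) refl))
      where
      i = foot v
      three : ∀ d → depth v ≡ d → 3 ≤ degree G (vert C i)
      three zero e = contradiction e v≢0
      three (suc d) e with next i | prev i | tree-neighbour d v e
      ... | j , s | k , t | a , a₁ , adj-a =
        degree-≥ (vert C i) (vert C j ∷ vert C k ∷ a ∷ [])
          ((j≢k ∷ off j ∷ []) ∷ (off k ∷ []) ∷ [] ∷ []) λ where
            (here refl) → adj C i j s
            (there (here refl)) → ∼-sym (adj C k i t)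
            (there (there (here refl))) → adj-a
        where
        off : ∀ x → vert C x ≢ a
        off x refl with trans (sym (depth-vert x)) a₁
        ... | ()
        j≢k : vert C j ≢ vert C k
        j≢k e′ with inj C _ _ e′
        ... | refl = ¬2-cycle (len≥3 C) s t

module Upper {G : Graph} {ℓ : ℕ} {C : Cycle G ℓ} (R : Rooted C) (h κ : ℕ) (ℓ≡ : ℓ ≡ h + h)
             (k≡ : bigCycleVertices C ≡ κ + κ) (0<κ : 0 < κ) where
  open Walks G
  open Rooted R
  open Distances R

  0<h : 0 < h
  0<h = go h ℓ≡
    where
    go : ∀ h → ℓ ≡ h + h → 0 < h
    go zero refl with len≥3 C
    ... | ()
    go (suc h) _ = s≤s z≤n

  cdᶜ : Fin ℓ → Fin ℓ → ℕ
  cdᶜ i j = cd ℓ (toℕ i) (toℕ j)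

  -- A numbering with a movable origin, because the vertex that stays unvisited is placed at `0`.
  -- Positions and distances are linked by `at-arc`, which `rotate` preserves through `rot-arc`.
  record Coordinates : Set where
    field
      at       : Fin ℓ → ℕ
      at-<     : ∀ i → at i < h + h
      at-inj   : ∀ {i j} → at i ≡ at j → i ≡ j
      at-sur   : ∀ r → r < h + h → ∃ λ i → at i ≡ r
      at-arc   : ∀ {i c j} → Arc h (at i) (at c) (at j) → cdᶜ i c + cdᶜ c j ≤ cdᶜ i j

    pos : V → ℕ
    pos v = at (foot v)

  open Coordinates

  standard : Coordinates
  standard = record
    { at = toℕ
    ; at-< = λ i → <-≤-trans (toℕ<n i) (≤-reflexive ℓ≡)
    ; at-inj = toℕ-injective
    ; at-sur = λ r lt → let lt′ = <-≤-trans lt (≤-reflexive (sym ℓ≡)) in fromℕ< lt′ , toℕ-fromℕ< lt′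
    ; at-arc = arc }
    where
    bound : (i : Fin ℓ) → toℕ i < h + h
    bound i = <-≤-trans (toℕ<n i) (≤-reflexive ℓ≡)
    ordered : ∀ i c j → InArc h (toℕ i) (toℕ c) (toℕ j) → cdᶜ i c + cdᶜ c j ≤ cdᶜ i j
    ordered i c j p = subst (λ t → cd t (toℕ i) (toℕ c) + cd t (toℕ c) (toℕ j) ≤ cd t (toℕ i) (toℕ j))
      (sym ℓ≡) (cd-arc (bound i) (bound c) (bound j) p)
    arc : ∀ {i c j} → Arc h (toℕ i) (toℕ c) (toℕ j) → cdᶜ i c + cdᶜ c j ≤ cdᶜ i j
    arc {i} {c} {j} (inj₁ p) = ordered i c j p
    arc {i} {c} {j} (inj₂ p) = subst₂ _≤_
      (trans (+-comm (cdᶜ j c) (cdᶜ c i)) (cong₂ _+_ (cd-sym ℓ (toℕ c) (toℕ i)) (cd-sym ℓ (toℕ j) (toℕ c))))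
      (cd-sym ℓ (toℕ j) (toℕ i)) (ordered j c i p)

  L : ℕ
  L = pred (h + h)

  sucL : suc L ≡ h + h
  sucL = suc-pred (h + h) ⦃ >-nonZero (≤-trans 0<h (m≤m+n h h)) ⦄

  rotate : Coordinates → Coordinates
  rotate q = record
    { at = λ i → rot L (at q i)
    ; at-< = λ i → ≤-trans (s≤s (rot-≤ (bound i))) (≤-reflexive sucL)
    ; at-inj = λ {i} {j} e → at-inj q (rot-inj (bound i) (bound j) e)
    ; at-sur = sur
    ; at-arc = arc }
    where
    bound : ∀ i → at q i ≤ L
    bound i = s≤s⁻¹ (≤-trans (at-< q i) (≤-reflexive (sym sucL)))
    arc : ∀ {i c j} → Arc h (rot L (at q i)) (rot L (at q c)) (rot L (at q j)) → cdᶜ i c + cdᶜ c j ≤ cdᶜ i j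
    arc {i} {c} {j} (inj₁ p) = at-arc q (rot-arc sucL (bound i) (bound c) (bound j) p)
    arc {i} {c} {j} (inj₂ p) = at-arc q (swap (rot-arc sucL (bound j) (bound c) (bound i) p))
    rot-inj : ∀ {a b} → a ≤ L → b ≤ L → rot L a ≡ rot L b → a ≡ b
    rot-inj {zero} {zero} _ _ _ = refl
    rot-inj {zero} {suc b} _ b< refl = contradiction b< (<-irrefl refl)
    rot-inj {suc a} {zero} a< _ refl = contradiction a< (<-irrefl refl)
    rot-inj {suc a} {suc b} _ _ refl = refl
    sur : ∀ r → r < h + h → ∃ λ i → rot L (at q i) ≡ r
    sur r lt with m≤n⇒m<n∨m≡n lt
    ... | inj₁ lt′ with at-sur q (suc r) lt′
    ...   | i , e = i , cong (rot L) e
    sur r lt | inj₂ e with at-sur q 0 (≤-trans 0<h (m≤m+n h h))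
    ... | i , e′ = i , trans (cong (rot L) e′) (suc-injective (trans sucL (sym e)))

  suc-rot : ∀ {a} → 0 < a → suc (rot L a) ≡ a
  suc-rot {suc a} _ = refl

  at-zero : ∀ i → ∃ λ q → at q i ≡ 0
  at-zero i = go _ standard refl
    where
    go : ∀ r q → at q i ≡ r → ∃ λ q → at q i ≡ 0
    go zero q e = q , e
    go (suc r) q e = go r (rotate q) (cong (rot L) e)

  record State (S : Subset (n G)) : Set where
    field
      gp    : GeneralPosition G S
      roams : Roams S
      size  : κ + 3 ≤ ∣ S ∣

  state-step : ∀ {S S′} → Step S S′ → State S → State S′
  state-step s st = record
    { gp = Step.gp′ s ; roams = roams-step s (State.roams st) ; size = ≤-trans (State.size st) (step-∣∣ s) }

  module InState {S} (st : State S) where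
    open State st

    remaining : ∀ c d → Σ (List V) λ xs → Unique xs × (∀ {x} → x ∈ˡ xs → x ∈ S × x ≢ c × x ≢ d) × κ < length xs
    remaining c d with all-but-two S c d
    ... | xs , u , sub , le = xs , u , sub , s≤s⁻¹ (s≤s⁻¹ (≤-trans (≤-reflexive (+-comm 3 κ)) (≤-trans size le)))

    third : ∀ x y → ∃ λ z → z ∈ S × z ≢ x × z ≢ y
    third x y with remaining x y
    ... | z ∷ _ , _ , sub , _ = z , sub (here refl)

    fourth : ∀ a b c → ∃ λ z → z ∈ S × z ≢ a × z ≢ b × z ≢ c
    fourth a b c with remaining a b
    ... | z ∷ [] , _ , _ , lt = contradiction lt (≤⇒≯ 0<κ)
    ... | z ∷ z′ ∷ _ , (z≢z′ ∷ _) ∷ _ , sub , _ with z ≟ᶠ c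
    ...   | no z≢c = z , proj₁ p , proj₁ (proj₂ p) , proj₂ (proj₂ p) , z≢c
      where p = sub (here refl)
    ...   | yes refl = z′ , proj₁ p , proj₁ (proj₂ p) , proj₂ (proj₂ p) , z≢z′ ∘ sym
      where p = sub (there (here refl))

    feet : ∀ {x y} → x ∈ S → y ∈ S → foot x ≡ foot y → x ≡ y
    feet {x} {y} x∈ y∈ e with third x y
    ... | z , z∈ , z≢x , z≢y = foot-injective gp roams x∈ y∈ z∈ (z≢x ∘ sym) (z≢y ∘ sym) e

    module _ (q : Coordinates) where

      pos-≢ : ∀ {x y} → x ∈ S → y ∈ S → x ≢ y → pos q x ≢ pos q y
      pos-≢ x∈ y∈ x≢y = x≢y ∘ feet x∈ y∈ ∘ at-inj q

      free : ∀ {x c z} → depth c ≡ 0 → x ∈ S → c ∈ S → z ∈ S → x ≢ c → z ≢ c →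
             ¬ Arc h (pos q x) (pos q c) (pos q z)
      free {x} {c} {z} c₀ x∈ c∈ z∈ x≢c z≢c arc with x ≟ᶠ z
      ... | yes refl = arc-irrefl 0<h arc
      ... | no x≢z = gp x c z x∈ c∈ z∈ x≢c (z≢c ∘ sym) x≢z
            (between⇒geodesic (x≢z ∘ feet x∈ z∈) c₀ (at-arc q arc))

    on-cycle-sorted : ∀ q {t a b c} → t ∈ S → a ∈ S → b ∈ S → c ∈ S → pos q t ≡ 0 →
      depth a ≡ 0 → depth c ≡ 0 → t ≢ a → t ≢ c → pos q a < pos q b → pos q b < pos q c → ⊥
    on-cycle-sorted q {t} {a} {b} {c} t∈ a∈ b∈ c∈ t₀ a₀ c₀ t≢a t≢c ab bc
      with three-arc {h} (n≢0⇒n>0 λ e → pos-≢ q t∈ a∈ t≢a (trans t₀ (sym e))) ab bc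
    ... | inj₁ arc = free q a₀ t∈ a∈ b∈ t≢a (λ { refl → <-irrefl refl ab })
                       (subst (λ r → Arc h r (pos q a) (pos q b)) (sym t₀) arc)
    ... | inj₂ arc = free q c₀ t∈ c∈ b∈ t≢c (λ { refl → <-irrefl refl bc })
                       (subst (λ r → Arc h r (pos q c) (pos q b)) (sym t₀) arc)

    -- A fourth robot exists since `κ` is positive. With its foot at `0`, the three are sorted by
    -- position, and by `three-arc` the first or the last lies on a shortest arc from the fourth to
    -- the middle one.
    at-most-two-on-cycle : ∀ {a b c} → a ∈ S → b ∈ S → c ∈ S → depth a ≡ 0 → depth b ≡ 0 → depth c ≡ 0 →
      a ≢ b → b ≢ c → a ≢ c → ⊥
    at-most-two-on-cycle {a} {b} {c} a∈ b∈ c∈ a₀ b₀ c₀ a≢b b≢c a≢c with fourth a b c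
    ... | t , t∈ , t≢a , t≢b , t≢c with at-zero (foot t)
    ...   | q , t₀ with <-cmp (pos q a) (pos q b) | <-cmp (pos q b) (pos q c) | <-cmp (pos q a) (pos q c)
    ... | tri≈ _ e _ | _ | _ = pos-≢ q a∈ b∈ a≢b e
    ... | _ | tri≈ _ e _ | _ = pos-≢ q b∈ c∈ b≢c e
    ... | _ | _ | tri≈ _ e _ = pos-≢ q a∈ c∈ a≢c e
    ... | tri< ab _ _ | tri< bc _ _ | _ = on-cycle-sorted q t∈ a∈ b∈ c∈ t₀ a₀ c₀ t≢a t≢c ab bc
    ... | tri< ab _ _ | tri> _ _ cb | tri< ac _ _ = on-cycle-sorted q t∈ a∈ c∈ b∈ t₀ a₀ b₀ t≢a t≢b ac cb
    ... | tri< ab _ _ | tri> _ _ cb | tri> _ _ ca = on-cycle-sorted q t∈ c∈ a∈ b∈ t₀ c₀ b₀ t≢c t≢b ca ab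
    ... | tri> _ _ ba | tri> _ _ cb | _ = on-cycle-sorted q t∈ c∈ b∈ a∈ t₀ c₀ a₀ t≢c t≢a cb ba
    ... | tri> _ _ ba | tri< bc _ _ | tri< ac _ _ = on-cycle-sorted q t∈ b∈ a∈ c∈ t₀ b₀ c₀ t≢b t≢c ba ac
    ... | tri> _ _ ba | tri< bc _ _ | tri> _ _ ca = on-cycle-sorted q t∈ b∈ c∈ a∈ t₀ b₀ a₀ t≢b t≢a bc ca

  -- Counting big vertices in half circles

  count : Coordinates → {P : ℕ → Set} → Decidable P → ℕ
  count q P? = length (filter (P? ∘ at q) (bigVertices C))

  -- Two coordinate systems occur because `turn` compares a half circle before a rotation with one
  -- after it.
  count-disjoint : ∀ q q′ {P Q : ℕ → Set} (P? : Decidable P) (Q? : Decidable Q) →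
    (∀ i → P (at q i) → Q (at q′ i) → ⊥) → count q P? + count q′ Q? ≤ κ + κ
  count-disjoint q q′ P? Q? dis = ≤-trans
    (≤-reflexive (sym (length-++ (filter (P? ∘ at q) bs))))
    (≤-trans (unique-length-≤ {ys = bs} (Unique.++⁺ (Unique.filter⁺ (P? ∘ at q) ub) (Unique.filter⁺ (Q? ∘ at q′) ub)
        λ (p , p′) → dis _ (proj₂ (∈-filter⁻ (P? ∘ at q) {xs = bs} p)) (proj₂ (∈-filter⁻ (Q? ∘ at q′) {xs = bs} p′)))
      λ p → [ proj₁ ∘ ∈-filter⁻ (P? ∘ at q) , proj₁ ∘ ∈-filter⁻ (Q? ∘ at q′) ]′
              (∈-++⁻ (filter (P? ∘ at q) bs) p))
    (≤-reflexive k≡))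
    where
    bs = bigVertices C
    ub = bigVertices-unique C

  InTrees : Subset (n G) → List V → Set
  InTrees S xs = Unique xs × (∀ {x} → x ∈ˡ xs → x ∈ S × depth x ≢ 0)

  count-robots : ∀ {S} → State S → ∀ {xs} → InTrees S xs → ∀ q {P : ℕ → Set} (P? : Decidable P) →
    (∀ {x} → x ∈ˡ xs → P (pos q x)) → length xs ≤ count q P?
  count-robots st {xs} (u , sub) q P? all = ≤-trans (≤-reflexive (sym (length-map foot xs)))
    (unique-length-≤ (unique-map foot (λ p p′ → feet (proj₁ (sub p)) (proj₁ (sub p′))) u) λ p →
      let x , x∈ , e = ∈-map⁻ foot p in
      subst (_∈ˡ _) (sym e) (∈-filter⁺ (P? ∘ at q) (foot-big R x (proj₂ (sub x∈))) (all x∈)))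
    where open InState st

  -- The feet of `xs` are more than `κ` of the `κ + κ` big vertices, and none of them satisfies `P`.
  few-opposite : ∀ {S} → State S → ∀ {xs} → InTrees S xs → κ < length xs → ∀ q {P : ℕ → Set} (P? : Decidable P) →
    (∀ {x} → x ∈ˡ xs → ¬ P (pos q x)) → count q P? ≤ κ
  few-opposite st {xs} it lt q {P} P? none = +-cancelˡ-≤ κ _ _ (≤-trans
    (+-monoˡ-≤ (count q P?) (≤-trans (<⇒≤ lt) (count-robots st it q (¬? ∘ P?) none)))
    (count-disjoint q q (¬? ∘ P?) P? λ _ ¬p p → ¬p p))

  right? : Decidable (λ r → 0 < r × r < h)
  right? r = (0 <? r) ×-dec (r <? h)

  left? : Decidable (λ r → h < r)
  left? r = h <? r

  Balanced : Coordinates → Set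
  Balanced q = count q right? ≤ κ × count q left? ≤ κ

  Str : Coordinates → V → V → Set
  Str q x y = Straddles h (pos q x) (pos q y)

  StraddledBy : Coordinates → (V → Set) → Set
  StraddledBy q P = ∃ λ x → ∃ λ y → P x × P y × Str q x y

  -- The robot `c` is on the long side of the arc from `x` to `y`, so no member of `xs` is over `h`.
  -- Unless one is over `0`, balance puts members on both sides, and `sides-straddle` makes such a
  -- pair straddle `0`. A straddling pair can thus be found in any group of more than `κ` robots in
  -- trees, which lets members join and leave.
  bulk : ∀ {S} (st : State S) q → Balanced q → ∀ {c} → c ∈ S → depth c ≡ 0 →
    StraddledBy q (λ x → x ∈ S × x ≢ c) →
    ∀ {xs} → InTrees S xs → (∀ {x} → x ∈ˡ xs → x ≢ c) → κ < length xs → StraddledBy q (_∈ˡ xs)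
  bulk {S} st q (bal-r , bal-l) {c} c∈ c₀ (x , y , (x∈ , x≢c) , (y∈ , y≢c) , str) {xs} it xs≢c lt
    with Any.any? (λ z → pos q z ≟ 0) xs | Any.any? (λ z → pos q z <? h) xs | Any.any? (λ z → h <? pos q z) xs
  ... | yes a | _ | _ with find a
  -- A robot over `0` straddles together with itself, since `wrap` reads `0` as `h + h`.
  ...   | z , z∈ , z₀ = z , z , z∈ , z∈ , subst (λ r → Straddles h r r) (sym z₀) (m<m+n h 0<h)
  bulk {S} st q (bal-r , bal-l) {c} c∈ c₀ (x , y , (x∈ , x≢c) , (y∈ , y≢c) , str) {xs} it xs≢c lt
      | no ¬z | right | left = go right left
    where
    open InState st
    cp = pos q c
    mem : ∀ {z} → z ∈ˡ xs → z ∈ S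
    mem z∈ = proj₁ (proj₂ it z∈)
    cp≢ : ∀ {z} → z ∈ S → z ≢ c → cp ≢ pos q z
    cp≢ z∈ z≢c = pos-≢ q c∈ z∈ (z≢c ∘ sym)
    block : ∀ {a b} → a ∈ S → b ∈ S → a ≢ c → b ≢ c → ¬ Arc h (pos q a) cp (pos q b)
    block a∈ b∈ a≢c b≢c = free q c₀ a∈ c∈ b∈ a≢c b≢c
    where-c : pos q y < cp × cp < wrap h (pos q x)
    where-c = outside-arc str (at-< q _) (at-< q _) (cp≢ x∈ x≢c) (cp≢ y∈ y≢c) (block y∈ x∈ y≢c x≢c)
    not-h : ∀ {z} → z ∈ˡ xs → pos q z ≢ h
    not-h z∈ e with antipode-arc str (at-< q _) (at-< q _) (proj₁ where-c) (proj₂ where-c)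
                      (λ e′ → cp≢ (mem z∈) (xs≢c z∈) (trans e′ (sym e)))
    ... | inj₁ arc = block y∈ (mem z∈) y≢c (xs≢c z∈) (subst (Arc h (pos q y) cp) (sym e) arc)
    ... | inj₂ arc = block x∈ (mem z∈) x≢c (xs≢c z∈) (subst (Arc h (pos q x) cp) (sym e) arc)
    go : Dec _ → Dec _ → StraddledBy q (_∈ˡ xs)
    go (yes r) (yes l) with find r | find l
    ... | z′ , z′∈ , z′<h | z , z∈ , h<z = z , z′ , z∈ , z′∈ ,
      sides-straddle str (at-< q _) (at-< q _) (proj₁ where-c) (proj₂ where-c) h<z z′<h
        (cp≢ (mem z∈) (xs≢c z∈)) (cp≢ (mem z′∈) (xs≢c z′∈))
        (block (mem z′∈) (mem z∈) (xs≢c z′∈) (xs≢c z∈))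
        (block y∈ (mem z′∈) y≢c (xs≢c z′∈)) (block x∈ (mem z∈) x≢c (xs≢c z∈))
    go (no ¬r) _ = contradiction (≤-trans (count-robots st it q left?
        λ z∈ → ≤∧≢⇒< (≮⇒≥ (All.lookup (All.¬Any⇒All¬ _ ¬r) z∈)) (not-h z∈ ∘ sym)) bal-l) (<⇒≱ lt)
    go _ (no ¬l) = contradiction (≤-trans (count-robots st it q right?
        λ z∈ → n≢0⇒n>0 (All.lookup (All.¬Any⇒All¬ _ ¬z) z∈) ,
               ≤∧≢⇒< (≮⇒≥ (All.lookup (All.¬Any⇒All¬ _ ¬l) z∈)) (not-h z∈)) bal-r) (<⇒≱ lt)

  -- The invariant and its preservation

  straddled-map : ∀ q {P Q : V → Set} → (∀ {x} → P x → Q x) → StraddledBy q P → StraddledBy q Q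
  straddled-map q f (x , y , p , p′ , s) = x , y , f p , f p′ , s

  Off : Subset (n G) → V → V → Set
  Off S c x = x ∈ S × x ≢ c × depth x ≢ 0

  AllInTrees : Subset (n G) → Set
  AllInTrees S = ∀ {y} → y ∈ S → depth y ≢ 0

  -- Whichever robot is on the cycle, or may be the next to step onto it, position 0 stays
  -- inside the arc spanned by the other robots that sit in trees.
  Invariant : Coordinates → Subset (n G) → Set
  Invariant q S = ∀ {c} → c ∈ S → depth c ≡ 0 ⊎ AllInTrees S → StraddledBy q (Off S c)

  same-foot : ∀ {u v} → u ∼ v → depth u ≢ 0 → depth v ≢ 0 → foot u ≡ foot v
  same-foot a u≢0 v≢0 with edge a
  ... | inj₁ (i , _ , _ , inj₁ (refl , _)) = contradiction (depth-vert i) u≢0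
  ... | inj₁ (i , _ , _ , inj₂ (refl , _)) = contradiction (depth-vert i) v≢0
  ... | inj₂ (inj₁ (_ , e , refl)) = sym (par-foot e)
  ... | inj₂ (inj₂ (_ , e , refl)) = par-foot e

  module _ {S S′} (st : State S) (st′ : State S′) (s : Step S S′) (q : Coordinates)
           (bal : Balanced q) (inv : Invariant q S) where
    open Step s using (from; to; from∈; to∉; to∈; from∼to; keep; keep⁻)

    depth-≢ : ∀ {x d} → depth x ≢ 0 → depth d ≡ 0 → x ≢ d
    depth-≢ x≢0 d₀ refl = x≢0 d₀

    kept : ∀ {x} → Off S from x → x ∈ S′ × x ≢ to × depth x ≢ 0
    kept (x∈ , x≢f , x≢0) = keep x∈ x≢f , (λ { refl → to∉ x∈ }) , x≢0

    from-cycle-to-cycle : depth from ≡ 0 → depth to ≡ 0 → Invariant q S′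
    from-cycle-to-cycle f₀ t₀ d∈ (inj₁ d₀) = straddled-map q
      (λ p → let x∈ , _ , x≢0 = kept p in x∈ , depth-≢ x≢0 d₀ , x≢0) (inv from∈ (inj₁ f₀))
    from-cycle-to-cycle f₀ t₀ d∈ (inj₂ none) = contradiction t₀ (none to∈)

    -- When the cycle becomes empty, the invariant is due for every robot `d`. If `d` is not the one
    -- that moved, `from` still serves `bulk` as the cycle robot before the move, and the more than
    -- `κ` robots other than `from` and `d` contain a pair.
    from-cycle-to-tree : depth from ≡ 0 → Invariant q S′
    from-cycle-to-tree f₀ d∈ (inj₁ d₀) = straddled-map q
      (λ p → let x∈ , _ , x≢0 = kept p in x∈ , depth-≢ x≢0 d₀ , x≢0) (inv from∈ (inj₁ f₀))
    from-cycle-to-tree f₀ {d} d∈ (inj₂ none) with d ≟ᶠ to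
    ... | yes refl = straddled-map q kept (inv from∈ (inj₁ f₀))
    ... | no d≢t with InState.remaining st from d
    ...   | xs , u , sub , lt = straddled-map q
            (λ x∈ → let x∈S , x≢f , x≢d = sub x∈ in keep x∈S x≢f , x≢d , none (keep x∈S x≢f))
            (bulk st q bal from∈ f₀ (straddled-map q (λ (x∈ , x≢ , _) → x∈ , x≢) (inv from∈ (inj₁ f₀)))
              (u , λ x∈ → let x∈S , x≢f , _ = sub x∈ in x∈S , none (keep x∈S x≢f))
              (λ x∈ → proj₁ (proj₂ (sub x∈))) lt)

    -- If the cycle was empty, the alternative `AllInTrees` of the invariant already provides a pair
    -- without the robot that steps down. Otherwise another robot `c` is on the cycle and no third
    -- one is, so the remaining robots are in trees and `bulk` applies.
    from-tree-to-cycle : depth from ≢ 0 → depth to ≡ 0 → Invariant q S′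
    from-tree-to-cycle f≢0 t₀ d∈ (inj₂ none) = contradiction t₀ (none to∈)
    from-tree-to-cycle f≢0 t₀ {d} d∈ (inj₁ d₀) with any? (λ c → (c ∈? S) ×-dec (depth c ≟ 0))
    ... | no ¬on = straddled-map q
          (λ p → let x∈ , _ , x≢0 = kept p in x∈ , depth-≢ x≢0 d₀ , x≢0)
          (inv from∈ (inj₂ λ y∈ y₀ → ¬on (_ , y∈ , y₀)))
    ... | yes (c , c∈ , c₀) with InState.remaining st c from
    ...   | xs , u , sub , lt = straddled-map q
            (λ x∈ → let x∈S , _ , x≢f = sub x∈ in keep x∈S x≢f , depth-≢ (tree x∈) d₀ , tree x∈)
            (bulk st q bal c∈ c₀ (straddled-map q (λ (x∈ , x≢ , _) → x∈ , x≢) (inv c∈ (inj₁ c₀)))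
              (u , λ x∈ → proj₁ (sub x∈) , tree x∈) (λ x∈ → proj₁ (proj₂ (sub x∈))) lt)
      where
      tree : ∀ {x} → x ∈ˡ xs → depth x ≢ 0
      tree x∈ x₀ = let x∈S , x≢c , x≢f = sub x∈ in
        InState.at-most-two-on-cycle st′ to∈ (keep c∈ λ { refl → f≢0 c₀ }) (keep x∈S x≢f) t₀ c₀ x₀
          (λ { refl → to∉ c∈ }) (x≢c ∘ sym) (λ { refl → to∉ x∈S })

    within-tree : depth from ≢ 0 → depth to ≢ 0 → Invariant q S′
    within-tree f≢0 t≢0 {d} d∈ on with d ≟ᶠ to
    ... | yes refl = straddled-map q kept (inv from∈ (inj₂ (none on)))
      where
      none : depth to ≡ 0 ⊎ AllInTrees S′ → AllInTrees S
      none (inj₁ t₀) = contradiction t₀ t≢0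
      none (inj₂ none′) {y} y∈ with y ≟ᶠ from
      ... | yes refl = f≢0
      ... | no y≢f = none′ (keep y∈ y≢f)
    ... | no d≢t = move (inv (keep⁻ d∈ d≢t) (on′ on))
      where
      on′ : depth d ≡ 0 ⊎ AllInTrees S′ → depth d ≡ 0 ⊎ AllInTrees S
      on′ (inj₁ d₀) = inj₁ d₀
      on′ (inj₂ none′) = inj₂ none
        where
        none : AllInTrees S
        none {y} y∈ with y ≟ᶠ from
        ... | yes refl = f≢0
        ... | no y≢f = none′ (keep y∈ y≢f)
      image : ∀ {x} → Off S d x → ∃ λ x′ → Off S′ d x′ × pos q x ≡ pos q x′
      image {x} (x∈ , x≢d , x≢0) with x ≟ᶠ from
      ... | yes refl = to , (to∈ , d≢t ∘ sym , t≢0) , cong (at q) (same-foot from∼to f≢0 t≢0)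
      ... | no x≢f = x , (keep x∈ x≢f , x≢d , x≢0) , refl
      move : StraddledBy q (Off S d) → StraddledBy q (Off S′ d)
      move (x , y , p , p′ , str) with image p | image p′
      ... | x′ , o , e | y′ , o′ , e′ = x′ , y′ , o , o′ , subst₂ (Straddles h) e e′ str

    invariant-step : Invariant q S′
    invariant-step with depth from ≟ 0 | depth to ≟ 0
    ... | yes f₀ | yes t₀ = from-cycle-to-cycle f₀ t₀
    ... | yes f₀ | no _ = from-cycle-to-tree f₀
    ... | no f≢0 | yes t₀ = from-tree-to-cycle f≢0 t₀
    ... | no f≢0 | no t≢0 = within-tree f≢0 t≢0

  invariant-star : ∀ {S T q} → Balanced q → Star Step S T → State S → Invariant q S → State T × Invariant q T
  invariant-star bal ε st inv = st , inv
  invariant-star {q = q} bal (s ◅ p) st inv =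
    invariant-star {q = q} bal p st′ (invariant-step st st′ s q bal inv)
    where st′ = state-step s st

  state-star : ∀ {S T} → Star Step S T → State S → State T
  state-star ε st = st
  state-star (s ◅ p) st = state-star p (state-step s st)

  zero-unvisited : ∀ {S c} → State S → ∀ q → Invariant q S → c ∈ S → depth c ≡ 0 → pos q c ≢ 0
  zero-unvisited st q inv c∈ c₀ e with inv c∈ (inj₁ c₀)
  ... | x , y , (x∈ , x≢c , _) , (y∈ , y≢c , _) , str =
    n≮0 (subst (pos q y <_) e (proj₁ (outside-arc str (at-< q _) (at-< q _)
      (pos-≢ q c∈ x∈ (x≢c ∘ sym)) (pos-≢ q c∈ y∈ (y≢c ∘ sym)) (free q c₀ y∈ c∈ x∈ y≢c x≢c))))
    where open InState st

  -- Choosing the origin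

  rot-mono : ∀ {a b} → 0 < a → a ≤ b → rot L a ≤ rot L b
  rot-mono {suc a} {suc b} _ (s≤s le) = le

  rot-straddles : ∀ {x y} → x < h + h → 0 < y → Straddles h x y → Straddles h (rot L x) (rot L y)
  rot-straddles {zero} {suc y} _ _ str =
    <-≤-trans (s≤s⁻¹ (≤-trans str (≤-reflexive (sym sucL)))) (≤-wrap L)
    where
    ≤-wrap : ∀ r → r ≤ wrap h r
    ≤-wrap zero = z≤n
    ≤-wrap (suc r) = ≤-refl
  rot-straddles {suc zero} {suc y} _ _ (s≤s ())
  rot-straddles {suc (suc x)} {suc y} _ _ (s≤s lt) = lt

  -- Turning the circle step by step, the first position at which the right half circle holds at
  -- most half of the trees is balanced, because the step before it the right half held more.
  module Balance {S} (st : State S) {xs : List V} (it : InTrees S xs) (many : κ < length xs)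
                 {x y : V} (y∈ : y ∈ˡ xs) where

    -- `r` counts down the position of `y`. At the latest when `y` is at `0`, the right half
    -- contains no foot of `xs`, and `few-opposite` bounds its count. The third hypothesis keeps all
    -- of `xs` on the arc of length less than `h` that ends at `y`.
    turn : ∀ r q → pos q y ≡ r → Str q x y → (∀ {u} → u ∈ˡ xs → pos q u ≤ pos q y ⊎ pos q y + h < pos q u) →
           count q left? ≤ κ → ∃ λ q → Balanced q × Str q x y
    turn r q e str spread left with count q right? ≤? κ
    ... | yes right = q , (right , left) , str
    turn zero q e str spread left | no ¬right = contradiction
      (few-opposite st it many q right? λ u∈ (p , p′) → empty p p′ (spread u∈)) ¬right
      where
      empty : ∀ {u} → 0 < pos q u → pos q u < h → ¬ (pos q u ≤ pos q y ⊎ pos q y + h < pos q u)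
      empty p _ (inj₁ le) = <⇒≱ p (≤-trans le (≤-reflexive e))
      empty _ p (inj₂ gt) = <-asym p (≤-<-trans (m≤n+m h (pos q y)) gt)
    turn (suc r) q e str spread left | no ¬right = turn r (rotate q) (cong (rot L) e)
      (rot-straddles (at-< q _) 0<y str) spread′ left′
      where
      0<y : 0 < pos q y
      0<y = ≤-trans (s≤s z≤n) (≤-reflexive (sym e))
      y<h : pos q y < h
      y<h = straddle-< {c = 0} str (at-< q _) (≤-trans 0<h (m≤m+n h h))
      spread-rot : ∀ {a b} → 0 < b → b < h → a ≤ b ⊎ b + h < a → rot L a ≤ rot L b ⊎ rot L b + h < rot L a
      spread-rot {zero} {suc b} _ b<h (inj₁ _) =
        inj₂ (s≤s⁻¹ (≤-trans (+-monoˡ-≤ h b<h) (≤-reflexive (sym sucL))))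
      spread-rot {suc a} {suc b} _ _ (inj₁ (s≤s le)) = inj₁ le
      spread-rot {suc a} {suc b} _ _ (inj₂ (s≤s lt)) = inj₂ lt
      spread′ : ∀ {u} → u ∈ˡ xs → pos (rotate q) u ≤ pos (rotate q) y ⊎ pos (rotate q) y + h < pos (rotate q) u
      spread′ u∈ = spread-rot 0<y y<h (spread u∈)
      disjoint : ∀ {a} → 0 < a × a < h → h < rot L a → ⊥
      disjoint {suc a} (_ , p) p′ = <-asym p (m<n⇒m<1+n p′)
      left′ : count (rotate q) left? ≤ κ
      -- The left half after the rotation is disjoint from the right half before it.
      left′ = +-cancelˡ-≤ κ _ _ (≤-trans (+-monoˡ-≤ (count (rotate q) left?) (≰⇒≥ ¬right))
        (count-disjoint q (rotate q) right? left? λ _ → disjoint))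

    -- Rotates until `x` is at `0`. All of `xs` is then below `h`, so the left half is free of it
    -- and has at most `κ` big vertices, as `turn` requires at its start.
    align : ∀ r q → pos q x ≡ r → (∀ {u} → u ∈ˡ xs → pos q x ≤ pos q u) →
            (∀ {u} → u ∈ˡ xs → pos q u ≤ pos q y) → pos q y < pos q x + h → ∃ λ q → Balanced q × Str q x y
    align zero q e min max lt = turn _ q refl
      (subst (λ r → Straddles h r (pos q y)) (sym e) (+-monoˡ-< h y<h)) (inj₁ ∘ max)
      (few-opposite st it many q left? λ u∈ h<u → <-asym h<u (≤-<-trans (max u∈) y<h))
      where
      y<h : pos q y < h
      y<h = subst (λ r → pos q y < r + h) e lt
    align (suc r) q e min max lt = align r (rotate q) (cong (rot L) e)
      (λ u∈ → rot-mono 0<x (min u∈)) (λ u∈ → rot-mono (<-≤-trans 0<x (min u∈)) (max u∈))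
      (s≤s⁻¹ (subst₂ (λ a b → a < b + h) (sym (suc-rot (<-≤-trans 0<x (min y∈)))) (sym (suc-rot 0<x)) lt))
      where
      0<x : 0 < pos q x
      0<x = ≤-trans (s≤s z≤n) (≤-reflexive (sym e))

  -- Roaming is used twice. A visit to the standard position `0` confines the robots in trees to a
  -- short arc that avoids `0`, with the least and greatest positions as its ends. The origin is
  -- chosen inside this arc, and from there a visit to it contradicts the invariant.
  ¬state : ∀ {S} → ¬ State S
  ¬state {S} st with at-sur standard 0 (≤-trans 0<h (m≤m+n h h))
  ... | i , i₀ with State.roams st (vert C i)
  ... | T , c∈ , p = at-visit (state-star p st)
    where
    c = vert C i
    c₀ = depth-vert i
    cp : pos standard c ≡ 0
    cp = trans (cong toℕ (foot-vert i)) i₀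
    at-visit : State T → ⊥
    at-visit stT = finish trees
      where
      open InState stT
      Trees : Set
      Trees = Σ (List V) λ xs → InTrees T xs × κ < length xs × (∀ {x} → x ∈ˡ xs → x ≢ c)
      trees : Trees
      trees with any? (λ d → (d ∈? T) ×-dec (¬? (d ≟ᶠ c) ×-dec (depth d ≟ 0)))
      ... | no ¬on with remaining c c
      ...   | xs , u , sub , lt = xs , (u , λ x∈ → let x∈T , x≢c , _ = sub x∈ in
              x∈T , λ x₀ → ¬on (_ , x∈T , x≢c , x₀)) , lt , λ x∈ → proj₁ (proj₂ (sub x∈))
      trees | yes (d , d∈ , d≢c , d₀) with remaining c d
      ... | xs , u , sub , lt = xs , (u , λ x∈ → let x∈T , x≢c , x≢d = sub x∈ in
              x∈T , λ x₀ → at-most-two-on-cycle c∈ d∈ x∈T c₀ d₀ x₀ (d≢c ∘ sym) (x≢d ∘ sym) (x≢c ∘ sym)) ,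
              lt , λ x∈ → proj₁ (proj₂ (sub x∈))
      finish : Trees → ⊥
      finish (x₁ ∷ xs , it , lt , ≢c) with minimiser (pos standard) x₁ xs | maximiser (pos standard) x₁ xs
      ... | x , x∈ , min | y , y∈ , max
        with Balance.align stT it lt {x} y∈ _ standard refl min max narrow
        where
        narrow : pos standard y < pos standard x + h
        -- Otherwise `c`, which is at `0`, would lie on a shortest arc from `x` to `y`.
        narrow = ≰⇒> λ le → free standard c₀ (proj₁ (proj₂ it x∈)) c∈ (proj₁ (proj₂ it y∈)) (≢c x∈) (≢c y∈)
          (inj₁ (inj₂ (le , inj₁ (subst (_< pos standard x) (sym cp)
            (n≢0⇒n>0 λ e → pos-≢ standard c∈ (proj₁ (proj₂ it x∈)) (≢c x∈ ∘ sym) (trans cp (sym e)))))))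
      ... | q , bal , str with at-sur q 0 (≤-trans 0<h (m≤m+n h h))
      ... | j , j₀ with State.roams stT (vert C j)
      ... | T′ , v∈ , p′ with invariant-star {q = q} bal p′ stT invT
        where
        invT : Invariant q T
        invT d∈ (inj₂ none) = contradiction c₀ (none c∈)
        invT d∈ (inj₁ d₀) = x , y , off x∈ , off y∈ , str
          where
          off : ∀ {z} → z ∈ˡ x₁ ∷ xs → Off T _ z
          off z∈ = let z∈T , z≢0 = proj₂ it z∈ in z∈T , (λ { refl → z≢0 d₀ }) , z≢0
      ... | st′ , inv′ = zero-unvisited st′ q inv′ v∈ (depth-vert j) (trans (cong (at q) (foot-vert j)) j₀)

  mobile-≤ : ∀ {S} → Mobile G S → ∣ S ∣ ≤ κ + 2
  mobile-≤ {S} mob with ∣ S ∣ ≤? κ + 2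
  ... | yes le = le
  ... | no ¬le = ⊥-elim (¬state (record
    { gp = proj₁ mob ; roams = mobile⇒roams mob
    ; size = ≤-trans (≤-reflexive (+-suc κ 2)) (≰⇒> ¬le) }))

-- A family attaining the bound

does⁻ : ∀ {P : Set} (P? : Dec P) → does P? ≡ true → P
does⁻ (yes p) _ = p

-- The cycle of length 2κ + 2 with a pendant vertex at each of the positions 1, …, 2κ.
module Comb (κ : ℕ) (0<κ : 0 < κ) where

  ℓ t : ℕ
  ℓ = suc κ + suc κ
  t = κ + κ

  ℓ≡ : ℓ ≡ suc (suc t)
  ℓ≡ = cong suc (+-suc κ κ)

  Kind : Set
  Kind = Fin ℓ ⊎ Fin t

  joined : Kind → Kind → Bool
  joined (inj₁ i) (inj₁ j) = does (Succ? i j ⊎-dec Succ? j i)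
  joined (inj₁ i) (inj₂ j) = does (toℕ i ≟ suc (toℕ j))
  joined (inj₂ j) (inj₁ i) = does (toℕ i ≟ suc (toℕ j))
  joined (inj₂ _) (inj₂ _) = false

  kind : Fin (ℓ + t) → Kind
  kind = splitAt ℓ

  joined-sym : ∀ a b → joined a b ≡ joined b a
  joined-sym (inj₁ i) (inj₁ j) = ∨-comm (does (Succ? i j)) (does (Succ? j i))
  joined-sym (inj₁ i) (inj₂ j) = refl
  joined-sym (inj₂ i) (inj₁ j) = refl
  joined-sym (inj₂ i) (inj₂ j) = refl

  3≤ℓ : 3 ≤ ℓ
  3≤ℓ = ≤-trans (s≤s (s≤s (≤-trans 0<κ (m≤m+n κ κ)))) (≤-reflexive (sym ℓ≡))

  joined-irrefl : ∀ a → joined a a ≡ false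
  joined-irrefl (inj₁ i) = dec-false (Succ? i i ⊎-dec Succ? i i)
    λ { (inj₁ s) → ¬2-cycle 3≤ℓ s s ; (inj₂ s) → ¬2-cycle 3≤ℓ s s }
  joined-irrefl (inj₂ _) = refl

  G : Graph
  G = record
    { n = ℓ + t
    ; E = λ u v → joined (kind u) (kind v)
    ; sym = λ u v → joined-sym (kind u) (kind v)
    ; irref = λ v → joined-irrefl (kind v) }

  open Walks G

  cyc : Fin ℓ → V
  cyc i = i ↑ˡ t

  leaf : Fin t → V
  leaf j = ℓ ↑ʳ j

  base< : (j : Fin t) → suc (toℕ j) < ℓ
  base< j = ≤-trans (s≤s (s≤s (<⇒≤ (toℕ<n j)))) (≤-reflexive (sym ℓ≡))

  base : Fin t → Fin ℓ
  base j = fromℕ< (base< j)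

  toℕ-base : ∀ j → toℕ (base j) ≡ suc (toℕ j)
  toℕ-base j = toℕ-fromℕ< (base< j)

  data View : V → Set where
    isCyc  : ∀ i → View (cyc i)
    isLeaf : ∀ j → View (leaf j)

  view : ∀ v → View v
  view v with splitAt ℓ v in e
  ... | inj₁ i = subst View (splitAt⁻¹-↑ˡ e) (isCyc i)
  ... | inj₂ j = subst View (splitAt⁻¹-↑ʳ {m = ℓ} e) (isLeaf j)

  kind-cyc : ∀ i → kind (cyc i) ≡ inj₁ i
  kind-cyc i = splitAt-↑ˡ ℓ i t

  kind-leaf : ∀ j → kind (leaf j) ≡ inj₂ j
  kind-leaf j = splitAt-↑ʳ ℓ t j

  footᵏ : Kind → Fin ℓ
  footᵏ (inj₁ i) = i
  footᵏ (inj₂ j) = base j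

  depthᵏ : Kind → ℕ
  depthᵏ (inj₁ _) = 0
  depthᵏ (inj₂ _) = 1

  footᵛ : V → Fin ℓ
  footᵛ v = footᵏ (kind v)

  depthᵛ : V → ℕ
  depthᵛ v = depthᵏ (kind v)

  cyc∼cyc : ∀ {i j} → Succ ℓ i j ⊎ Succ ℓ j i → cyc i ∼ cyc j
  cyc∼cyc {i} {j} s rewrite kind-cyc i | kind-cyc j = dec-true (Succ? i j ⊎-dec Succ? j i) s

  cyc∼cyc⁻ : ∀ {i j} → cyc i ∼ cyc j → Succ ℓ i j ⊎ Succ ℓ j i
  cyc∼cyc⁻ {i} {j} a rewrite kind-cyc i | kind-cyc j = does⁻ (Succ? i j ⊎-dec Succ? j i) a

  leaf∼base : ∀ j → leaf j ∼ cyc (base j)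
  leaf∼base j rewrite kind-cyc (base j) | kind-leaf j = dec-true (toℕ (base j) ≟ suc (toℕ j)) (toℕ-base j)

  leaf∼cyc⁻ : ∀ {j i} → leaf j ∼ cyc i → i ≡ base j
  leaf∼cyc⁻ {j} {i} a rewrite kind-cyc i | kind-leaf j =
    toℕ-injective (trans (does⁻ (toℕ i ≟ suc (toℕ j)) a) (sym (toℕ-base j)))

  ¬leaf∼leaf : ∀ {i j} → ¬ (leaf i ∼ leaf j)
  ¬leaf∼leaf {i} {j} a rewrite kind-leaf i | kind-leaf j with a
  ... | ()

  C : Cycle G ℓ
  C = record { len≥3 = 3≤ℓ ; vert = cyc ; inj = λ i j → ↑ˡ-injective t i j ; adj = λ i j s → cyc∼cyc (inj₁ s) }

  R : Rooted C
  R = record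
    { foot = footᵛ ; depth = depthᵛ ; par = cyc ∘ footᵛ
    ; depth-vert = λ i → cong depthᵏ (kind-cyc i)
    ; foot-vert = λ i → cong footᵏ (kind-cyc i)
    ; root = λ v → root v (view v)
    ; par-adj = λ {v} → par-adj v (view v)
    ; par-depth = λ {v} e → trans (cong depthᵏ (kind-cyc (footᵛ v))) (suc-injective (trans (sym (one v (view v) e)) e))
    ; par-foot = λ {v} _ → cong footᵏ (kind-cyc (footᵛ v))
    ; edge = λ {u} {v} → edge (view u) (view v) }
    where
    root : ∀ v → View v → depthᵛ v ≡ 0 → cyc (footᵛ v) ≡ v
    root _ (isCyc i) _ = cong (cyc ∘ footᵏ) (kind-cyc i)
    root _ (isLeaf j) e with trans (sym (cong depthᵏ (kind-leaf j))) e
    ... | ()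
    par-adj : ∀ v → View v → ∀ {d} → depthᵛ v ≡ suc d → v ∼ cyc (footᵛ v)
    par-adj _ (isCyc i) e with trans (sym (cong depthᵏ (kind-cyc i))) e
    ... | ()
    par-adj _ (isLeaf j) _ = subst (λ k → leaf j ∼ cyc (footᵏ k)) (sym (kind-leaf j)) (leaf∼base j)
    one : ∀ v → View v → ∀ {d} → depthᵛ v ≡ suc d → depthᵛ v ≡ 1
    one _ (isCyc i) e with trans (sym (cong depthᵏ (kind-cyc i))) e
    ... | ()
    one _ (isLeaf j) _ = cong depthᵏ (kind-leaf j)
    edge : ∀ {u v} → View u → View v → u ∼ v → CycEdge C u v ⊎
           (∃ λ d → depthᵛ u ≡ suc d × v ≡ cyc (footᵛ u)) ⊎ (∃ λ d → depthᵛ v ≡ suc d × u ≡ cyc (footᵛ v))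
    edge (isCyc i) (isCyc j) a with cyc∼cyc⁻ a
    ... | inj₁ s = inj₁ (i , j , s , inj₁ (refl , refl))
    ... | inj₂ s = inj₁ (j , i , s , inj₂ (refl , refl))
    edge (isLeaf j) (isCyc i) a = inj₂ (inj₁ (0 , cong depthᵏ (kind-leaf j) ,
      trans (cong cyc (leaf∼cyc⁻ a)) (cong (cyc ∘ footᵏ) (sym (kind-leaf j)))))
    edge (isCyc i) (isLeaf j) a = inj₂ (inj₂ (0 , cong depthᵏ (kind-leaf j) ,
      trans (cong cyc (leaf∼cyc⁻ (∼-sym {cyc i} a))) (cong (cyc ∘ footᵏ) (sym (kind-leaf j)))))
    edge (isLeaf i) (isLeaf j) a = ⊥-elim (¬leaf∼leaf a)

  open Rooted R using (foot; depth)

  foot-leaf : ∀ j → foot (leaf j) ≡ base j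
  foot-leaf j = cong footᵏ (kind-leaf j)

  degree-≤2 : ∀ i → (∀ j → toℕ i ≢ suc (toℕ j)) → degree G (cyc i) ≤ 2
  degree-≤2 i bare with next i | prev i
  ... | j , s | k , s′ = degree-≤ {G = G} (cyc i) (cyc j ∷ cyc k ∷ []) λ {x} → adjacent (view x)
    where
    adjacent : ∀ {x} → View x → cyc i ∼ x → x ∈ˡ cyc j ∷ cyc k ∷ []
    adjacent (isCyc x) a with cyc∼cyc⁻ a
    ... | inj₁ q = here (cong cyc (succ-unique q s))
    ... | inj₂ q = there (here (cong cyc (pred-unique q s′)))
    adjacent (isLeaf x) a = contradiction (trans (cong toℕ (leaf∼cyc⁻ (∼-sym {cyc i} a))) (toℕ-base x)) (bare x)

  big-count : bigCycleVertices C ≡ κ + κ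
  big-count = trans (≤-antisym
    (unique-length-≤ (bigVertices-unique C) λ {i} p → sub i (bigVertices⁻ C p))
    (unique-length-≤ (Unique.map⁺ base-injective (Unique.allFin⁺ t)) sup))
    (trans (length-map base (allFin t)) (length-tabulate id))
    where
    base-injective : ∀ {i j} → base i ≡ base j → i ≡ j
    base-injective {i} {j} e = toℕ-injective (suc-injective (trans (sym (toℕ-base i)) (trans (cong toℕ e) (toℕ-base j))))
    sub : ∀ i → 3 ≤ degree G (cyc i) → i ∈ˡ map base (allFin t)
    sub i big with any? (λ j → toℕ i ≟ suc (toℕ j))
    ... | yes (j , e) = subst (_∈ˡ map base (allFin t)) (toℕ-injective (trans (toℕ-base j) (sym e))) (∈-map⁺ base (∈-allFin j))
    ... | no ¬e = contradiction big (<⇒≱ (s≤s (degree-≤2 i λ j e → ¬e (j , e))))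
    sup : ∀ {i} → i ∈ˡ map base (allFin t) → i ∈ˡ bigVertices C
    sup p with ∈-map⁻ base p
    ... | j , _ , refl = subst (_∈ˡ bigVertices C) (foot-leaf j)
          (foot-big R (leaf j) λ e → contradiction (trans (sym (cong depthᵏ (kind-leaf j))) e) λ ())

  pos-leaf : ∀ j → toℕ (foot (leaf j)) ≡ suc (toℕ j)
  pos-leaf j = trans (cong toℕ (foot-leaf j)) (toℕ-base j)

  depth-leaf : ∀ j → depth (leaf j) ≡ 1
  depth-leaf j = cong depthᵏ (kind-leaf j)

  shape : ∀ v → depth v ≡ 0 ⊎ (depth v ≡ 1 × 0 < toℕ (foot v) × toℕ (foot v) ≤ t)
  shape v with view v
  ... | isCyc i = inj₁ (Rooted.depth-vert R i)
  ... | isLeaf j = inj₂ (depth-leaf j , ≤-trans (s≤s z≤n) (≤-reflexive (sym (pos-leaf j))) ,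
                         ≤-trans (≤-reflexive (pos-leaf j)) (toℕ<n j))

  vertex-≡ : ∀ {x y} → depth x ≡ depth y → toℕ (foot x) ≡ toℕ (foot y) → x ≡ y
  vertex-≡ {x} {y} d p with view x | view y
  ... | isCyc i | isCyc j = Distances.roots-≡ R (Rooted.depth-vert R i) (Rooted.depth-vert R j) (toℕ-injective p)
  ... | isCyc i | isLeaf j = contradiction (trans (sym (Rooted.depth-vert R i)) (trans d (depth-leaf j))) λ ()
  ... | isLeaf i | isCyc j = contradiction (trans (sym (Rooted.depth-vert R j)) (trans (sym d) (depth-leaf i))) λ ()
  ... | isLeaf i | isLeaf j =
        cong leaf (toℕ-injective (suc-injective (trans (sym (pos-leaf i)) (trans p (pos-leaf j)))))

  on-leaf : ∀ r → r < t → ∃ λ v → depth v ≡ 1 × toℕ (foot v) ≡ suc r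
  on-leaf r lt = leaf (fromℕ< lt) , depth-leaf (fromℕ< lt) ,
    trans (pos-leaf (fromℕ< lt)) (cong suc (toℕ-fromℕ< lt))

-- The tour of the comb

module Tour {G : Graph} {ℓ : ℕ} {C : Cycle G ℓ} (R : Rooted C) (κ′ : ℕ)
  (ℓ≡ : ℓ ≡ suc (suc κ′) + suc (suc κ′))
  (shape : ∀ v → Rooted.depth R v ≡ 0 ⊎
    (Rooted.depth R v ≡ 1 × 0 < toℕ (Rooted.foot R v) × toℕ (Rooted.foot R v) ≤ suc κ′ + suc κ′))
  (vertex-≡ : ∀ {x y} → Rooted.depth R x ≡ Rooted.depth R y → toℕ (Rooted.foot R x) ≡ toℕ (Rooted.foot R y) → x ≡ y)
  (on-leaf : ∀ r → r < suc κ′ + suc κ′ → ∃ λ v → Rooted.depth R v ≡ 1 × toℕ (Rooted.foot R v) ≡ suc r)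
  where
  open Walks G
  open Rooted R
  open Distances R

  κ : ℕ
  κ = suc κ′

  pos : V → ℕ
  pos v = toℕ (foot v)

  -- A vertex is determined by its depth and position, so sets of robots are predicates on these.
  Pattern : Set₁
  Pattern = ℕ → ℕ → Set

  _at_ : Pattern → V → Set
  P at v = P (depth v) (pos v)

  _⊨_ : Subset (n G) → Pattern → Set
  S ⊨ P = ∀ w → (w ∈ S → P at w) × (P at w → w ∈ S)

  <ℓ : ∀ {r} → r ≤ κ + suc κ → r < ℓ
  <ℓ le = ≤-trans (s≤s le) (≤-reflexive (sym ℓ≡))

  on-cycle : ∀ r → r < ℓ → ∃ λ v → depth v ≡ 0 × pos v ≡ r
  on-cycle r lt = vert C (fromℕ< lt) , depth-vert (fromℕ< lt) ,
    trans (cong toℕ (foot-vert (fromℕ< lt))) (toℕ-fromℕ< lt)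

  up-adj : ∀ {u v} → depth u ≡ 1 → depth v ≡ 0 → pos u ≡ pos v → u ∼ v
  up-adj {u} {v} u₁ v₀ e = subst (u ∼_) (roots-≡ (par-depth u₁) v₀
    (trans (par-foot u₁) (toℕ-injective e))) (par-adj u₁)

  cycle-adj : ∀ {u v} → depth u ≡ 0 → depth v ≡ 0 →
    suc (pos v) ≡ pos u ⊎ (pos u ≡ 0 × suc (pos v) ≡ ℓ) → u ∼ v
  cycle-adj {u} {v} u₀ v₀ e = subst₂ _∼_ (root u u₀) (root v v₀) (∼-sym {vert C (foot v)} (adj C _ _ (succ e)))
    where
    succ : suc (pos v) ≡ pos u ⊎ (pos u ≡ 0 × suc (pos v) ≡ ℓ) → Succ ℓ (foot v) (foot u)
    succ (inj₁ e) = inj₁ e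
    succ (inj₂ (z , e)) = inj₂ (e , z)

  -- An arc of κ + 1 positions is shorter than half the cycle, so a robot on the cycle outside
  -- this arc lies on no geodesic between robots with feet inside it.
  record Spread (P : Pattern) : Set where
    field
      single : ∀ {d d′ r} → P d r → P d′ r → d ≡ d′
      window : ∀ {ρ} → P 0 ρ → ∃ λ lo → (∀ {d r} → P d r → r ≢ ρ → lo ≤ r × r ≤ lo + κ) × (ρ < lo ⊎ lo + κ < ρ)

  spread⇒gp : ∀ {P S} → Spread P → S ⊨ P → GeneralPosition G S
  spread⇒gp {P} {S} sp rep = general-position feet free
    where
    open Spread sp
    feet : ∀ {x y} → x ∈ S → y ∈ S → foot x ≡ foot y → x ≡ y
    feet {x} {y} x∈ y∈ e = vertex-≡ (single (proj₁ (rep x) x∈) (subst (P (depth y)) (cong toℕ (sym e)) (proj₁ (rep y) y∈))) (cong toℕ e)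
    pos-≢ : ∀ {x y} → x ∈ S → y ∈ S → x ≢ y → pos x ≢ pos y
    pos-≢ x∈ y∈ x≢y e = x≢y (feet x∈ y∈ (toℕ-injective e))
    ordered : ∀ {x c z} → x ∈ S → c ∈ S → z ∈ S → x ≢ c → z ≢ c → pos x < pos z → ¬ Between x c z
    ordered {x} {c} {z} x∈ c∈ z∈ x≢c z≢c lt (c₀ , le)
      with window (subst (λ d → P d (pos c)) c₀ (proj₁ (rep c) c∈))
    ... | lo , within , side with within (proj₁ (rep x) x∈) (pos-≢ x∈ c∈ x≢c) | within (proj₁ (rep z) z∈) (pos-≢ z∈ c∈ z≢c)
    ...   | lx , xh | lz , zh = off-arc ℓ≡ lt
            (≤-trans (s≤s zh) (≤-trans (≤-reflexive (sym (+-suc lo κ))) (+-monoˡ-≤ (suc κ) lx)))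
            (toℕ<n (foot z)) (toℕ<n (foot c))
            ([ (λ p → inj₁ (<-≤-trans p lx)) , (λ p → inj₂ (≤-<-trans zh p)) ]′ side) le
    free : ∀ {x c z} → x ∈ S → c ∈ S → z ∈ S → x ≢ c → c ≢ z → x ≢ z → ¬ Between x c z
    free {x} {c} {z} x∈ c∈ z∈ x≢c c≢z x≢z b with <-cmp (pos x) (pos z)
    ... | tri< lt _ _ = ordered x∈ c∈ z∈ x≢c (c≢z ∘ sym) lt b
    ... | tri≈ _ e _ = pos-≢ x∈ z∈ x≢z e
    ... | tri> _ _ gt = ordered z∈ c∈ x∈ (c≢z ∘ sym) x≢c gt (between-sym {x} {c} {z} b)

  -- Quantified over all sets of pattern `P`, so that runs are joined by patterns instead of
  -- equations between subsets. `Q` grows as moves are put in front.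
  record Visits (P Q : Pattern) : Set where
    constructor visiting
    field
      tour : ∀ S → S ⊨ P → Σ (List (Subset (n G))) λ rest →
             Run G S rest × (∀ x → Q at x → Any (x ∈_) (S ∷ rest))

  visits-here : ∀ {P} → Visits P P
  visits-here = visiting λ S rep → [] , done , λ x p → here (proj₂ (rep x) p)

  visits-start : ∀ {P Q} → Visits P Q → Visits P (λ d r → P d r ⊎ Q d r)
  visits-start (visiting f) = visiting λ S rep → let rest , run , all = f S rep in
    rest , run , λ where
      x (inj₁ p) → here (proj₂ (rep x) p)
      x (inj₂ q) → all x q

  visits-weaken : ∀ {P Q Q′} → (∀ x → Q′ at x → Q at x) → Visits P Q → Visits P Q′
  visits-weaken w (visiting f) = visiting λ S rep → let rest , run , all = f S rep in
    rest , run , λ x p → all x (w x p)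

  visits-≡ : ∀ {P P′ Q} → (∀ d r → P d r → P′ d r) → (∀ d r → P′ d r → P d r) → Visits P′ Q → Visits P Q
  visits-≡ f g (visiting v) = visiting λ S rep → v S λ w → f _ _ ∘ proj₁ (rep w) , proj₂ (rep w) ∘ g _ _

  visits-move : ∀ {P P′ Q} → Spread P′ → ∀ u v → u ∼ v → P at u → ¬ (P at v) → P′ at v →
    (∀ w → P′ at w → w ≢ v → P at w × w ≢ u) → (∀ w → P at w → w ≢ u → P′ at w) →
    Visits P′ Q → Visits P (λ d r → P d r ⊎ Q d r)
  visits-move {P} {P′} {Q} sp u v a pu ¬pv p′v back forth (visiting f) = visiting λ S rep →
    let S′ = (S [ u ]≔ outside) [ v ]≔ inside
        rest , run , all = f S′ (rep′ S rep) in
    S′ ∷ rest ,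
    step (u , v , proj₂ (rep u) pu , (λ v∈ → ¬pv (proj₁ (rep v) v∈)) , a , refl , spread⇒gp sp (rep′ S rep)) run ,
    λ where
      x (inj₁ p) → here (proj₂ (rep x) p)
      x (inj₂ q) → there (all x q)
    where
    module _ (S : Subset (n G)) (rep : S ⊨ P) where
      S′ : Subset (n G)
      S′ = (S [ u ]≔ outside) [ v ]≔ inside
      rep′ : S′ ⊨ P′
      rep′ w with w ≟ᶠ v
      ... | yes refl = (λ _ → p′v) , (λ _ → ≔-∈ _ v)
      ... | no w≢v = (λ w∈ → forth w (proj₁ (rep w) (in-S w∈)) (w≢u w∈)) ,
          λ p′ → let p , w≢u = back w p′ w≢v in ≔-other _ w≢v (≔-other S w≢u (proj₂ (rep w) p))
        where
        w≢u : w ∈ S′ → w ≢ u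
        w≢u w∈ refl = ≔-∉ S u (≔-other⁻ _ w≢v w∈)
        in-S : w ∈ S′ → w ∈ S
        in-S w∈ = ≔-other⁻ S (w≢u w∈) (≔-other⁻ _ w≢v w∈)

  Group : ℕ → Pattern
  Group a d r = d ≡ 1 × a < r × r ≤ suc (a + κ)

  Outside : ℕ → ℕ → Set
  Outside a ρ = ρ ≤ a ⊎ suc (a + κ) < ρ

  Patrol : ℕ → ℕ → ℕ → Pattern
  Patrol a δ ρ d r = Group a d r ⊎ (d ≡ δ × r ≡ ρ)

  -- The first pattern of the tour (`a = 0`) and the last (`a = κ`). The cycle positions `κ + 1` and
  -- `κ` are beneath the group throughout the patrol, so the flanking robots have to visit them.
  Flanked : ℕ → Pattern
  Flanked a d r = (d ≡ 1 × a < r × r ≤ a + κ) ⊎ (d ≡ 0 × (r ≡ a ⊎ r ≡ suc (a + κ)))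

  ¬in-group : ∀ {a d r} → Outside a r → ¬ Group a d r
  ¬in-group (inj₁ le) (_ , gt , _) = <⇒≱ gt le
  ¬in-group (inj₂ gt) (_ , _ , le) = <⇒≱ gt le

  patrol-spread : ∀ {a δ ρ} → Outside a ρ → Spread (Patrol a δ ρ)
  patrol-spread {a} {δ} {ρ} out = record { single = single ; window = window }
    where
    single : ∀ {d d′ r} → Patrol a δ ρ d r → Patrol a δ ρ d′ r → d ≡ d′
    single (inj₁ (p , _)) (inj₁ (p′ , _)) = trans p (sym p′)
    single (inj₂ (p , _)) (inj₂ (p′ , _)) = trans p (sym p′)
    single (inj₁ g) (inj₂ (_ , refl)) = contradiction g (¬in-group out)
    single (inj₂ (_ , refl)) (inj₁ g) = contradiction g (¬in-group out)
    window : ∀ {ρ′} → Patrol a δ ρ 0 ρ′ →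
      ∃ λ lo → (∀ {d r} → Patrol a δ ρ d r → r ≢ ρ′ → lo ≤ r × r ≤ lo + κ) × (ρ′ < lo ⊎ lo + κ < ρ′)
    window (inj₂ (_ , refl)) = suc a , within , side out
      where
      within : ∀ {d r} → Patrol a δ ρ d r → r ≢ ρ → suc a ≤ r × r ≤ suc a + κ
      within (inj₁ (_ , gt , le)) _ = gt , le
      within (inj₂ (_ , e)) ne = contradiction e ne
      side : Outside a ρ → ρ < suc a ⊎ suc a + κ < ρ
      side (inj₁ le) = inj₁ (s≤s le)
      side (inj₂ gt) = inj₂ gt

  flanked-spread : ∀ a → Spread (Flanked a)
  flanked-spread a = record { single = single ; window = window }
    where
    clash : ∀ {r} → a < r → r ≤ a + κ → ¬ (r ≡ a ⊎ r ≡ suc (a + κ))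
    clash gt _ (inj₁ refl) = <-irrefl refl gt
    clash _ le (inj₂ refl) = <-irrefl refl le
    single : ∀ {d d′ r} → Flanked a d r → Flanked a d′ r → d ≡ d′
    single (inj₁ (p , _)) (inj₁ (p′ , _)) = trans p (sym p′)
    single (inj₂ (p , _)) (inj₂ (p′ , _)) = trans p (sym p′)
    single (inj₁ (_ , gt , le)) (inj₂ (_ , e)) = contradiction e (clash gt le)
    single (inj₂ (_ , e)) (inj₁ (_ , gt , le)) = contradiction e (clash gt le)
    window : ∀ {ρ} → Flanked a 0 ρ →
      ∃ λ lo → (∀ {d r} → Flanked a d r → r ≢ ρ → lo ≤ r × r ≤ lo + κ) × (ρ < lo ⊎ lo + κ < ρ)
    window (inj₂ (_ , inj₁ refl)) = suc a , within , inj₁ ≤-refl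
      where
      within : ∀ {d r} → Flanked a d r → r ≢ a → suc a ≤ r × r ≤ suc a + κ
      within (inj₁ (_ , gt , le)) _ = gt , m≤n⇒m≤1+n le
      within (inj₂ (_ , inj₁ e)) ne = contradiction e ne
      within (inj₂ (_ , inj₂ refl)) _ = s≤s (m≤m+n a κ) , ≤-refl
    window (inj₂ (_ , inj₂ refl)) = a , within , inj₂ ≤-refl
      where
      within : ∀ {d r} → Flanked a d r → r ≢ suc (a + κ) → a ≤ r × r ≤ a + κ
      within (inj₁ (_ , gt , le)) _ = <⇒≤ gt , le
      within (inj₂ (_ , inj₁ refl)) _ = ≤-refl , m≤m+n a κ
      within (inj₂ (_ , inj₂ e)) ne = contradiction e ne

  code : ∀ {w v d r} → depth v ≡ d → pos v ≡ r → depth w ≡ d → pos w ≡ r → w ≡ v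
  code vd vr wd wr = vertex-≡ (trans wd (sym vd)) (trans wr (sym vr))

  patrol-move : ∀ {a δ ρ δ′ ρ′ Q} u v → depth u ≡ δ → pos u ≡ ρ → depth v ≡ δ′ → pos v ≡ ρ′ → u ∼ v →
    Outside a ρ → Outside a ρ′ → Visits (Patrol a δ′ ρ′) Q →
    Visits (Patrol a δ ρ) (λ d r → Patrol a δ ρ d r ⊎ Q d r)
  patrol-move {a} u v ud up vd vp adj out out′ = visits-move (patrol-spread out′) u v adj (inj₂ (ud , up))
    (λ where
      (inj₁ g) → ¬in-group (subst (Outside a) (sym vp) out′) g
      (inj₂ (d , r)) → ∼-irrefl (subst (_∼ v) (sym (code ud up d r)) adj))
    (inj₂ (vd , vp))
    (λ where
      w (inj₁ g) _ → inj₁ g , λ { refl → ¬in-group (subst (Outside a) (sym up) out) g }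
      w (inj₂ (d , r)) w≢v → contradiction (code vd vp d r) w≢v)
    (λ where
      w (inj₁ g) _ → inj₁ g
      w (inj₂ (d , r)) w≢u → contradiction (code ud up d r) w≢u)

  cycle-move : ∀ {a ρ ρ′ Q} → ρ < ℓ → ρ′ < ℓ → suc ρ′ ≡ ρ ⊎ (ρ ≡ 0 × suc ρ′ ≡ ℓ) → Outside a ρ → Outside a ρ′ →
    Visits (Patrol a 0 ρ′) Q → Visits (Patrol a 0 ρ) (λ d r → Patrol a 0 ρ d r ⊎ Q d r)
  cycle-move {ρ = ρ} {ρ′} lt lt′ next out out′ with on-cycle ρ lt | on-cycle ρ′ lt′
  ... | u , u₀ , up | v , v₀ , vp = patrol-move u v u₀ up v₀ vp (cycle-adj u₀ v₀ (adjacent next)) out out′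
    where
    adjacent : suc ρ′ ≡ ρ ⊎ (ρ ≡ 0 × suc ρ′ ≡ ℓ) → suc (pos v) ≡ pos u ⊎ (pos u ≡ 0 × suc (pos v) ≡ ℓ)
    adjacent (inj₁ e) = inj₁ (trans (cong suc vp) (trans e (sym up)))
    adjacent (inj₂ (z , e)) = inj₂ (trans up z , trans (cong suc vp) e)

  -- The alternative fixes the side of the group on which the whole path runs; `Outside` at both
  -- ends would allow it to cross beneath the group.
  descend : ∀ m {a ρ Q} → m + ρ < ℓ → m + ρ ≤ a ⊎ suc (a + κ) < ρ → Visits (Patrol a 0 ρ) Q →
    Visits (Patrol a 0 (m + ρ)) (λ d r → (d ≡ 0 × ρ ≤ r × r ≤ m + ρ) ⊎ Q d r)
  descend zero {a} {ρ} lt out vis = visits-weaken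
    (λ where
      x (inj₁ (d , lo , hi)) → inj₁ (inj₂ (d , ≤-antisym hi lo))
      x (inj₂ q) → inj₂ q)
    (visits-start vis)
  descend (suc m) {a} {ρ} lt out vis = visits-weaken
    (λ where
      x (inj₁ (d , lo , hi)) → [ (λ lt → inj₂ (inj₁ (d , lo , s≤s⁻¹ lt))) , (λ e → inj₁ (inj₂ (d , e))) ]′ (m≤n⇒m<n∨m≡n hi)
      x (inj₂ q) → inj₂ (inj₂ q))
    (cycle-move lt (<⇒≤ lt) (inj₁ refl) (here-outside out) (below-outside out)
      (descend m (<⇒≤ lt) (weaken out) vis))
    where
    here-outside : suc m + ρ ≤ a ⊎ suc (a + κ) < ρ → Outside a (suc m + ρ)
    here-outside (inj₁ le) = inj₁ le
    here-outside (inj₂ gt) = inj₂ (≤-trans gt (m≤n+m ρ (suc m)))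
    below-outside : suc m + ρ ≤ a ⊎ suc (a + κ) < ρ → Outside a (m + ρ)
    below-outside (inj₁ le) = inj₁ (<⇒≤ le)
    below-outside (inj₂ gt) = inj₂ (≤-trans gt (m≤n+m ρ m))
    weaken : suc m + ρ ≤ a ⊎ suc (a + κ) < ρ → m + ρ ≤ a ⊎ suc (a + κ) < ρ
    weaken (inj₁ le) = inj₁ (<⇒≤ le)
    weaken (inj₂ gt) = inj₂ gt

  descend₀ : ∀ m {a Q} → m < ℓ → m ≤ a → Visits (Patrol a 0 0) Q →
    Visits (Patrol a 0 m) (λ d r → (d ≡ 0 × 0 ≤ r × r ≤ m) ⊎ Q d r)
  descend₀ m {a} {Q} lt le vis =
    subst (λ m → Visits (Patrol a 0 m) (λ d r → (d ≡ 0 × 0 ≤ r × r ≤ m) ⊎ Q d r)) m+0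
      (descend m (subst (_< ℓ) (sym m+0) lt) (inj₁ (≤-trans (≤-reflexive m+0) le)) vis)
    where m+0 = +-identityʳ m

  -- What is still to be visited when the patrolling robot arrives at `2 + (a + κ)`. Cycle positions
  -- above `κ` are absent because the starting pattern and the first round cover them.
  Remaining : ℕ → Pattern
  Remaining a d r = (d ≡ 0 × a < r × r ≤ κ) ⊎ (d ≡ 1 × suc (a + κ) < r)

  -- At `a = κ′` no pendant vertex is left beyond the group, and of the cycle only position `κ` is
  -- missing; the first robot of the group steps down onto it.
  last-stop : Visits (Patrol κ′ 0 (suc (κ + κ))) (Remaining κ′)
  last-stop with on-leaf κ′ (m≤m+n κ κ) | on-cycle κ (<ℓ (m≤m+n κ (suc κ)))
  ... | u , u₁ , up | v , v₀ , vp = visits-weaken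
    (λ where
      x (inj₁ (d , lo , hi)) → inj₂ (inj₂ (d , inj₁ (≤-antisym hi lo)))
      x (inj₂ (d , gt)) → contradiction gt (≤⇒≯ (leaf-bound d)))
    (visits-move (flanked-spread κ) u v (up-adj u₁ v₀ (trans up (sym vp)))
      (inj₁ (u₁ , ≤-reflexive (sym up) , ≤-trans (≤-reflexive up) (s≤s (m≤m+n κ′ κ))))
      (λ where
        (inj₁ (d , _)) → contradiction (trans (sym v₀) d) λ ()
        (inj₂ (_ , r)) → <⇒≢ (s≤s (m≤m+n κ κ)) (trans (sym vp) r))
      (inj₂ (v₀ , inj₁ vp))
      back forth visits-here)
    where
    leaf-bound : ∀ {x} → depth x ≡ 1 → pos x ≤ κ + κ
    leaf-bound {x} d with shape x
    ... | inj₁ e = contradiction (trans (sym e) d) λ ()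
    ... | inj₂ (_ , _ , le) = le
    back : ∀ w → Flanked κ at w → w ≢ v → Patrol κ′ 0 (suc (κ + κ)) at w × w ≢ u
    back w (inj₁ (d , gt , le)) _ = inj₁ (d , <⇒≤ gt , le) , λ { refl → <-irrefl (sym up) gt }
    back w (inj₂ (d , inj₁ r)) w≢v = contradiction (code v₀ vp d r) w≢v
    back w (inj₂ (d , inj₂ r)) _ = inj₂ (d , r) , λ { refl → contradiction (trans (sym d) u₁) λ () }
    forth : ∀ w → Patrol κ′ 0 (suc (κ + κ)) at w → w ≢ u → Flanked κ at w
    forth w (inj₁ (d , gt , le)) w≢u = inj₁ (d , ≤∧≢⇒< gt (λ e → w≢u (code u₁ up d (sym e))) , le)
    forth w (inj₂ (d , r)) _ = inj₂ (d , inj₂ r)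

  wrap-around : ∀ j a {Q} → j + a ≡ κ′ → Visits (Patrol a 0 (2 + (a + κ))) Q →
    Visits (Patrol a 0 0) (λ d r → Patrol a 0 0 d r ⊎ ((d ≡ 0 × 2 + (a + κ) ≤ r × r ≤ κ + suc κ) ⊎ Q d r))
  wrap-around j a {Q} e vis = cycle-move (<ℓ z≤n) (<ℓ ≤-refl) (inj₂ (refl , sym ℓ≡)) (inj₁ z≤n)
    (inj₂ (subst (2 + (a + κ) ≤_) (sym top) (m≤n+m _ j)))
    (subst (λ m → Visits (Patrol a 0 m) (λ d r → (d ≡ 0 × 2 + (a + κ) ≤ r × r ≤ m) ⊎ Q d r)) (sym top)
      (descend j (subst (_< ℓ) top (<ℓ ≤-refl)) (inj₂ ≤-refl) vis))
    where top = trans (cong (λ m → suc m + suc (suc m)) (sym e)) (trans (round j a) (cong (λ m → j + (2 + (a + suc m))) e))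

  -- The patrolling robot enters the next tree, the first robot of the group leaves its own
  -- and goes all the way round the cycle.
  slides : ∀ j a → j + a ≡ κ′ → Visits (Patrol a 0 (2 + (a + κ))) (Remaining a)
  slides zero a refl = last-stop
  slides (suc j) a e with on-cycle (2 + (a + κ)) entry<ℓ | on-leaf (suc (a + κ)) entry<t
                        | on-leaf a (<⇒≤ (≤-<-trans (s≤s (m≤m+n a κ)) entry<t))
                        | on-cycle (suc a) (≤-<-trans (s≤s (m≤n⇒m≤1+n (m≤m+n a κ))) entry<ℓ)
    where
    entry<t : suc (a + κ) < κ + κ
    entry<t = +-monoˡ-≤ κ (s≤s (≤-trans (s≤s (m≤n+m a j)) (≤-reflexive e)))
    entry<ℓ : 2 + (a + κ) < ℓ
    entry<ℓ = <ℓ (≤-trans entry<t (+-monoʳ-≤ κ (n≤1+n κ)))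
  ... | p , p₀ , pp | p′ , p′₁ , pp′ | u , u₁ , up | v , v₀ , vp = visits-weaken
    (λ where
      x (inj₁ (d , gt , le)) → [ (λ lt → inj₂ (inj₂ (inj₂ (inj₂ (inj₂ (inj₁ (d , lt , le)))))))
                               , (λ eq → inj₂ (inj₂ (inj₁ (d , z≤n , ≤-reflexive (sym eq))))) ]′
                               (m≤n⇒m<n∨m≡n gt)
      x (inj₂ (d , gt)) → [ (λ lt → inj₂ (inj₂ (inj₂ (inj₂ (inj₂ (inj₂ (d , lt)))))))
                          , (λ eq → inj₂ (inj₁ (inj₁ (d , subst (suc a <_) eq (s≤s (s≤s (m≤m+n a κ))) , ≤-reflexive (sym eq))))) ]′
                          (m≤n⇒m<n∨m≡n gt))
    (patrol-move p p′ p₀ pp p′₁ pp′ (∼-sym {p′} (up-adj p′₁ p₀ (trans pp′ (sym pp)))) (inj₂ ≤-refl) (inj₂ ≤-refl)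
      -- No move, only a new reading of the same set: the newcomer belongs to the shifted group, and
      -- the old first robot counts as the patrol.
      (visits-≡ there-to back-to
        (patrol-move u v u₁ up v₀ vp (up-adj u₁ v₀ (trans up (sym vp))) (inj₁ ≤-refl) (inj₁ ≤-refl)
          (descend₀ (suc a) (subst (_< ℓ) vp (toℕ<n (foot v))) ≤-refl
            (wrap-around j (suc a) e′ (slides j (suc a) e′))))))
    where
    e′ : j + suc a ≡ κ′
    e′ = trans (+-suc j a) e
    there-to : ∀ d r → Patrol a 1 (2 + (a + κ)) d r → Patrol (suc a) 1 (suc a) d r
    there-to d r (inj₁ (q , gt , le)) = [ (λ lt → inj₁ (q , lt , m≤n⇒m≤1+n le)) , (λ eq → inj₂ (q , sym eq)) ]′ (m≤n⇒m<n∨m≡n gt)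
    there-to d r (inj₂ (q , refl)) = inj₁ (q , s≤s (s≤s (m≤m+n a κ)) , ≤-refl)
    back-to : ∀ d r → Patrol (suc a) 1 (suc a) d r → Patrol a 1 (2 + (a + κ)) d r
    back-to d r (inj₁ (q , gt , le)) = [ (λ lt → inj₁ (q , <⇒≤ gt , s≤s⁻¹ lt)) , (λ eq → inj₂ (q , eq)) ]′ (m≤n⇒m<n∨m≡n le)
    back-to d r (inj₂ (q , refl)) = inj₁ (q , ≤-refl , s≤s (m≤m+n a κ))

  -- The opening move takes the robot at cycle position `κ + 1` up into its pendant vertex. This
  -- completes the group, and the robot at `0` becomes the patrol.
  grand-tour : Visits (Flanked 0) (λ _ _ → ⊤)
  grand-tour with on-cycle (suc κ) (<ℓ (m≤n+m (suc κ) κ)) | on-leaf κ (m<m+n κ (s≤s z≤n))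
  ... | u , u₀ , up | v , v₁ , vp = visits-weaken (λ x _ → visited (shape x))
    (visits-move (patrol-spread (inj₁ z≤n)) u v (∼-sym {v} (up-adj v₁ u₀ (trans vp (sym up))))
      (inj₂ (u₀ , inj₂ up))
      (λ where
        (inj₁ (_ , _ , le)) → <-irrefl vp (s≤s le)
        (inj₂ (d , _)) → contradiction (trans (sym v₁) d) λ ())
      (inj₁ (v₁ , ≤-trans (s≤s z≤n) (≤-reflexive (sym vp)) , ≤-reflexive vp))
      back forth
      (wrap-around κ′ 0 (+-identityʳ κ′) (slides κ′ 0 (+-identityʳ κ′))))
    where
    back : ∀ w → Patrol 0 0 0 at w → w ≢ v → Flanked 0 at w × w ≢ u
    back w (inj₁ (d , gt , le)) w≢v =
      inj₁ (d , gt , s≤s⁻¹ (≤∧≢⇒< le λ e → w≢v (code v₁ vp d e))) ,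
      λ { refl → contradiction (trans (sym d) u₀) λ () }
    back w (inj₂ (d , r)) _ = inj₂ (d , inj₁ r) , λ { refl → contradiction (trans (sym up) r) λ () }
    forth : ∀ w → Flanked 0 at w → w ≢ u → Patrol 0 0 0 at w
    forth w (inj₁ (d , gt , le)) _ = inj₁ (d , gt , m≤n⇒m≤1+n le)
    forth w (inj₂ (d , inj₁ r)) _ = inj₂ (d , r)
    forth w (inj₂ (d , inj₂ r)) w≢u = contradiction (code u₀ up d r) w≢u
    visited : ∀ {x} → depth x ≡ 0 ⊎ (depth x ≡ 1 × 0 < pos x × pos x ≤ κ + κ) →
      Flanked 0 at x ⊎ (Patrol 0 0 0 at x ⊎
        ((depth x ≡ 0 × 2 + κ ≤ pos x × pos x ≤ κ + suc κ) ⊎ Remaining 0 at x))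
    visited {x} (inj₁ d) with pos x ≟ 0 | pos x ≤? κ | pos x ≟ suc κ
    ... | yes z | _ | _ = inj₁ (inj₂ (d , inj₁ z))
    ... | no nz | yes le | _ = inj₂ (inj₂ (inj₂ (inj₁ (d , n≢0⇒n>0 nz , le))))
    ... | no _ | no _ | yes e = inj₁ (inj₂ (d , inj₂ e))
    ... | no _ | no gt | no ne = inj₂ (inj₂ (inj₁ (d , ≤∧≢⇒< (≰⇒> gt) (ne ∘ sym) , s≤s⁻¹ (subst (pos x <_) ℓ≡ (toℕ<n (foot x))))))
    visited {x} (inj₂ (d , gt , _)) with pos x ≤? suc κ
    ... | yes le = inj₂ (inj₁ (inj₁ (d , gt , le)))
    ... | no nle = inj₂ (inj₂ (inj₂ (inj₂ (d , ≰⇒> nle))))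

  flanked? : ∀ d r → Dec (Flanked 0 d r)
  flanked? d r = ((d ≟ 1) ×-dec ((0 <? r) ×-dec (r ≤? κ))) ⊎-dec ((d ≟ 0) ×-dec ((r ≟ 0) ⊎-dec (r ≟ suc κ)))

  member? : ∀ w → Dec (Flanked 0 at w)
  member? w = flanked? (depth w) (pos w)

  start : Subset (n G)
  start = tabulate (does ∘ member?)

  start⊨ : start ⊨ Flanked 0
  start⊨ w = (λ w∈ → does⁻ (member? w) (trans (sym (lookup∘tabulate (does ∘ member?) w)) ([]=⇒lookup w∈))) ,
             λ p → lookup⇒[]= w start (trans (lookup∘tabulate (does ∘ member?) w) (dec-true (member? w) p))

  start-mobile : Mobile G start
  start-mobile = spread⇒gp (flanked-spread 0) start⊨ ,
    proj₁ tour , proj₁ (proj₂ tour) , λ x → proj₂ (proj₂ tour) x tt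
    where tour = Visits.tour grand-tour start start⊨

  start-size : κ + 2 ≤ ∣ start ∣
  start-size = subst₂ _≤_ size (length-elements start)
    (unique-length-≤ {xs = u ∷ v ∷ map leaf (allFin κ)}
      ((u≢v ∷ off u₀) ∷ off v₀ ∷ Unique.map⁺ leaf-injective (Unique.allFin⁺ κ)) sub)
    where
    first = on-cycle 0 (<ℓ z≤n)
    second = on-cycle (suc κ) (<ℓ (m≤n+m (suc κ) κ))
    u v : V
    u = proj₁ first
    v = proj₁ second
    u₀ = proj₁ (proj₂ first)
    v₀ = proj₁ (proj₂ second)
    leaf-at : (i : Fin κ) → ∃ λ v → depth v ≡ 1 × pos v ≡ suc (toℕ i)
    leaf-at i = on-leaf (toℕ i) (≤-trans (toℕ<n i) (m≤m+n κ κ))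
    leaf : Fin κ → V
    leaf i = proj₁ (leaf-at i)
    leaf-injective : ∀ {i j} → leaf i ≡ leaf j → i ≡ j
    leaf-injective {i} {j} e = toℕ-injective (suc-injective
      (trans (sym (proj₂ (proj₂ (leaf-at i)))) (trans (cong pos e) (proj₂ (proj₂ (leaf-at j))))))
    size : 2 + length (map leaf (allFin κ)) ≡ κ + 2
    size = trans (cong (2 +_) (trans (length-map leaf (allFin κ)) (length-tabulate {n = κ} id))) (+-comm 2 κ)
    u≢v : u ≢ v
    u≢v e = contradiction (trans (sym (proj₂ (proj₂ first))) (trans (cong pos e) (proj₂ (proj₂ second)))) λ ()
    off : ∀ {x} {ys : List (Fin κ)} → depth x ≡ 0 → All (x ≢_) (map leaf ys)
    off x₀ = All.tabulate λ p e → let i , _ , e′ = ∈-map⁻ leaf p in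
      contradiction (trans (sym x₀) (trans (cong depth (trans e e′)) (proj₁ (proj₂ (leaf-at i))))) λ ()
    sub : ∀ {x} → x ∈ˡ u ∷ v ∷ map leaf (allFin κ) → x ∈ˡ elements start
    sub (here refl) = ∈-elements⁺ start (proj₂ (start⊨ u) (inj₂ (u₀ , inj₁ (proj₂ (proj₂ first)))))
    sub (there (here refl)) = ∈-elements⁺ start (proj₂ (start⊨ v) (inj₂ (v₀ , inj₂ (proj₂ (proj₂ second)))))
    sub (there (there p)) with ∈-map⁻ leaf p
    ... | i , _ , refl = ∈-elements⁺ start (proj₂ (start⊨ (leaf i)) (inj₁
          (proj₁ (proj₂ (leaf-at i)) , ≤-trans (s≤s z≤n) (≤-reflexive (sym (proj₂ (proj₂ (leaf-at i))))) ,
           ≤-trans (≤-reflexive (proj₂ (proj₂ (leaf-at i)))) (toℕ<n i))))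

  comb-mob : bigCycleVertices C ≡ κ + κ → IsMob G (κ + 2)
  -- The upper bound, applied to `start` itself, turns `start-size` into an equality.
  comb-mob big = (start , start-mobile , ≤-antisym (bound start start-mobile) start-size) , bound
    where
    bound : ∀ S → Mobile G S → ∣ S ∣ ≤ κ + 2
    bound S = Upper.mobile-≤ R (suc κ) κ ℓ≡ big (s≤s z≤n)

half : ∀ {k κ} → k ≡ κ * 2 → k / 2 ≡ κ
half {κ = κ} refl = m*n/n≡m κ 2

double : ∀ κ → κ * 2 ≡ κ + κ
double κ = trans (*-comm κ 2) (cong (κ +_) (+-identityʳ κ))

theorem2p4 : ((G : Graph) (ℓ : ℕ) (C : Cycle G ℓ) → UnicyclicWith G C →
    (k : ℕ) → bigCycleVertices C ≡ k → 2 ≤ k → 2 ∣ k → 2 ∣ ℓ →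
    (m : ℕ) → IsMob G m → m ≤ k / 2 + 2)
    ×
    ((k : ℕ) → 2 ≤ k → 2 ∣ k →
    Σ Graph λ G → Σ ℕ λ ℓ → Σ (Cycle G ℓ) λ C →
    UnicyclicWith G C × bigCycleVertices C ≡ k × 2 ∣ ℓ ×
    IsMob G (k / 2 + 2))
theorem2p4 = upper , tight
  where
  upper : (G : Graph) (ℓ : ℕ) (C : Cycle G ℓ) → UnicyclicWith G C →
    (k : ℕ) → bigCycleVertices C ≡ k → 2 ≤ k → 2 ∣ k → 2 ∣ ℓ →
    (m : ℕ) → IsMob G m → m ≤ k / 2 + 2
  upper G ℓ C uni k k≡ 2≤k (divides κ eκ) (divides h eh) m ((S , mobile , size) , _) =
    subst₂ _≤_ size (cong (_+ 2) (sym (half eκ)))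
      (Upper.mobile-≤ (Unicyclic.unicyclic⇒rooted {C = C} uni) h κ (trans eh (double h))
        (trans k≡ (trans eκ (double κ))) (positive κ eκ) mobile)
    where
    positive : ∀ κ → k ≡ κ * 2 → 0 < κ
    positive zero refl = contradiction 2≤k λ ()
    positive (suc κ) _ = s≤s z≤n
  tight : (k : ℕ) → 2 ≤ k → 2 ∣ k →
    Σ Graph λ G → Σ ℕ λ ℓ → Σ (Cycle G ℓ) λ C →
    UnicyclicWith G C × bigCycleVertices C ≡ k × 2 ∣ ℓ × IsMob G (k / 2 + 2)
  tight k () (divides zero refl)
  tight k _ (divides (suc κ′) e) =
    G , ℓ , C , UniqueCycle.rooted⇒unicyclic R ,
    trans big-count (sym (trans e (double (suc κ′)))) ,
    divides (suc (suc κ′)) (sym (double (suc (suc κ′)))) ,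
    subst (λ m → IsMob G (m + 2)) (sym (half e))
      (Tour.comb-mob R κ′ refl shape vertex-≡ on-leaf big-count)
    where open Comb (suc κ′) (s≤s z≤n)
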